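{- Let $R$ be a finite commutative ring with unity $1\ne 0$, decomposed as $R\cong R_1\times\cdots\times R_s$ ($s\ge1$) with each $R_i$ a finite local ring with maximal ideal $M_i$, ordered so that $|R_1|/|M_1|\geq\cdots\geq|R_s|/|M_s|$, and suppose $|R_i|/|M_i|\equiv 1\pmod 4$ for all $i\in\{1,\ldots,s\}$. Then the quadratic unitary Cayley graph $\mathcal{G}_R$ is periodic if and only if $s=1$ and $R_1/M_1\cong\mathbb{Z}_5$.
   Context: $R^\times$ is the group of units of $R$; $Q_R=\{u^2:u\in R^\times\}$ and $T_R=Q_R\cup(-Q_R)$. The quadratic unitary Cayley graph $\mathcal{G}_R=\operatorname{Cay}(R,T_R)$ has vertex set $R$, with distinct $u,v$ adjacent iff $u-v\in T_R$. Grover walk on a finite simple graph $G$ without isolated vertices: arcs $\mathcal{A}(G)=\{(u,v),(v,u):uv\in E(G)\}$, for $a=(u,v)$ put $t(a)=v$, $a^{ -1}=(v,u)$; boundary matrix $N_{ua}=\frac{1}{\sqrt{\deg u}}\delta_{u,t(a)}$; shift matrix $S_{ab}=\delta_{a,b^{ -1}}$; time evolution matrix $U=S(2N^*N-I)$. $G$ is periodic if $U^\tau=I$ for some positive integer $\tau$. -}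

module Defs where

open import Level using (0ℓ)
open import Data.Bool using (Bool; true; false; if_then_else_; _∧_; _∨_; not)
open import Data.Nat as ℕ using (ℕ; zero; suc; _≤_)
open import Data.Nat.DivMod using (_mod_) renaming (_/_ to _/ℕ_)
open import Data.Fin using (Fin; toℕ)
open import Data.Integer using (+_)
open import Data.Rational as ℚ using (ℚ; 0ℚ; 1ℚ)
open import Data.List using (List; []; _∷_; map; concatMap; foldr)
open import Data.List.Membership.Propositional using (_∈_)
open import Data.List.Relation.Unary.Unique.Propositional using (Unique)
open import Data.Product using (Σ; ∃; _×_; _,_; proj₁; proj₂)
open import Data.Sum using (_⊎_)
open import Relation.Nullary using (¬_; does)
open import Relation.Binary.PropositionalEquality using (_≡_; _≢_)
open import Relation.Binary.Definitions using (DecidableEquality)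
open import Algebra.Core using (Op₁; Op₂)
open import Algebra.Structures using (IsCommutativeRing)

record FinCommRing : Set₁ where
  infixl 7 _*_
  infixl 6 _+_
  field
    Carrier  : Set
    _+_ _*_  : Op₂ Carrier
    -_       : Op₁ Carrier
    0# 1#    : Carrier
    isCommutativeRing : IsCommutativeRing _≡_ _+_ _*_ -_ 0# 1#
    _≟_      : DecidableEquality Carrier
    elems    : List Carrier
    complete : ∀ x → x ∈ elems
    unique   : Unique elems
    nontrivial : 1# ≢ 0#

open FinCommRing

eqB : (R : FinCommRing) → Carrier R → Carrier R → Bool
eqB R x y = does (_≟_ R x y)

countB : {A : Set} → (A → Bool) → List A → ℕ
countB p []       = 0
countB p (x ∷ xs) = if p x then suc (countB p xs) else countB p xs

anyB : {A : Set} → (A → Bool) → List A → Bool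
anyB p []       = false
anyB p (x ∷ xs) = p x ∨ anyB p xs

filterB : {A : Set} → (A → Bool) → List A → List A
filterB p []       = []
filterB p (x ∷ xs) = if p x then x ∷ filterB p xs else filterB p xs

Subset : FinCommRing → Set
Subset R = Carrier R → Bool

card : (R : FinCommRing) → Subset R → ℕ
card R P = countB P (elems R)

record IsIdeal (R : FinCommRing) (I : Subset R) : Set where
  field
    zero-mem : I (0# R) ≡ true
    +-closed : ∀ x y → I x ≡ true → I y ≡ true → I (_+_ R x y) ≡ true
    neg-closed : ∀ x → I x ≡ true → I (-_ R x) ≡ true
    *-closed : ∀ r x → I x ≡ true → I (_*_ R r x) ≡ true

_⊆_ : {R : FinCommRing} → Subset R → Subset R → Set
_⊆_ {R} I J = ∀ x → I x ≡ true → J x ≡ true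

record IsMaximalIdeal (R : FinCommRing) (M : Subset R) : Set where
  field
    ideal   : IsIdeal R M
    proper  : ∃ λ x → M x ≡ false
    maximal : ∀ (J : Subset R) → IsIdeal R J → _⊆_ {R} M J →
              _⊆_ {R} J M ⊎ (∀ x → J x ≡ true)

record IsLocalWith (R : FinCommRing) (M : Subset R) : Set where
  field
    max    : IsMaximalIdeal R M
    unique-max : ∀ (J : Subset R) → IsMaximalIdeal R J → ∀ x → J x ≡ M x

-- truncated natural division (the divisor |M| is always ≥ 1 here,
-- since 0 ∈ M)
divℕ : ℕ → ℕ → ℕ
divℕ m zero    = 0
divℕ m (suc k) = m /ℕ suc k

resSize : (R : FinCommRing) → Subset R → ℕ
resSize R M = divℕ (card R (λ _ → true)) (card R M)

record IsRingHom (R S : FinCommRing) (f : Carrier R → Carrier S) : Set where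
  field
    +-hom : ∀ x y → f (_+_ R x y) ≡ _+_ S (f x) (f y)
    *-hom : ∀ x y → f (_*_ R x y) ≡ _*_ S (f x) (f y)
    1-hom : f (1# R) ≡ 1# S

record IsProductIso (R : FinCommRing) {s : ℕ} (Rs : Fin s → FinCommRing)
                    (ψ : (i : Fin s) → Carrier R → Carrier (Rs i)) : Set where
  field
    hom        : ∀ i → IsRingHom R (Rs i) (ψ i)
    injective  : ∀ x y → (∀ i → ψ i x ≡ ψ i y) → x ≡ y
    surjective : ∀ (f : (i : Fin s) → Carrier (Rs i)) →
                 ∃ λ x → ∀ i → ψ i x ≡ f i

_+₅_ : Fin 5 → Fin 5 → Fin 5
a +₅ b = (toℕ a ℕ.+ toℕ b) mod 5

_*₅_ : Fin 5 → Fin 5 → Fin 5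
a *₅ b = (toℕ a ℕ.* toℕ b) mod 5

-- R / M ≅ ℤ₅, expressed via the first isomorphism theorem: a surjective
-- ring homomorphism φ : R → ℤ₅ whose kernel is exactly M.
record ResidueIsoZ5 (R : FinCommRing) (M : Subset R) : Set where
  field
    φ      : Carrier R → Fin 5
    +-hom  : ∀ x y → φ (_+_ R x y) ≡ φ x +₅ φ y
    *-hom  : ∀ x y → φ (_*_ R x y) ≡ φ x *₅ φ y
    1-hom  : φ (1# R) ≡ Data.Fin.suc Data.Fin.zero
    surj   : ∀ (a : Fin 5) → ∃ λ x → φ x ≡ a
    kernel : ∀ x → (φ x ≡ Data.Fin.zero) → M x ≡ true
    kernel⁻ : ∀ x → M x ≡ true → φ x ≡ Data.Fin.zero

isUnit : (R : FinCommRing) → Carrier R → Bool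
isUnit R u = anyB (λ w → eqB R (_*_ R u w) (1# R)) (elems R)

inT : (R : FinCommRing) → Carrier R → Bool
inT R x = anyB (λ w → isUnit R w ∧ (eqB R x (_*_ R w w) ∨ eqB R x (-_ R (_*_ R w w))))
               (elems R)

adjR : (R : FinCommRing) → Carrier R → Carrier R → Bool
adjR R u v = not (eqB R u v) ∧ inT R (_+_ R u (-_ R v))

-- Grover walk on a finite simple graph given by a vertex list (without
-- repetition), decidable equality and a Boolean adjacency relation.
-- Matrices indexed by arcs are functions Arc → Arc → ℚ; only their
-- entries at arcs matter (products sum over the arc list).

module Grover {V : Set} (_≟V_ : DecidableEquality V) (vs : List V)
              (adj : V → V → Bool) where

  Arc : Set
  Arc = V × V

  eqV : V → V → Bool
  eqV x y = does (x ≟V y)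

  eqA : Arc → Arc → Bool
  eqA (a₁ , a₂) (b₁ , b₂) = eqV a₁ b₁ ∧ eqV a₂ b₂

  arcs : List Arc
  arcs = concatMap (λ u → map (λ v → (u , v)) (filterB (adj u) vs)) vs

  t : Arc → V
  t = proj₂

  _⁻¹ : Arc → Arc
  (u , v) ⁻¹ = (v , u)

  deg : V → ℕ
  deg u = countB (adj u) vs

  -- 1/n (n ≥ 1 whenever used: vertices heads of arcs have degree ≥ 1)
  recip : ℕ → ℚ
  recip zero    = 0ℚ
  recip (suc n) = + 1 ℚ./ suc n

  δ : Bool → ℚ
  δ b = if b then 1ℚ else 0ℚ

  Mat : Set
  Mat = Arc → Arc → ℚ

  sumℚ : {A : Set} → (A → ℚ) → List A → ℚ
  sumℚ f = foldr (λ x acc → f x ℚ.+ acc) 0ℚ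

  -- N_{ua} N_{ub} = (1/√deg u) δ_{u,t(a)} (1/√deg u) δ_{u,t(b)}
  --              = δ_{u,t(a)} δ_{u,t(b)} / deg u
  NN : V → Arc → Arc → ℚ
  NN u a b = if eqV u (t a) ∧ eqV u (t b) then recip (deg u) else 0ℚ

  -- N*N (N is real, so N* = Nᵀ)
  NstarN : Mat
  NstarN a b = sumℚ (λ u → NN u a b) vs

  I : Mat
  I a b = δ (eqA a b)

  S : Mat
  S a b = δ (eqA a (b ⁻¹))

  _·_ : Mat → Mat → Mat
  (A · B) a b = sumℚ (λ c → A a c ℚ.* B c b) arcs

  two : ℚ
  two = + 2 ℚ./ 1

  U : Mat
  U = S · (λ a b → (two ℚ.* NstarN a b) ℚ.- I a b)

  _^_ : Mat → ℕ → Mat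
  A ^ zero  = I
  A ^ suc n = A · (A ^ n)

  Periodic : Set
  Periodic = Σ ℕ λ τ → (1 ≤ τ) ×
             (∀ a b → a ∈ arcs → b ∈ arcs → (U ^ τ) a b ≡ I a b)

PeriodicQUCG : FinCommRing → Set
PeriodicQUCG R = Grover.Periodic (_≟_ R) (elems R) (adjR R)

{-# OPTIONS --safe #-}
-- For a Grover walk on a d-regular graph with random walk P, the average F n of the n-th iterate over
-- the arcs entering a vertex obeys F (n + 2) = 2 P F (n + 1) − F n, so periodicity forces T_τ(P) = 1
-- for a Chebyshev polynomial T_τ.
--
-- Suppose that on functions pulled back along a map out of R the operator 2 P is A / f with A an integer
-- matrix satisfying A² ≡ − A modulo f. Then 2 f^τ = 2 f^τ T_τ(P) ≡ A^τ ≡ ± A modulo f, and since A has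
-- an entry 1 this forces f = 1. For the residue field of a local factor, with q = 4 e + 1 elements,
-- counting sums of two elements of T gives this with f = e (or f = 2 e if T consists of all units), so
-- q = 5. If there were two factors, both with residue field ℤ₅, then (a , b) ↦ a + 2 b would map T
-- uniformly onto ℤ₅ ∖ {0}, which gives this with f = 2 for the complete graph on ℤ₅.
--
-- Conversely, over a local ring with residue field ℤ₅ the elements of residue 1 are squares, so the graph
-- is a blow-up of the pentagon. There P only sees averages over the fibres of the residue map, these
-- averages recur with period 5, and summing up the recursion of the walk gives U²⁰ = 1.
module Submission where

-- The rigidity comes from 2 T_n(x / 2) being a monic integer polynomial: periodicity makes every
-- eigenvalue of 2 P a sum of a root of unity and its inverse, hence an algebraic integer.
-- Congruences modulo f replace this spectral argument, so that all computation stays in ℚ. The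
-- congruence A² ≡ - A has two sources. If T has index two in the units of a field with 4 e + 1
-- elements, A is strongly regular with A² + A = e (I + J), as for a Paley graph; on a complete
-- graph with n + 1 vertices A² + A = n J. Projecting to one residue field at a time cannot exclude
-- several factors with residue field ℤ₅, since each of them passes with f = 1. This is why two of
-- them are merged into a single complete graph. The period 20 is the least common multiple of 5 and
-- 4: the pentagon has the eigenvalues 2 cos(2π/5) and 2 cos(4π/5), which give fifth roots of unity,
-- while functions with mean zero on every fibre are killed by P and give the eigenvalues ± i of the
-- walk.

open import Defs
open import Level using (0ℓ)
open import Data.Bool using (Bool; true; false; if_then_else_; _∧_; _∨_; not)
open import Data.Nat as ℕ using (ℕ; zero; suc; _≤_; _%_; _/_; z≤n; s≤s)
import Data.Nat.Properties as ℕP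
open import Data.Nat.Divisibility using (divides; ∣1⇒≡1; ∣m+n∣m⇒∣n; m∣m*n)
open import Data.Nat.DivMod using (_mod_; m*n/n≡m; m≡m%n+[m/n]*n; m%n<n)
open import Data.Nat.Tactic.RingSolver using (solve-∀)
open import Data.Integer as ℤ using () renaming (+_ to pos)
import Data.Integer.Properties as ℤP
open import Data.Rational as ℚ using (ℚ; 0ℚ; 1ℚ)
import Data.Rational.Properties as ℚP
import Data.Rational.Unnormalised as ℚᵘ
import Data.Rational.Unnormalised.Properties as ℚᵘP
open import Data.Fin using (Fin; zero; suc; toℕ)
import Data.Fin.Properties as FinP
open import Data.Maybe using (just; nothing)
open import Data.Product using (Σ; ∃; _×_; _,_; proj₁; proj₂)
open import Data.Sum using (_⊎_; inj₁; inj₂)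
open import Data.List using (List; []; _∷_; map; concatMap; foldr; _++_; deduplicate; allFin)
open import Data.List.Membership.Propositional using (_∈_)
open import Data.List.Membership.Propositional.Properties using
  (∈-map⁺; ∈-map⁻; ∈-concatMap⁺; ∈-concatMap⁻; ∈-deduplicate⁺; ∈-allFin)
import Data.List.Relation.Unary.All as All
open import Data.List.Relation.Unary.AllPairs using ([]; _∷_)
open import Data.List.Relation.Unary.Any as Any using (here; there)
open import Data.List.Relation.Unary.Unique.Propositional using (Unique)
open import Data.List.Relation.Unary.Unique.Propositional.Properties using (allFin⁺)
import Data.List.Relation.Unary.Unique.DecPropositional.Properties as DecUnique
open import Function using (_∘_)
open import Function.Bundles using (_⇔_; mk⇔)
open import Algebra.Bundles using (CommutativeRing; RawRing)
open import Algebra.Core using (Op₂)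
open import Algebra.Structures using (IsCommutativeRing; IsCommutativeSemiring)
import Algebra.Properties.AbelianGroup
import Algebra.Properties.CommutativeSemigroup
open import Algebra.Properties.Group ℚP.+-0-group using () renaming (∙-cancelˡ to ℚ-+-cancelˡ)
import Algebra.Properties.Ring
import Algebra.Properties.Semiring.Mult
import Algebra.Solver.Ring
open import Algebra.Solver.Ring.AlmostCommutativeRing
  using (fromCommutativeRing; _-Raw-AlmostCommutative⟶_; Induced-equivalence)
open import Relation.Nullary using (¬_; Dec; does; yes; no; contradiction)
open import Relation.Nullary.Decidable using (dec-true; dec-false; map′; from-yes; _→-dec_; ¬?; _⊎-dec_)
open import Relation.Binary.Definitions using (DecidableEquality; WeaklyDecidable)
open import Relation.Binary.PropositionalEquality
  using (_≡_; _≢_; refl; sym; trans; cong; cong₂; subst; isEquivalence; module ≡-Reasoning)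

-- The stock ring solver is useless over an abstract ring, because it takes its
-- coefficients in the ring itself; here they are formal differences (a , b) = a − b.
module DifferenceSolver (CR : CommutativeRing 0ℓ 0ℓ) where
  open CommutativeRing CR hiding (refl; sym; trans)
  private module C = CommutativeRing CR
  open import Relation.Binary.Reasoning.Setoid setoid
  open Algebra.Properties.Ring ring using (-‿distribˡ-*; -‿distribʳ-*)
  open Algebra.Properties.AbelianGroup +-abelianGroup using (⁻¹-∙-comm; ⁻¹-involutive)
  open Algebra.Properties.Semiring.Mult semiring using (×-homo-+; ×1-homo-*) renaming (_×_ to _·_)
  open Algebra.Properties.CommutativeSemigroup +-commutativeSemigroup using (interchange)

  differences : RawRing 0ℓ 0ℓ
  differences = record
    { Carrier = ℕ × ℕ
    ; _≈_ = _≡_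
    ; _+_ = λ (a , b) (c , d) → (a ℕ.+ c) , (b ℕ.+ d)
    ; _*_ = λ (a , b) (c , d) → (a ℕ.* c ℕ.+ b ℕ.* d) , (a ℕ.* d ℕ.+ b ℕ.* c)
    ; -_ = λ (a , b) → b , a
    ; 0# = 0 , 0
    ; 1# = 1 , 0
    }

  value : ℕ × ℕ → Carrier
  value (a , b) = a · 1# - b · 1#

  value-+ : ∀ x y → value (RawRing._+_ differences x y) ≈ value x + value y
  value-+ (a , b) (c , d) = begin
    (a ℕ.+ c) · 1# - (b ℕ.+ d) · 1#            ≈⟨ +-cong (×-homo-+ 1# a c) (-‿cong (×-homo-+ 1# b d)) ⟩
    (a · 1# + c · 1#) - (b · 1# + d · 1#)      ≈⟨ +-congˡ (⁻¹-∙-comm _ _) ⟨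
    (a · 1# + c · 1#) + (- (b · 1#) - d · 1#)  ≈⟨ interchange _ _ _ _ ⟩
    value (a , b) + value (c , d)              ∎

  value-neg : ∀ x → value (RawRing.-_ differences x) ≈ - value x
  value-neg (a , b) = begin
    b · 1# - a · 1#          ≈⟨ +-comm _ _ ⟩
    - (a · 1#) + b · 1#      ≈⟨ +-congˡ (⁻¹-involutive _) ⟨
    - (a · 1#) - - (b · 1#)  ≈⟨ ⁻¹-∙-comm _ _ ⟩
    - value (a , b)          ∎

  value-* : ∀ x y → value (RawRing._*_ differences x y) ≈ value x * value y
  value-* (a , b) (c , d) = begin
    value (a ℕ.* c ℕ.+ b ℕ.* d , a ℕ.* d ℕ.+ b ℕ.* c)
      ≈⟨ value-+ (a ℕ.* c , a ℕ.* d) (b ℕ.* d , b ℕ.* c) ⟩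
    value (a ℕ.* c , a ℕ.* d) + value (b ℕ.* d , b ℕ.* c)
      ≈⟨ +-cong (scale a c d) (scale b d c) ⟩
    a · 1# * value (c , d) + b · 1# * value (d , c)
      ≈⟨ +-congˡ (*-congˡ (value-neg (c , d))) ⟩
    a · 1# * value (c , d) + b · 1# * - value (c , d)
      ≈⟨ +-congˡ (-‿distribʳ-* _ _) ⟨
    a · 1# * value (c , d) + - (b · 1# * value (c , d))
      ≈⟨ +-congˡ (-‿distribˡ-* _ _) ⟩
    a · 1# * value (c , d) + - (b · 1#) * value (c , d)
      ≈⟨ distribʳ _ _ _ ⟨
    value (a , b) * value (c , d) ∎
    where
    scale : ∀ k m n → value (k ℕ.* m , k ℕ.* n) ≈ k · 1# * value (m , n)
    scale k m n = begin
      (k ℕ.* m) · 1# - (k ℕ.* n) · 1#          ≈⟨ +-cong (×1-homo-* k m) (-‿cong (×1-homo-* k n)) ⟩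
      k · 1# * m · 1# - k · 1# * n · 1#        ≈⟨ +-congˡ (-‿distribʳ-* _ _) ⟩
      k · 1# * m · 1# + k · 1# * - (n · 1#)    ≈⟨ distribˡ _ _ _ ⟨
      k · 1# * value (m , n)                   ∎

  -- Agrees with value, but constants denote 0# and 1# definitionally.
  constant : ℕ × ℕ → Carrier
  constant (0 , 0) = 0#
  constant (1 , 0) = 1#
  constant x       = value x

  constant≈value : ∀ x → constant x ≈ value x
  constant≈value (0 , 0)           = C.sym (-‿inverseʳ 0#)
  constant≈value (1 , 0)           = C.sym (C.trans (+-cong (+-identityʳ 1#) -0≈0) (+-identityʳ 1#))
    where
    -0≈0 : - 0# ≈ 0#
    -0≈0 = C.trans (C.sym (+-identityˡ _)) (-‿inverseʳ 0#)
  constant≈value (0 , suc b)       = C.refl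
  constant≈value (1 , suc b)       = C.refl
  constant≈value (suc (suc a) , b) = C.refl

  morphism : differences -Raw-AlmostCommutative⟶ fromCommutativeRing CR
  morphism = record
    { ⟦_⟧ = constant
    ; +-homo = λ x y → C.trans (constant≈value (RawRing._+_ differences x y))
        (C.trans (value-+ x y) (C.sym (+-cong (constant≈value x) (constant≈value y))))
    ; *-homo = λ x y → C.trans (constant≈value (RawRing._*_ differences x y))
        (C.trans (value-* x y) (C.sym (*-cong (constant≈value x) (constant≈value y))))
    ; -‿homo = λ x → C.trans (constant≈value (RawRing.-_ differences x))
        (C.trans (value-neg x) (C.sym (-‿cong (constant≈value x))))
    ; 0-homo = C.refl
    ; 1-homo = C.refl
    }

  -- Cross-addition decides equality of formal differences: (a , b) is padded by (d , d) and, after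
  -- regrouping, stripped of (b , b), both of value zero. In positive characteristic different
  -- differences may still agree, hence the weak decision.
  equal-differences? : WeaklyDecidable (Induced-equivalence morphism)
  equal-differences? (a , b) (c , d) with a ℕ.+ d ℕ.≟ c ℕ.+ b
  ... | no _ = nothing
  ... | yes eq = just (C.trans (constant≈value (a , b)) (C.trans (begin
    value (a , b)                                      ≈⟨ +-identityʳ _ ⟨
    value (a , b) + 0#                                 ≈⟨ +-congˡ (-‿inverseʳ _) ⟨
    value (a , b) + value (d , d)                      ≈⟨ value-+ (a , b) (d , d) ⟨
    value (a ℕ.+ d , b ℕ.+ d)                          ≡⟨ cong (λ n → n · 1# - (b ℕ.+ d) · 1#) eq ⟩
    value (c ℕ.+ b , b ℕ.+ d)                          ≈⟨ value-+ (c , b) (b , d) ⟩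
    value (c , b) + value (b , d)                      ≈⟨ interchange _ _ _ _ ⟩
    (c · 1# + b · 1#) + (- (b · 1#) + - (d · 1#))      ≈⟨ +-congˡ (+-comm _ _) ⟩
    (c · 1# + b · 1#) + (- (d · 1#) + - (b · 1#))      ≈⟨ interchange _ _ _ _ ⟩
    value (c , d) + value (b , b)                      ≈⟨ +-congˡ (-‿inverseʳ _) ⟩
    value (c , d) + 0#                                 ≈⟨ +-identityʳ _ ⟩
    value (c , d)                                      ∎) (C.sym (constant≈value (c , d)))))

  open Algebra.Solver.Ring differences (fromCommutativeRing CR) morphism equal-differences? public
    using (solve; _:=_; _:+_; _:*_; _:-_; :-_; con)

-- Boolean predicates and search

Bool-ext : ∀ {a b} → (a ≡ true → b ≡ true) → (b ≡ true → a ≡ true) → a ≡ b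
Bool-ext {true}  {b}     f g = sym (f refl)
Bool-ext {false} {true}  f g = g refl
Bool-ext {false} {false} f g = refl

∧-true : ∀ {a b} → a ≡ true → b ≡ true → a ∧ b ≡ true
∧-true refl refl = refl

∧-trueˡ : ∀ {a b} → a ∧ b ≡ true → a ≡ true
∧-trueˡ {true} _ = refl

∧-trueʳ : ∀ {a b} → a ∧ b ≡ true → b ≡ true
∧-trueʳ {true} p = p

∨-true : ∀ {a b} → a ∨ b ≡ true → a ≡ true ⊎ b ≡ true
∨-true {true}  p = inj₁ refl
∨-true {false} p = inj₂ p

∨-trueˡ : ∀ {a b} → a ≡ true → a ∨ b ≡ true
∨-trueˡ refl = refl

∨-trueʳ : ∀ {a b} → b ≡ true → a ∨ b ≡ true
∨-trueʳ {true}  _ = refl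
∨-trueʳ {false} p = p

not-true : ∀ {a} → not a ≡ true → a ≢ true
not-true {true} () _
not-true {false} _ ()

not-true⁻ : ∀ {a} → a ≢ true → not a ≡ true
not-true⁻ {true} p = contradiction refl p
not-true⁻ {false} _ = refl

true-or : ∀ a → a ≡ true ⊎ a ≢ true
true-or true = inj₁ refl
true-or false = inj₂ λ ()

≢true : ∀ {a} → a ≢ true → a ≡ false
≢true {true} p = contradiction refl p
≢true {false} p = refl

false≢true : ∀ {a} → a ≡ false → a ≢ true
false≢true refl ()

anyB-true : ∀ {A : Set} (p : A → Bool) xs → anyB p xs ≡ true → ∃ λ x → x ∈ xs × p x ≡ true
anyB-true p (x ∷ xs) h with ∨-true {p x} h
... | inj₁ q = x , here refl , q
... | inj₂ q with anyB-true p xs q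
...   | y , y∈ , py = y , there y∈ , py

anyB-intro : ∀ {A : Set} (p : A → Bool) {xs x} → x ∈ xs → p x ≡ true → anyB p xs ≡ true
anyB-intro p (here refl) q = ∨-trueˡ q
anyB-intro p (there x∈) q = ∨-trueʳ (anyB-intro p x∈ q)

-- Finite sums

-- The fields are named as in `FinCommRing`, so that `enumeration` can copy them; the same sums then
-- range over rings, residue classes and `Fin 5`.
record Enumeration (A : Set) : Set where
  field
    _≟_      : DecidableEquality A
    elems    : List A
    complete : ∀ x → x ∈ elems
    unique   : Unique elems

  _==_ : A → A → Bool
  x == y = does (x ≟ y)

  ==-sound : ∀ {x y} → (x == y) ≡ true → x ≡ y
  ==-sound {x} {y} p with x ≟ y
  ... | yes q = q
  ==-sound () | no _

  ==-complete : ∀ {x y} → x ≡ y → (x == y) ≡ true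
  ==-complete {x} {y} = dec-true (x ≟ y)

  ≠-false : ∀ {x y} → x ≢ y → (x == y) ≡ false
  ≠-false {x} {y} = dec-false (x ≟ y)

  any : (A → Bool) → Bool
  any p = anyB p elems

  any-sound : ∀ p → any p ≡ true → ∃ λ x → p x ≡ true
  any-sound p h with anyB-true p elems h
  ... | x , _ , q = x , q

  any-complete : ∀ p {x} → p x ≡ true → any p ≡ true
  any-complete p {x} = anyB-intro p (complete x)

  search : ∀ p → (∃ λ x → p x ≡ true) ⊎ (∀ x → p x ≡ false)
  search p with true-or (any p)
  ... | inj₁ h = inj₁ (any-sound p h)
  ... | inj₂ h = inj₂ λ x → ≢true λ q → h (any-complete p q)

enumeration : (R : FinCommRing) → Enumeration (FinCommRing.Carrier R)
enumeration R = record { FinCommRing R }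

-- The values lie in ℕ for counting, in ℚ for the walk, and in `FiveElements` in the ring itself.
module Summation {K : Set} {_+_ _*_ : Op₂ K} {0# 1# : K}
                 (isCommutativeSemiring : IsCommutativeSemiring _≡_ _+_ _*_ 0# 1#) where
  open IsCommutativeSemiring isCommutativeSemiring
    using (+-identityˡ; +-identityʳ; +-assoc; +-comm; *-identityˡ; *-identityʳ; *-assoc; *-comm;
           distribˡ; distribʳ; zeroˡ; zeroʳ)
  open ≡-Reasoning

  private variable
    A B : Set

  sum : (A → K) → List A → K
  sum f = foldr (λ x acc → f x + acc) 0#

  ind : Bool → K
  ind b = if b then 1# else 0#

  ind-∧ : ∀ a b → ind (a ∧ b) ≡ ind a * ind b
  ind-∧ true  b = sym (*-identityˡ _)
  ind-∧ false b = sym (zeroˡ _)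

  interchange : ∀ a b c d → (a + b) + (c + d) ≡ (a + c) + (b + d)
  interchange a b c d = begin
    (a + b) + (c + d)  ≡⟨ +-assoc a b _ ⟩
    a + (b + (c + d))  ≡⟨ cong (a +_) (+-assoc b c d) ⟨
    a + ((b + c) + d)  ≡⟨ cong (λ x → a + (x + d)) (+-comm b c) ⟩
    a + ((c + b) + d)  ≡⟨ cong (a +_) (+-assoc c b d) ⟩
    a + (c + (b + d))  ≡⟨ +-assoc a c _ ⟨
    (a + c) + (b + d)  ∎

  *-swap : ∀ a b c → a * (b * c) ≡ b * (a * c)
  *-swap a b c = begin
    a * (b * c)  ≡⟨ *-assoc a b c ⟨
    (a * b) * c  ≡⟨ cong (_* c) (*-comm a b) ⟩
    (b * a) * c  ≡⟨ *-assoc b a c ⟩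
    b * (a * c)  ∎

  sum-cong-∈ : ∀ {f g : A → K} xs → (∀ {x} → x ∈ xs → f x ≡ g x) → sum f xs ≡ sum g xs
  sum-cong-∈ []       h = refl
  sum-cong-∈ (x ∷ xs) h = cong₂ _+_ (h (here refl)) (sum-cong-∈ xs (h ∘ there))

  sum-cong : ∀ {f g : A → K} xs → (∀ x → f x ≡ g x) → sum f xs ≡ sum g xs
  sum-cong xs h = sum-cong-∈ xs λ {x} _ → h x

  sum-0 : ∀ (xs : List A) → sum (λ _ → 0#) xs ≡ 0#
  sum-0 []       = refl
  sum-0 (x ∷ xs) = trans (+-identityˡ _) (sum-0 xs)

  sum-+ : ∀ (f g : A → K) xs → sum (λ x → f x + g x) xs ≡ sum f xs + sum g xs
  sum-+ f g []       = sym (+-identityˡ 0#)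
  sum-+ f g (x ∷ xs) = trans (cong ((f x + g x) +_) (sum-+ f g xs)) (interchange _ _ _ _)

  sum-*ˡ : ∀ c (f : A → K) xs → sum (λ x → c * f x) xs ≡ c * sum f xs
  sum-*ˡ c f []       = sym (zeroʳ c)
  sum-*ˡ c f (x ∷ xs) = trans (cong ((c * f x) +_) (sum-*ˡ c f xs)) (sym (distribˡ c _ _))

  sum-*ʳ : ∀ c (f : A → K) xs → sum (λ x → f x * c) xs ≡ sum f xs * c
  sum-*ʳ c f xs = begin
    sum (λ x → f x * c) xs  ≡⟨ sum-cong xs (λ x → *-comm (f x) c) ⟩
    sum (λ x → c * f x) xs  ≡⟨ sum-*ˡ c f xs ⟩
    c * sum f xs            ≡⟨ *-comm c _ ⟩
    sum f xs * c            ∎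

  sum-swap : ∀ (f : A → B → K) xs ys →
             sum (λ x → sum (f x) ys) xs ≡ sum (λ y → sum (λ x → f x y) xs) ys
  sum-swap f []       ys = sym (sum-0 ys)
  sum-swap f (x ∷ xs) ys = trans (cong (sum (f x) ys +_) (sum-swap f xs ys)) (sym (sum-+ (f x) _ ys))

  sum-++ : ∀ (f : A → K) xs ys → sum f (xs ++ ys) ≡ sum f xs + sum f ys
  sum-++ f []       ys = sym (+-identityˡ _)
  sum-++ f (x ∷ xs) ys = trans (cong (f x +_) (sum-++ f xs ys)) (sym (+-assoc _ _ _))

  sum-map : ∀ (f : B → K) (g : A → B) xs → sum f (map g xs) ≡ sum (f ∘ g) xs
  sum-map f g []       = refl
  sum-map f g (x ∷ xs) = cong (f (g x) +_) (sum-map f g xs)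

  sum-concatMap : ∀ (f : B → K) (g : A → List B) xs →
                  sum f (concatMap g xs) ≡ sum (λ x → sum f (g x)) xs
  sum-concatMap f g []       = refl
  sum-concatMap f g (x ∷ xs) =
    trans (sum-++ f (g x) (concatMap g xs)) (cong (sum f (g x) +_) (sum-concatMap f g xs))

  sum-filterB : ∀ (f : A → K) p xs → sum f (filterB p xs) ≡ sum (λ x → ind (p x) * f x) xs
  sum-filterB f p [] = refl
  sum-filterB f p (x ∷ xs) with p x
  ... | true  = cong₂ _+_ (sym (*-identityˡ _)) (sum-filterB f p xs)
  ... | false = trans (sum-filterB f p xs) (sym (trans (cong₂ _+_ (zeroˡ _) refl) (+-identityˡ _)))

  module _ (E : Enumeration A) where
    open Enumeration E

    ∑ : (A → K) → K
    ∑ f = sum f elems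

    private
      sum-δ-∉ : ∀ {a} (f : A → K) xs → (∀ {x} → x ∈ xs → x ≢ a) → sum (λ x → ind (x == a) * f x) xs ≡ 0#
      sum-δ-∉ f xs h = trans
        (sum-cong-∈ xs λ {x} x∈ → trans (cong (λ b → ind b * f x) (≠-false (h x∈))) (zeroˡ _)) (sum-0 xs)

      sum-δ-∈ : ∀ {a} (f : A → K) {xs} → Unique xs → a ∈ xs → sum (λ x → ind (x == a) * f x) xs ≡ f a
      sum-δ-∈ {a} f {x ∷ xs} (x∉ ∷ _) (here refl) = begin
        (ind (a == a) * f a) + sum (λ x → ind (x == a) * f x) xs
          ≡⟨ cong₂ _+_ (cong (λ b → ind b * f a) (==-complete refl))
                       (sum-δ-∉ f xs λ y∈ y≡a → All.lookup x∉ y∈ (sym y≡a)) ⟩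
        (1# * f a) + 0#  ≡⟨ +-identityʳ _ ⟩
        1# * f a         ≡⟨ *-identityˡ _ ⟩
        f a              ∎
      sum-δ-∈ {a} f {x ∷ xs} (x∉ ∷ u) (there a∈) = begin
        (ind (x == a) * f x) + sum (λ x → ind (x == a) * f x) xs
          ≡⟨ cong₂ _+_ (cong (λ b → ind b * f x) (≠-false (All.lookup x∉ a∈))) (sum-δ-∈ f u a∈) ⟩
        (0# * f x) + f a  ≡⟨ cong (_+ f a) (zeroˡ _) ⟩
        0# + f a          ≡⟨ +-identityˡ _ ⟩
        f a               ∎

    ∑-δ : ∀ a (f : A → K) → ∑ (λ x → ind (x == a) * f x) ≡ f a
    ∑-δ a f = sum-δ-∈ f unique (complete a)

    ∑-δ′ : ∀ a (f : A → K) → ∑ (λ x → ind (a == x) * f x) ≡ f a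
    ∑-δ′ a f = trans (sum-cong elems λ x → cong (λ b → ind b * f x)
                        (Bool-ext (==-complete ∘ sym ∘ ==-sound) (==-complete ∘ sym ∘ ==-sound)))
                     (∑-δ a f)

    ∑-δ-1 : ∀ a → ∑ (λ x → ind (x == a)) ≡ 1#
    ∑-δ-1 a = trans (sum-cong elems λ x → sym (*-identityʳ _)) (∑-δ a λ _ → 1#)

  -- Expand f (π x) as the sum over y of [π x = y] f y and swap the sums. This is how sums over the
  -- ring descend to a quotient.
  ∑-fibre : (EA : Enumeration A) (EB : Enumeration B) (π : A → B) (w : A → K) (f : B → K) →
            let open Enumeration EB in
            ∑ EA (λ x → w x * f (π x)) ≡ ∑ EB (λ y → ∑ EA (λ x → w x * ind (π x == y)) * f y)
  ∑-fibre EA EB π w f = begin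
    ∑ EA (λ x → w x * f (π x))
      ≡⟨ sum-cong xs (λ x → cong (w x *_) (sym (∑-δ′ EB (π x) f))) ⟩
    ∑ EA (λ x → w x * ∑ EB (λ y → ind (π x == y) * f y))
      ≡⟨ sum-cong xs (λ x → sym (sum-*ˡ (w x) _ ys)) ⟩
    ∑ EA (λ x → ∑ EB (λ y → w x * (ind (π x == y) * f y)))
      ≡⟨ sum-swap _ xs ys ⟩
    ∑ EB (λ y → ∑ EA (λ x → w x * (ind (π x == y) * f y)))
      ≡⟨ sum-cong ys (λ y → trans (sum-cong xs (λ x → sym (*-assoc _ _ _))) (sum-*ʳ (f y) _ xs)) ⟩
    ∑ EB (λ y → ∑ EA (λ x → w x * ind (π x == y)) * f y)
      ∎
    where
    xs = Enumeration.elems EA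
    ys = Enumeration.elems EB
    open Enumeration EB using (_==_)

  ∑-fibre-1 : (EA : Enumeration A) (EB : Enumeration B) (π : A → B) (f : B → K) →
              let open Enumeration EB in
              ∑ EA (f ∘ π) ≡ ∑ EB (λ y → ∑ EA (λ x → ind (π x == y)) * f y)
  ∑-fibre-1 EA EB π f = begin
    ∑ EA (f ∘ π)
      ≡⟨ sum-cong (Enumeration.elems EA) (λ x → sym (*-identityˡ _)) ⟩
    ∑ EA (λ x → 1# * f (π x))
      ≡⟨ ∑-fibre EA EB π (λ _ → 1#) f ⟩
    ∑ EB (λ y → ∑ EA (λ x → 1# * ind (π x == y)) * f y)
      ≡⟨ sum-cong (Enumeration.elems EB)
           (λ y → cong (_* f y) (sum-cong (Enumeration.elems EA) λ x → *-identityˡ _)) ⟩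
    ∑ EB (λ y → ∑ EA (λ x → ind (π x == y)) * f y) ∎
    where open Enumeration EB using (_==_)

  -- Every fibre of a bijection is a single point, so `∑-fibre-1` has all weights 1.
  ∑-reindex : (EA : Enumeration A) (EB : Enumeration B) (σ : A → B) (σ⁻¹ : B → A) →
              (∀ x → σ⁻¹ (σ x) ≡ x) → (∀ y → σ (σ⁻¹ y) ≡ y) →
              (f : B → K) → ∑ EA (f ∘ σ) ≡ ∑ EB f
  ∑-reindex EA EB σ σ⁻¹ leftInv rightInv f = trans (∑-fibre-1 EA EB σ f)
    (sum-cong (Enumeration.elems EB) λ y → begin
      ∑ EA (λ x → ind (σ x ==ᴮ y)) * f y
        ≡⟨ cong (_* f y) (sum-cong (Enumeration.elems EA) λ x → cong ind (Bool-ext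
             (λ p → A.==-complete (trans (sym (leftInv x)) (cong σ⁻¹ (B.==-sound p))))
             (λ p → B.==-complete (trans (cong σ (A.==-sound p)) (rightInv y))))) ⟩
      ∑ EA (λ x → ind (x ==ᴬ σ⁻¹ y)) * f y  ≡⟨ cong (_* f y) (∑-δ-1 EA _) ⟩
      1# * f y                             ≡⟨ *-identityˡ _ ⟩
      f y                                  ∎)
    where
    module A = Enumeration EA
    module B = Enumeration EB
    _==ᴬ_ = A._==_
    _==ᴮ_ = B._==_

-- Natural numbers inside ℚ, and counting

module ∑ℕ = Summation ℕP.+-*-isCommutativeSemiring
module ∑ℚ = Summation (IsCommutativeRing.isCommutativeSemiring ℚP.+-*-isCommutativeRing)
module ℚ-solver = DifferenceSolver ℚP.+-*-commutativeRing

-- Kept opaque so that rational arithmetic on numerals is never evaluated during conversion checking.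
opaque
  ι : ℕ → ℚ
  ι zero    = 0ℚ
  ι (suc n) = 1ℚ ℚ.+ ι n

  ι-+ : ∀ m n → ι (m ℕ.+ n) ≡ ι m ℚ.+ ι n
  ι-+ zero    n = sym (ℚP.+-identityˡ (ι n))
  ι-+ (suc m) n = trans (cong (1ℚ ℚ.+_) (ι-+ m n)) (sym (ℚP.+-assoc 1ℚ (ι m) (ι n)))

  ι-* : ∀ m n → ι (m ℕ.* n) ≡ ι m ℚ.* ι n
  ι-* zero    n = sym (ℚP.*-zeroˡ (ι n))
  ι-* (suc m) n = begin
    ι (n ℕ.+ m ℕ.* n)             ≡⟨ ι-+ n (m ℕ.* n) ⟩
    ι n ℚ.+ ι (m ℕ.* n)           ≡⟨ cong₂ ℚ._+_ (sym (ℚP.*-identityˡ (ι n))) (ι-* m n) ⟩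
    1ℚ ℚ.* ι n ℚ.+ ι m ℚ.* ι n    ≡⟨ ℚP.*-distribʳ-+ (ι n) 1ℚ (ι m) ⟨
    (1ℚ ℚ.+ ι m) ℚ.* ι n          ∎
    where open ≡-Reasoning

  ι-ind : ∀ b → ι (∑ℕ.ind b) ≡ ∑ℚ.ind b
  ι-ind true  = ℚP.+-identityʳ 1ℚ
  ι-ind false = refl

  ι-sum : ∀ {A : Set} (f : A → ℕ) xs → ι (∑ℕ.sum f xs) ≡ ∑ℚ.sum (ι ∘ f) xs
  ι-sum f []       = refl
  ι-sum f (x ∷ xs) = trans (ι-+ (f x) _) (cong (ι (f x) ℚ.+_) (ι-sum f xs))

  ι-∑-ind : ∀ {A : Set} (E : Enumeration A) (p : A → Bool) →
            ι (∑ℕ.∑ E (∑ℕ.ind ∘ p)) ≡ ∑ℚ.∑ E (∑ℚ.ind ∘ p)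
  ι-∑-ind E p = trans (ι-sum (∑ℕ.ind ∘ p) (Enumeration.elems E)) (∑ℚ.sum-cong (Enumeration.elems E) λ x → ι-ind (p x))

  ι-nonneg : ∀ n → 0ℚ ℚ.≤ ι n
  ι-nonneg zero    = ℚP.≤-refl
  ι-nonneg (suc n) = ℚP.+-mono-≤ {0ℚ} {1ℚ} {0ℚ} (ℚP.nonNegative⁻¹ 1ℚ) (ι-nonneg n)

  ι-suc≢0 : ∀ n → ι (suc n) ≢ 0ℚ
  ι-suc≢0 n eq = ℚP.<-irrefl (sym eq) (ℚP.+-mono-<-≤ {0ℚ} {1ℚ} {0ℚ} (ℚP.positive⁻¹ 1ℚ) (ι-nonneg n))

  ι-injective : ∀ m n → ι m ≡ ι n → m ≡ n
  ι-injective zero    zero    eq = refl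
  ι-injective zero    (suc n) eq = contradiction (sym eq) (ι-suc≢0 n)
  ι-injective (suc m) zero    eq = contradiction eq (ι-suc≢0 m)
  ι-injective (suc m) (suc n) eq = cong suc (ι-injective m n (ℚ-+-cancelˡ 1ℚ _ _ eq))

  -- The quotient `ℚ./` cancels a gcd, which does not compute for a variable denominator.
  -- Unnormalised rationals expose numerator and denominator, and `1/suc*ι` is proved there.
  toℚᵘ-ι : ∀ n → ℚ.toℚᵘ (ι n) ℚᵘ.≃ ℚᵘ.mkℚᵘ (pos n) 0
  toℚᵘ-ι zero    = ℚᵘP.≃-refl
  toℚᵘ-ι (suc n) = ℚᵘP.≃-trans (ℚP.toℚᵘ-homo-+ 1ℚ (ι n))
    (ℚᵘP.≃-trans (ℚᵘP.+-congʳ (ℚ.toℚᵘ 1ℚ) (toℚᵘ-ι n))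
      (ℚᵘ.*≡* (trans (ℤP.*-identityʳ _) (trans (cong (λ k → (pos 1) ℤ.+ k) (ℤP.*-identityʳ (pos n))) (sym (ℤP.*-identityʳ (pos (suc n))))))))

  1/suc*ι : ∀ n → (pos 1 ℚ./ suc n) ℚ.* ι (suc n) ≡ 1ℚ
  1/suc*ι n = ℚP.toℚᵘ-injective
    (ℚᵘP.≃-trans (ℚP.toℚᵘ-homo-* (pos 1 ℚ./ suc n) (ι (suc n)))
    (ℚᵘP.≃-trans (ℚᵘP.*-cong (ℚP.toℚᵘ-fromℚᵘ (ℚᵘ.mkℚᵘ (pos 1) n)) (toℚᵘ-ι (suc n)))
      (ℚᵘ.*≡* (trans (ℤP.*-identityʳ _) (cong (λ k → (pos 1) ℤ.* (pos k)) (sym (ℕP.*-identityʳ (suc n))))))))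

  ι-0 : ι 0 ≡ 0ℚ
  ι-0 = refl

  ι-1 : ι 1 ≡ 1ℚ
  ι-1 = ℚP.+-identityʳ 1ℚ

  ι-2 : ι 2 ≡ pos 2 ℚ./ 1
  ι-2 = refl

ι-2-* : ∀ x → ι 2 ℚ.* x ≡ x ℚ.+ x
ι-2-* x = trans (cong (ℚ._* x) (trans (ι-+ 1 1) (cong₂ ℚ._+_ ι-1 ι-1)))
  (solve 1 (λ x → (con (1 , 0) :+ con (1 , 0)) :* x := x :+ x) refl x)
  where open ℚ-solver using (solve; con; _:=_; _:+_; _:*_)

countB-sum : ∀ {A : Set} (p : A → Bool) xs → countB p xs ≡ ∑ℕ.sum (∑ℕ.ind ∘ p) xs
countB-sum p [] = refl
countB-sum p (x ∷ xs) with p x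
... | true  = cong suc (countB-sum p xs)
... | false = countB-sum p xs

sum-mono : ∀ {A : Set} {f g : A → ℕ} xs → (∀ x → f x ℕ.≤ g x) → ∑ℕ.sum f xs ℕ.≤ ∑ℕ.sum g xs
sum-mono []       h = z≤n
sum-mono (x ∷ xs) h = ℕP.+-mono-≤ (h x) (sum-mono xs h)

-- A strict inequality at one entry could not be made up at the others. With f constantly 0 this
-- says that a vanishing sum has only vanishing terms; otherwise it serves as the pigeonhole
-- principle.
sum-tight : ∀ {A : Set} {f g : A → ℕ} xs → (∀ x → f x ℕ.≤ g x) → ∑ℕ.sum f xs ≡ ∑ℕ.sum g xs →
            ∀ {x} → x ∈ xs → f x ≡ g x
sum-tight {f = f} {g = g} (y ∷ ys) h eq x∈ = go x∈
  where
  head-eq : f y ≡ g y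
  head-eq = ℕP.≤-antisym (h y) (ℕP.+-cancelʳ-≤ (∑ℕ.sum g ys) _ _
    (ℕP.≤-trans (ℕP.≤-reflexive (sym eq)) (ℕP.+-monoʳ-≤ (f y) (sum-mono ys h))))
  go : ∀ {x} → x ∈ y ∷ ys → f x ≡ g x
  go (here refl) = head-eq
  go (there x∈)  = sum-tight ys h
    (ℕP.+-cancelˡ-≡ (f y) _ _ (trans eq (cong (ℕ._+ _) (sym head-eq)))) x∈

size : ∀ {A : Set} → Enumeration A → ℕ
size E = ∑ℕ.∑ E λ _ → 1

-- Fibres of an injection have at most one element, and their sizes add up to the size of B, so
-- `sum-tight` makes every one of them exactly 1.
injective⇒surjective : ∀ {A B : Set} (EA : Enumeration A) (EB : Enumeration B) → size EA ≡ size EB →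
  (f : A → B) → (∀ {x y} → f x ≡ f y → x ≡ y) → ∀ y → ∃ λ x → f x ≡ y
injective⇒surjective EA EB same f f-inj y = fromFibre (sum-tight (Enumeration.elems EB) fibre≤1 total (B.complete y))
  where
  module A = Enumeration EA
  module B = Enumeration EB
  open ∑ℕ

  fibre : _ → ℕ
  fibre y = ∑ EA λ x → ind (f x B.== y)

  fibre-value : ∀ y → (fibre y ≡ 1 × ∃ λ x → f x ≡ y) ⊎ fibre y ≡ 0
  fibre-value y with A.search (λ x → f x B.== y)
  ... | inj₁ (x , fx) = inj₁ (trans (sum-cong A.elems λ x′ → cong ind (Bool-ext
          (λ p → A.==-complete (f-inj (trans (B.==-sound p) (sym (B.==-sound fx)))))
          (λ p → subst (λ z → (f z B.== y) ≡ true) (sym (A.==-sound p)) fx))) (∑-δ-1 EA x)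
        , x , B.==-sound fx)
  ... | inj₂ none = inj₂ (trans (sum-cong A.elems λ x → cong ind (none x)) (sum-0 A.elems))

  fibre≤1 : ∀ y → fibre y ℕ.≤ 1
  fibre≤1 y with fibre-value y
  ... | inj₁ (eq , _) = ℕP.≤-reflexive eq
  ... | inj₂ eq       = ℕP.≤-trans (ℕP.≤-reflexive eq) z≤n

  total : ∑ EB fibre ≡ ∑ EB λ _ → 1
  total = trans (sum-cong B.elems λ y → sym (ℕP.*-identityʳ _))
                (trans (sym (∑-fibre-1 EA EB f λ _ → 1)) same)

  fromFibre : fibre y ≡ 1 → ∃ λ x → f x ≡ y
  fromFibre eq with fibre-value y
  ... | inj₁ (_ , w) = w
  ... | inj₂ eq′ with () ← trans (sym eq) eq′

-- The Grover walk

filterB-∈⁺ : ∀ {A : Set} (p : A → Bool) {xs x} → x ∈ xs → p x ≡ true → x ∈ filterB p xs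
filterB-∈⁺ p {y ∷ ys} (here refl) q with p y
... | true = here refl
filterB-∈⁺ p {y ∷ ys} (here refl) () | false
filterB-∈⁺ p {y ∷ ys} (there x∈) q with p y
... | true = there (filterB-∈⁺ p x∈ q)
... | false = filterB-∈⁺ p x∈ q

filterB-∈⁻ : ∀ {A : Set} (p : A → Bool) xs {x} → x ∈ filterB p xs → p x ≡ true
filterB-∈⁻ p (y ∷ ys) x∈ with p y in eq
filterB-∈⁻ p (y ∷ ys) (here refl) | true = eq
filterB-∈⁻ p (y ∷ ys) (there x∈)  | true = filterB-∈⁻ p ys x∈
... | false = filterB-∈⁻ p ys x∈

module Walk {V : Set} (E : Enumeration V) (adj : V → V → Bool)
            (adj-sym : ∀ u v → adj u v ≡ adj v u) where
  open Enumeration E using (_==_; elems; complete; ==-sound; ==-complete)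
  open Grover (Enumeration._≟_ E) elems adj
  open ∑ℚ
  open ≡-Reasoning
  open import Data.Rational using (_+_; _*_; _-_; -_)
  open ℚ-solver using (solve; con; _:=_; _:+_; _:*_; _:-_; :-_)

  double-minus : ∀ x → ι 2 * x - x ≡ x
  double-minus x = trans (cong (_- x) (ι-2-* x)) (solve 1 (λ x → x :+ x :- x := x) refl x)

  arcs⁺ : ∀ {u v} → adj u v ≡ true → (u , v) ∈ arcs
  arcs⁺ {u} {v} p = ∈-concatMap⁺ (λ u → map (u ,_) (filterB (adj u) elems))
    (Any.map (λ { refl → ∈-map⁺ (u ,_) (filterB-∈⁺ (adj u) (complete v) p) }) (complete u))

  arcs⁻ : ∀ {u v} → (u , v) ∈ arcs → adj u v ≡ true
  arcs⁻ a∈ with Any.satisfied (∈-concatMap⁻ (λ u → map (u ,_) (filterB (adj u) elems)) {xs = elems} a∈)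
  ... | u′ , a∈′ with ∈-map⁻ (u′ ,_) a∈′
  ...   | v′ , v∈ , refl = filterB-∈⁻ (adj u′) elems v∈

  sum-arcs : ∀ h → sum h arcs ≡ ∑ E λ u → ∑ E λ v → ind (adj u v) * h (u , v)
  sum-arcs h = trans (sum-concatMap h _ elems) (sum-cong elems λ u →
    trans (sum-map h (u ,_) (filterB (adj u) elems)) (sum-filterB (λ v → h (u , v)) (adj u) elems))

  ∑∑-δ : ∀ a b (h : Arc → ℚ) →
         (∑ E λ x → ∑ E λ y → ind (adj x y) * ((ind (a == x) * ind (b == y)) * h (x , y)))
         ≡ ind (adj a b) * h (a , b)
  ∑∑-δ a b h = begin
    (∑ E λ x → ∑ E λ y → ind (adj x y) * ((ind (a == x) * ind (b == y)) * h (x , y)))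
      ≡⟨ sum-cong elems (λ x → trans
           (sum-cong elems λ y → solve 4 (λ i j k h → i :* ((j :* k) :* h) := j :* (k :* (i :* h))) refl
              (ind (adj x y)) (ind (a == x)) (ind (b == y)) (h (x , y)))
           (trans (sum-*ˡ (ind (a == x)) _ elems)
                  (cong (ind (a == x) *_) (∑-δ′ E b λ y → ind (adj x y) * h (x , y))))) ⟩
    (∑ E λ x → ind (a == x) * (ind (adj x b) * h (x , b)))
      ≡⟨ ∑-δ′ E a (λ x → ind (adj x b) * h (x , b)) ⟩
    ind (adj a b) * h (a , b) ∎

  -- Products sum over arcs only, so the delta finds its term because the reversed pair (v , u) is
  -- an arc.
  sum-S : ∀ {u v} h → adj v u ≡ true → sum (λ c → S (u , v) c * h c) arcs ≡ h (v , u)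
  sum-S {u} {v} h p = begin
    sum (λ c → S (u , v) c * h c) arcs
      ≡⟨ sum-arcs _ ⟩
    (∑ E λ x → ∑ E λ y → ind (adj x y) * (ind ((u == y) ∧ (v == x)) * h (x , y)))
      ≡⟨ sum-cong elems (λ x → sum-cong elems λ y → cong (λ z → ind (adj x y) * (z * h (x , y)))
           (trans (ind-∧ (u == y) (v == x)) (ℚP.*-comm (ind (u == y)) (ind (v == x))))) ⟩
    (∑ E λ x → ∑ E λ y → ind (adj x y) * ((ind (v == x) * ind (u == y)) * h (x , y)))
      ≡⟨ ∑∑-δ v u h ⟩
    ind (adj v u) * h (v , u)  ≡⟨ cong (λ b → ind b * h (v , u)) p ⟩
    1ℚ * h (v , u)             ≡⟨ ℚP.*-identityˡ (h (v , u)) ⟩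
    h (v , u)                  ∎

  sum-I : ∀ {u v} h → adj u v ≡ true → sum (λ c → I (u , v) c * h c) arcs ≡ h (u , v)
  sum-I {u} {v} h p = begin
    sum (λ c → I (u , v) c * h c) arcs
      ≡⟨ sum-arcs _ ⟩
    (∑ E λ x → ∑ E λ y → ind (adj x y) * (ind ((u == x) ∧ (v == y)) * h (x , y)))
      ≡⟨ sum-cong elems (λ x → sum-cong elems λ y → cong (λ z → ind (adj x y) * (z * h (x , y)))
           (ind-∧ (u == x) (v == y))) ⟩
    (∑ E λ x → ∑ E λ y → ind (adj x y) * ((ind (u == x) * ind (v == y)) * h (x , y)))
      ≡⟨ ∑∑-δ u v h ⟩
    ind (adj u v) * h (u , v)  ≡⟨ cong (λ b → ind b * h (u , v)) p ⟩
    1ℚ * h (u , v)             ≡⟨ ℚP.*-identityˡ (h (u , v)) ⟩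
    h (u , v)                  ∎

  -- Of the sum over vertices only the term at the head of a survives.
  NstarN-value : ∀ a b → NstarN a b ≡ ind (t a == t b) * recip (deg (t a))
  NstarN-value a b = trans (sum-cong elems entry)
    (∑-δ E (t a) λ u → ind (u == t b) * recip (deg u))
    where
    entry : ∀ u → NN u a b ≡ ind (u == t a) * (ind (u == t b) * recip (deg u))
    entry u with u == t a | u == t b
    ... | true  | true  = sym (trans (ℚP.*-identityˡ (1ℚ * recip (deg u))) (ℚP.*-identityˡ (recip (deg u))))
    ... | true  | false = sym (trans (ℚP.*-identityˡ (0ℚ * recip (deg u))) (ℚP.*-zeroˡ (recip (deg u))))
    ... | false | true  = sym (ℚP.*-zeroˡ (1ℚ * recip (deg u)))
    ... | false | false = sym (ℚP.*-zeroˡ (0ℚ * recip (deg u)))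

  evolve : (Arc → ℚ) → Arc → ℚ
  evolve f a = sum (λ c → U a c * f c) arcs

  evolve^ : ℕ → (Arc → ℚ) → Arc → ℚ
  evolve^ zero    f = f
  evolve^ (suc n) f = evolve (evolve^ n f)

  -- These are N f and N S f divided by √deg; the rescaling removes the square roots.
  inflow outflow : (Arc → ℚ) → V → ℚ
  inflow  f u = recip (deg u) * ∑ E λ w → ind (adj w u) * f (w , u)
  outflow f u = recip (deg u) * ∑ E λ w → ind (adj u w) * f (u , w)

  average : (V → ℚ) → V → ℚ
  average g u = recip (deg u) * ∑ E λ w → ind (adj w u) * g w

  -- The shift reads the coin 2 N*N - I at the reversed arc (v , u). Its head is u, so N*N
  -- contributes the mean over the arcs entering u.
  evolve-step : ∀ f {u v} → adj u v ≡ true → evolve f (u , v) ≡ ι 2 * inflow f u - f (v , u)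
  evolve-step f {u} {v} p = begin
    sum (λ c → U (u , v) c * f c) arcs
      ≡⟨ sum-cong arcs (λ c → cong (_* f c) (sum-S (λ a → two * NstarN a c - I a c) q)) ⟩
    sum (λ c → (two * NstarN (v , u) c - I (v , u) c) * f c) arcs
      ≡⟨ sum-cong arcs (λ c → trans
           (cong (λ z → (two * z - I (v , u) c) * f c) (NstarN-value (v , u) c))
           (solve 5 (λ t i r d x → (t :* (i :* r) :- d) :* x := (t :* r) :* (i :* x) :+ con (0 , 1) :* (d :* x)) refl
             two (ind (u == t c)) r (I (v , u) c) (f c))) ⟩
    sum (λ c → (two * r) * (ind (u == t c) * f c) + - 1ℚ * (I (v , u) c * f c)) arcs
      ≡⟨ sum-+ (λ c → (two * r) * (ind (u == t c) * f c)) _ arcs ⟩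
    sum (λ c → (two * r) * (ind (u == t c) * f c)) arcs + sum (λ c → - 1ℚ * (I (v , u) c * f c)) arcs
      ≡⟨ cong₂ _+_ (trans (sum-*ˡ (two * r) (λ c → ind (u == t c) * f c) arcs) (cong ((two * r) *_) incoming))
                   (trans (sum-*ˡ (- 1ℚ) (λ c → I (v , u) c * f c) arcs) (cong (- 1ℚ *_) (sum-I f q))) ⟩
    (two * r) * (∑ E λ w → ind (adj w u) * f (w , u)) + - 1ℚ * f (v , u)
      ≡⟨ solve 4 (λ t r s x → (t :* r) :* s :+ con (0 , 1) :* x := t :* (r :* s) :- x) refl
           two r (∑ E λ w → ind (adj w u) * f (w , u)) (f (v , u)) ⟩
    two * inflow f u - f (v , u)  ≡⟨ cong (λ z → z * inflow f u - f (v , u)) ι-2 ⟨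
    ι 2 * inflow f u - f (v , u) ∎
    where
    r : ℚ
    r = recip (deg u)
    q : adj v u ≡ true
    q = trans (adj-sym v u) p
    incoming : sum (λ c → ind (u == t c) * f c) arcs ≡ ∑ E λ w → ind (adj w u) * f (w , u)
    incoming = trans (sum-arcs _) (sum-cong elems λ x → trans
      (sum-cong elems λ y → *-swap (ind (adj x y)) (ind (u == y)) (f (x , y)))
      (∑-δ′ E u λ y → ind (adj x y) * f (x , y)))

  U^-evolve : ∀ n a b → (U ^ n) a b ≡ evolve^ n (λ c → I c b) a
  U^-evolve zero    a b = refl
  U^-evolve (suc n) a b = sum-cong arcs λ c → cong (U a c *_) (U^-evolve n c b)

  -- The restriction to arcs is already forced for n = 0, where the sum against `I` only sees values
  -- on the arc list. It survives the induction because the intermediate index runs over arcs too.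
  evolve^-kernel : ∀ n f {a} → a ∈ arcs → evolve^ n f a ≡ sum (λ b → (U ^ n) a b * f b) arcs
  evolve^-kernel zero    f {a} a∈ = sym (sum-I f (arcs⁻ a∈))
  evolve^-kernel (suc n) f {a} a∈ = begin
    sum (λ c → U a c * evolve^ n f c) arcs
      ≡⟨ sum-cong-∈ arcs (λ {c} c∈ → trans (cong (U a c *_) (evolve^-kernel n f c∈))
           (sym (sum-*ˡ (U a c) (λ b → (U ^ n) c b * f b) arcs))) ⟩
    sum (λ c → sum (λ b → U a c * ((U ^ n) c b * f b)) arcs) arcs
      ≡⟨ sum-swap (λ c b → U a c * ((U ^ n) c b * f b)) arcs arcs ⟩
    sum (λ b → sum (λ c → U a c * ((U ^ n) c b * f b)) arcs) arcs
      ≡⟨ sum-cong arcs (λ b → trans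
           (sum-cong arcs λ c → sym (ℚP.*-assoc (U a c) ((U ^ n) c b) (f b)))
           (sum-*ʳ (f b) (λ c → U a c * (U ^ n) c b) arcs)) ⟩
    sum (λ b → (U ^ suc n) a b * f b) arcs ∎

  on-arcs : ∀ {f g : Arc → ℚ} → (∀ {u v} → adj u v ≡ true → f (u , v) ≡ g (u , v)) →
            ∀ u v → ind (adj u v) * f (u , v) ≡ ind (adj u v) * g (u , v)
  on-arcs {f} {g} h u v with adj u v in eq
  ... | true  = cong (1ℚ *_) (h eq)
  ... | false = trans (ℚP.*-zeroˡ (f (u , v))) (sym (ℚP.*-zeroˡ (g (u , v))))

  -- By `evolve-step` the arc (w , u) receives twice the inflow at w minus the value of (u , w);
  -- averaging over w gives one random walk step and an outflow.
  inflow-evolve : ∀ f u → inflow (evolve f) u ≡ ι 2 * average (inflow f) u - outflow f u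
  inflow-evolve f u = begin
    r * (∑ E λ w → ind (adj w u) * evolve f (w , u))
      ≡⟨ cong (r *_) (sum-cong elems λ w → trans (on-arcs (evolve-step f) w u) (trans
           (solve 4 (λ i t g x → i :* (t :* g :- x) := t :* (i :* g) :+ con (0 , 1) :* (i :* x)) refl
             (ind (adj w u)) (ι 2) (inflow f w) (f (u , w)))
           (cong (λ b → ι 2 * (ind (adj w u) * inflow f w) + - 1ℚ * (ind b * f (u , w))) (adj-sym w u)))) ⟩
    r * (∑ E λ w → ι 2 * (ind (adj w u) * inflow f w) + - 1ℚ * (ind (adj u w) * f (u , w)))
      ≡⟨ cong (r *_) (trans (sum-+ (λ w → ι 2 * (ind (adj w u) * inflow f w)) _ elems)
           (cong₂ _+_ (sum-*ˡ (ι 2) (λ w → ind (adj w u) * inflow f w) elems)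
                      (sum-*ˡ (- 1ℚ) (λ w → ind (adj u w) * f (u , w)) elems))) ⟩
    r * (ι 2 * (∑ E λ w → ind (adj w u) * inflow f w) + - 1ℚ * (∑ E λ w → ind (adj u w) * f (u , w)))
      ≡⟨ solve 4 (λ r t a b → r :* (t :* a :+ con (0 , 1) :* b) := t :* (r :* a) :- r :* b) refl
           r (ι 2) (∑ E λ w → ind (adj w u) * inflow f w) (∑ E λ w → ind (adj u w) * f (u , w)) ⟩
    ι 2 * average (inflow f) u - outflow f u ∎
    where
    r : ℚ
    r = recip (deg u)

  -- Since `recip 0` is 0, this excludes isolated vertices.
  module _ (recip-deg : ∀ u → recip (deg u) * (∑ E λ w → ind (adj u w)) ≡ 1ℚ) where

    average-const : ∀ u c → recip (deg u) * (∑ E λ w → ind (adj u w) * c) ≡ c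
    average-const u c = begin
      recip (deg u) * (∑ E λ w → ind (adj u w) * c)    ≡⟨ cong (recip (deg u) *_) (sum-*ʳ c (λ w → ind (adj u w)) elems) ⟩
      recip (deg u) * ((∑ E λ w → ind (adj u w)) * c)  ≡⟨ ℚP.*-assoc (recip (deg u)) _ c ⟨
      recip (deg u) * (∑ E λ w → ind (adj u w)) * c    ≡⟨ cong (_* c) (recip-deg u) ⟩
      1ℚ * c                                           ≡⟨ ℚP.*-identityˡ c ⟩
      c                                                ∎

    -- On the arcs leaving u the inflow at u enters as a constant, so the average is twice the
    -- inflow minus the inflow. Together with `inflow-evolve` this closes up to a second-order
    -- recursion for the inflow.
    outflow-evolve : ∀ f u → outflow (evolve f) u ≡ inflow f u
    outflow-evolve f u = begin
      r * (∑ E λ w → ind (adj u w) * evolve f (u , w))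
        ≡⟨ cong (r *_) (sum-cong elems λ w → trans (on-arcs (evolve-step f) u w) (trans
             (solve 4 (λ i t g x → i :* (t :* g :- x) := i :* (t :* g) :+ con (0 , 1) :* (i :* x)) refl
               (ind (adj u w)) (ι 2) (inflow f u) (f (w , u)))
             (cong (λ b → ind (adj u w) * (ι 2 * inflow f u) + - 1ℚ * (ind b * f (w , u))) (adj-sym u w)))) ⟩
      r * (∑ E λ w → ind (adj u w) * (ι 2 * inflow f u) + - 1ℚ * (ind (adj w u) * f (w , u)))
        ≡⟨ cong (r *_) (trans (sum-+ (λ w → ind (adj u w) * (ι 2 * inflow f u)) _ elems)
             (cong (A +_) (sum-*ˡ (- 1ℚ) (λ w → ind (adj w u) * f (w , u)) elems))) ⟩
      r * (A + - 1ℚ * B)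
        ≡⟨ solve 3 (λ r a b → r :* (a :+ con (0 , 1) :* b) := r :* a :- r :* b) refl r A B ⟩
      r * A - inflow f u
        ≡⟨ cong (_- inflow f u) (average-const u (ι 2 * inflow f u)) ⟩
      ι 2 * inflow f u - inflow f u
        ≡⟨ double-minus (inflow f u) ⟩
      inflow f u ∎
      where
      r A B : ℚ
      r = recip (deg u)
      A = ∑ E λ w → ind (adj u w) * (ι 2 * inflow f u)
      B = ∑ E λ w → ind (adj w u) * f (w , u)

    chebyshev : ℕ → (V → ℚ) → V → ℚ
    chebyshev zero          g = g
    chebyshev (suc zero)    g = average g
    chebyshev (suc (suc n)) g u = ι 2 * average (chebyshev (suc n) g) u - chebyshev n g u

    average-cong : ∀ {g h : V → ℚ} → (∀ u → g u ≡ h u) → ∀ u → average g u ≡ average h u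
    average-cong eq u = cong (recip (deg u) *_) (sum-cong elems λ w → cong (ind (adj w u) *_) (eq w))

    inflow-evolve² : ∀ f u → inflow (evolve (evolve f)) u ≡ ι 2 * average (inflow (evolve f)) u - inflow f u
    inflow-evolve² f u = trans (inflow-evolve (evolve f) u)
      (cong (λ x → ι 2 * average (inflow (evolve f)) u - x) (outflow-evolve f u))

    module _ (g : V → ℚ) where
      private
        start : Arc → ℚ
        start = g ∘ t

      inflow-start : ∀ u → inflow start u ≡ g u
      inflow-start u = trans
        (cong (recip (deg u) *_) (sum-cong elems λ w → cong (λ b → ind b * g u) (adj-sym w u)))
        (average-const u (g u))

      outflow-start : ∀ u → outflow start u ≡ average g u
      outflow-start u =
        cong (recip (deg u) *_) (sum-cong elems λ w → cong (λ b → ind b * g w) (adj-sym u w))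

      -- Starting from a function of the head, the first step yields 2 P g - P g = P g. These
      -- initial values select the Chebyshev polynomials of the first kind.
      inflow-chebyshev : ∀ n u → inflow (evolve^ n start) u ≡ chebyshev n g u
      inflow-chebyshev zero u = inflow-start u
      inflow-chebyshev (suc zero) u = begin
        inflow (evolve start) u
          ≡⟨ inflow-evolve start u ⟩
        ι 2 * average (inflow start) u - outflow start u
          ≡⟨ cong₂ (λ x y → ι 2 * x - y) (average-cong inflow-start u) (outflow-start u) ⟩
        ι 2 * average g u - average g u
          ≡⟨ double-minus (average g u) ⟩
        average g u ∎
      inflow-chebyshev (suc (suc n)) u = trans (inflow-evolve² (evolve^ n start) u)
        (cong₂ (λ x y → ι 2 * x - y) (average-cong (inflow-chebyshev (suc n)) u) (inflow-chebyshev n u))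

    -- The walk returns g ∘ t to itself, and inflow recovers g from it. The witness is τ - 1, which
    -- makes the index visibly positive.
    periodic⇒chebyshev : Periodic → ∃ λ n → ∀ g u → chebyshev (suc n) g u ≡ g u
    periodic⇒chebyshev (suc n , _ , U^τ≡I) = n , λ g u → begin
      chebyshev (suc n) g u
        ≡⟨ inflow-chebyshev g (suc n) u ⟨
      inflow (evolve^ (suc n) (g ∘ t)) u
        ≡⟨ cong (recip (deg u) *_) (sum-cong elems λ w →
             on-arcs {evolve^ (suc n) (g ∘ t)} {g ∘ t} (λ p → returns g (arcs⁺ p)) w u) ⟩
      inflow (g ∘ t) u
        ≡⟨ inflow-start g u ⟩
      g u ∎
      where
      returns : ∀ g {a} → a ∈ arcs → evolve^ (suc n) (g ∘ t) a ≡ g (t a)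
      returns g {a} a∈ = begin
        evolve^ (suc n) (g ∘ t) a
          ≡⟨ evolve^-kernel (suc n) (g ∘ t) a∈ ⟩
        sum (λ b → (U ^ suc n) a b * g (t b)) arcs
          ≡⟨ sum-cong-∈ arcs (λ {b} b∈ → cong (_* g (t b)) (U^τ≡I a b a∈ b∈)) ⟩
        sum (λ b → I a b * g (t b)) arcs
          ≡⟨ sum-I (g ∘ t) (arcs⁻ a∈) ⟩
        g (t a) ∎

-- Quadratic units

commutativeRing : FinCommRing → CommutativeRing 0ℓ 0ℓ
commutativeRing R = record { isCommutativeRing = FinCommRing.isCommutativeRing R }

module QuadraticUnits (R : FinCommRing) where
  open FinCommRing R hiding (_≟_; elems; complete; unique) public
  open CommutativeRing (commutativeRing R) public
    using (_-_; +-identityˡ; +-identityʳ; +-assoc; +-comm; -‿inverseˡ; -‿inverseʳ;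
           *-identityˡ; *-identityʳ; *-assoc; *-comm; distribˡ; distribʳ; zeroˡ; zeroʳ; isCommutativeSemiring)
  open Enumeration (enumeration R) public
  module Solver = DifferenceSolver (commutativeRing R)
  open Solver public using (solve; con; _:=_; _:+_; _:*_; _:-_; :-_)
  open ≡-Reasoning

  E : Enumeration Carrier
  E = enumeration R

  Unit : Carrier → Set
  Unit x = ∃ λ y → x * y ≡ 1#

  T : Carrier → Set
  T x = ∃ λ w → Unit w × (x ≡ w * w ⊎ x ≡ - (w * w))

  isUnit⁺ : ∀ {x} → Unit x → isUnit R x ≡ true
  isUnit⁺ {x} (y , p) = any-complete (λ y → (x * y) == 1#) (==-complete p)

  isUnit⁻ : ∀ {x} → isUnit R x ≡ true → Unit x
  isUnit⁻ {x} h with any-sound (λ y → (x * y) == 1#) h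
  ... | y , p = y , ==-sound p

  inT⁺ : ∀ {x} → T x → inT R x ≡ true
  inT⁺ (w , u , inj₁ p) = any-complete _ (∧-true (isUnit⁺ u) (∨-trueˡ (==-complete p)))
  inT⁺ (w , u , inj₂ p) = any-complete _ (∧-true (isUnit⁺ u) (∨-trueʳ (==-complete p)))

  inT⁻ : ∀ {x} → inT R x ≡ true → T x
  inT⁻ {x} h with any-sound (λ w → isUnit R w ∧ ((x == (w * w)) ∨ (x == (- (w * w))))) h
  ... | w , p with ∨-true {x == (w * w)} (∧-trueʳ {isUnit R w} p)
  ...   | inj₁ q = w , isUnit⁻ (∧-trueˡ p) , inj₁ (==-sound q)
  ...   | inj₂ q = w , isUnit⁻ (∧-trueˡ p) , inj₂ (==-sound q)

  Unit-1 : Unit 1#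
  Unit-1 = 1# , *-identityˡ 1#

  Unit-* : ∀ {x y} → Unit x → Unit y → Unit (x * y)
  Unit-* {x} {y} (x′ , p) (y′ , q) = x′ * y′ , (begin
    (x * y) * (x′ * y′)  ≡⟨ solve 4 (λ x y z w → (x :* y) :* (z :* w) := (x :* z) :* (y :* w)) refl x y x′ y′ ⟩
    (x * x′) * (y * y′)  ≡⟨ cong₂ _*_ p q ⟩
    1# * 1#              ≡⟨ *-identityˡ 1# ⟩
    1#                   ∎)

  Unit-neg : ∀ {x} → Unit x → Unit (- x)
  Unit-neg {x} (y , p) = - y , trans (solve 2 (λ x y → :- x :* :- y := x :* y) refl x y) p

  Unit-factor : ∀ {x y} → Unit (x * y) → Unit x
  Unit-factor {x} {y} (z , p) = y * z , trans (sym (*-assoc x y z)) p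

  Unit-cancel : ∀ {x y z} → Unit x → x * y ≡ x * z → y ≡ z
  Unit-cancel {x} {y} {z} (x′ , p) eq = begin
    y              ≡⟨ lemma y ⟨
    x′ * (x * y)   ≡⟨ cong (x′ *_) eq ⟩
    x′ * (x * z)   ≡⟨ lemma z ⟩
    z              ∎
    where
    lemma : ∀ y → x′ * (x * y) ≡ y
    lemma y = begin
      x′ * (x * y)  ≡⟨ solve 3 (λ x x′ y → x′ :* (x :* y) := (x :* x′) :* y) refl x x′ y ⟩
      (x * x′) * y  ≡⟨ cong (_* y) p ⟩
      1# * y        ≡⟨ *-identityˡ y ⟩
      y             ∎

  ¬Unit-0 : ¬ Unit 0#
  ¬Unit-0 (y , p) = nontrivial (trans (sym p) (zeroˡ y))

  T⇒Unit : ∀ {x} → T x → Unit x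
  T⇒Unit (w , u , inj₁ refl) = Unit-* u u
  T⇒Unit (w , u , inj₂ refl) = Unit-neg (Unit-* u u)

  T-square : ∀ {w} → Unit w → T (w * w)
  T-square {w} u = w , u , inj₁ refl

  T-1 : T 1#
  T-1 = 1# , Unit-1 , inj₁ (sym (*-identityˡ 1#))

  T-neg : ∀ {x} → T x → T (- x)
  T-neg (w , u , inj₁ refl) = w , u , inj₂ refl
  T-neg (w , u , inj₂ refl) = w , u , inj₁ (solve 1 (λ x → :- (:- x) := x) refl (w * w))

  T-* : ∀ {x y} → T x → T y → T (x * y)
  T-* (w , u , p) (z , v , q) = w * z , Unit-* u v , sign p q
    where
    sign : ∀ {x y} → x ≡ w * w ⊎ x ≡ - (w * w) → y ≡ z * z ⊎ y ≡ - (z * z) →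
           x * y ≡ (w * z) * (w * z) ⊎ x * y ≡ - ((w * z) * (w * z))
    sign (inj₁ refl) (inj₁ refl) = inj₁ (solve 2 (λ w z → (w :* w) :* (z :* z) := (w :* z) :* (w :* z)) refl w z)
    sign (inj₁ refl) (inj₂ refl) = inj₂ (solve 2 (λ w z → (w :* w) :* :- (z :* z) := :- ((w :* z) :* (w :* z))) refl w z)
    sign (inj₂ refl) (inj₁ refl) = inj₂ (solve 2 (λ w z → :- (w :* w) :* (z :* z) := :- ((w :* z) :* (w :* z))) refl w z)
    sign (inj₂ refl) (inj₂ refl) = inj₁ (solve 2 (λ w z → :- (w :* w) :* :- (z :* z) := (w :* z) :* (w :* z)) refl w z)

  -- The inverse is y = x y², an element of T times the square of a unit.
  T-inv : ∀ {x y} → T x → x * y ≡ 1# → T y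
  T-inv {x} {y} t p = subst T (begin
    x * (y * y)  ≡⟨ *-assoc x y y ⟨
    (x * y) * y  ≡⟨ cong (_* y) p ⟩
    1# * y       ≡⟨ *-identityˡ y ⟩
    y            ∎) (T-* t (T-square (x , trans (*-comm y x) p)))

  inT-ext : ∀ {x y} → (T x → T y) → (T y → T x) → inT R x ≡ inT R y
  inT-ext f g = Bool-ext (inT⁺ ∘ f ∘ inT⁻) (inT⁺ ∘ g ∘ inT⁻)

  inT-neg : ∀ x → inT R (- x) ≡ inT R x
  inT-neg x = inT-ext (subst T (solve 1 (λ x → :- (:- x) := x) refl x) ∘ T-neg) T-neg

  inT-scale : ∀ {s} → T s → ∀ x → inT R (s * x) ≡ inT R x
  inT-scale {s} Ts x with T⇒Unit Ts
  ... | s′ , p = inT-ext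
    (λ t → subst T (begin
      s′ * (s * x)  ≡⟨ solve 3 (λ s s′ x → s′ :* (s :* x) := (s :* s′) :* x) refl s s′ x ⟩
      (s * s′) * x  ≡⟨ cong (_* x) p ⟩
      1# * x        ≡⟨ *-identityˡ x ⟩
      x             ∎) (T-* (T-inv Ts p) t))
    (T-* Ts)

  difference-0 : ∀ {u v} → u + - v ≡ 0# → u ≡ v
  difference-0 {u} {v} p = begin
    u              ≡⟨ solve 2 (λ u v → u := (u :+ :- v) :+ v) refl u v ⟩
    (u + - v) + v  ≡⟨ cong (_+ v) p ⟩
    0# + v         ≡⟨ +-identityˡ v ⟩
    v              ∎

  -- For u = v both sides are false, because 0 is not a unit in a nontrivial ring.
  adj-inT : ∀ u v → adjR R u v ≡ inT R (u + - v)
  adj-inT u v with FinCommRing._≟_ R u v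
  ... | yes refl = sym (≢true λ h → ¬Unit-0 (subst Unit (-‿inverseʳ u) (T⇒Unit (inT⁻ h))))
  ... | no _     = refl

  adj-sym : ∀ u v → adjR R u v ≡ adjR R v u
  adj-sym u v = begin
    adjR R u v          ≡⟨ adj-inT u v ⟩
    inT R (u + - v)     ≡⟨ inT-neg _ ⟨
    inT R (- (u + - v)) ≡⟨ cong (inT R) (solve 2 (λ u v → :- (u :+ :- v) := v :+ :- u) refl u v) ⟩
    inT R (v + - u)     ≡⟨ adj-inT v u ⟨
    adjR R v u          ∎

  module Sums {K : Set} {_⊕_ _⊗_ : K → K → K} {0K 1K : K}
              (isCS : IsCommutativeSemiring _≡_ _⊕_ _⊗_ 0K 1K) where
    open Summation isCS

    ∑-translate : ∀ a (f : Carrier → K) → ∑ E (λ x → f (a + x)) ≡ ∑ E f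
    ∑-translate a = ∑-reindex E E (a +_) (- a +_)
      (λ x → solve 2 (λ a x → :- a :+ (a :+ x) := x) refl a x)
      (λ x → solve 2 (λ a x → a :+ (:- a :+ x) := x) refl a x)

    ∑-neg : ∀ (f : Carrier → K) → ∑ E (λ x → f (- x)) ≡ ∑ E f
    ∑-neg = ∑-reindex E E -_ -_ neg-neg neg-neg
      where
      neg-neg : ∀ x → - (- x) ≡ x
      neg-neg x = solve 1 (λ x → :- (:- x) := x) refl x

    ∑-scale : ∀ {s} → Unit s → (f : Carrier → K) → ∑ E (λ x → f (s * x)) ≡ ∑ E f
    ∑-scale {s} (s′ , p) = ∑-reindex E E (s *_) (s′ *_)
      (λ x → trans (solve 3 (λ s s′ x → s′ :* (s :* x) := (s :* s′) :* x) refl s s′ x) (unit x))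
      (λ x → trans (solve 3 (λ s s′ x → s :* (s′ :* x) := (s :* s′) :* x) refl s s′ x) (unit x))
      where
      unit : ∀ x → (s * s′) * x ≡ x
      unit x = trans (cong (_* x) p) (*-identityˡ x)

  module ℕ-sums = Sums ℕP.+-*-isCommutativeSemiring
  module ℚ-sums = Sums (IsCommutativeRing.isCommutativeSemiring ℚP.+-*-isCommutativeRing)

  degree : ℕ
  degree = ∑ℕ.∑ E λ t → ∑ℕ.ind (inT R t)

  open Grover (Enumeration._≟_ E) elems (adjR R) using (recip; deg)

  deg-degree : ∀ u → deg u ≡ degree
  deg-degree u = begin
    countB (adjR R u) elems                       ≡⟨ countB-sum (adjR R u) elems ⟩
    (∑ℕ.∑ E λ v → ∑ℕ.ind (adjR R u v))            ≡⟨ ∑ℕ.sum-cong elems (λ v → cong ∑ℕ.ind (adj-inT u v)) ⟩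
    (∑ℕ.∑ E λ v → ∑ℕ.ind (inT R (u + - v)))       ≡⟨ ℕ-sums.∑-neg (λ v → ∑ℕ.ind (inT R (u + v))) ⟩
    (∑ℕ.∑ E λ v → ∑ℕ.ind (inT R (u + v)))         ≡⟨ ℕ-sums.∑-translate u (λ v → ∑ℕ.ind (inT R v)) ⟩
    degree                                        ∎

  degree≢0 : degree ≢ 0
  degree≢0 eq = contradiction (sum-tight {f = λ _ → 0} elems (λ _ → z≤n) (trans (∑ℕ.sum-0 elems) (sym eq)) (complete 1#))
    λ p → contradiction (trans p (cong ∑ℕ.ind (inT⁺ T-1))) λ ()

  recip-degree : recip degree ℚ.* ι degree ≡ 1ℚ
  recip-degree with degree in eq
  ... | zero  = contradiction eq degree≢0
  ... | suc n = 1/suc*ι n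

  open Walk E (adjR R) adj-sym using (average; chebyshev; periodic⇒chebyshev)

  ∑-adj : ∀ u (g : Carrier → ℚ) →
          (∑ℚ.∑ E λ w → ∑ℚ.ind (adjR R w u) ℚ.* g w) ≡ (∑ℚ.∑ E λ t → ∑ℚ.ind (inT R t) ℚ.* g (u + t))
  ∑-adj u g = begin
    (∑ℚ.∑ E λ w → ∑ℚ.ind (adjR R w u) ℚ.* g w)
      ≡⟨ ℚ-sums.∑-translate u (λ w → ∑ℚ.ind (adjR R w u) ℚ.* g w) ⟨
    (∑ℚ.∑ E λ t → ∑ℚ.ind (adjR R (u + t) u) ℚ.* g (u + t))
      ≡⟨ ∑ℚ.sum-cong elems (λ t → cong (λ b → ∑ℚ.ind b ℚ.* g (u + t)) (trans (adj-inT (u + t) u)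
           (cong (inT R) (solve 2 (λ u t → (u :+ t) :+ :- u := t) refl u t)))) ⟩
    (∑ℚ.∑ E λ t → ∑ℚ.ind (inT R t) ℚ.* g (u + t)) ∎

  average-T : ∀ g u → average g u ≡ recip degree ℚ.* (∑ℚ.∑ E λ t → ∑ℚ.ind (inT R t) ℚ.* g (u + t))
  average-T g u = cong₂ (λ d x → recip d ℚ.* x) (deg-degree u) (∑-adj u g)

  recip-deg : ∀ u → recip (deg u) ℚ.* (∑ℚ.∑ E λ w → ∑ℚ.ind (adjR R u w)) ≡ 1ℚ
  recip-deg u = begin
    recip (deg u) ℚ.* (∑ℚ.∑ E λ w → ∑ℚ.ind (adjR R u w))
      ≡⟨ cong (recip (deg u) ℚ.*_) (trans (sym (ι-∑-ind E (adjR R u)))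
           (cong ι (trans (sym (countB-sum (adjR R u) elems)) (deg-degree u)))) ⟩
    recip (deg u) ℚ.* ι degree  ≡⟨ cong (λ d → recip d ℚ.* ι degree) (deg-degree u) ⟩
    recip degree ℚ.* ι degree   ≡⟨ recip-degree ⟩
    1ℚ                          ∎

  periodic⇒cheb : PeriodicQUCG R → ∃ λ n → ∀ g u → chebyshev recip-deg (suc n) g u ≡ g u
  periodic⇒cheb = periodic⇒chebyshev recip-deg

-- Integrality, and quotients of a periodic walk

Integral : ℚ → Set
Integral x = ∃ λ m → ∃ λ n → x ≡ ι m ℚ.- ι n

module IntegralNumbers where
  open import Data.Rational using (_+_; _*_; _-_; -_)
  open ℚ-solver using (solve; con; _:=_; _:+_; _:*_; _:-_; :-_)

  ι-integral : ∀ n → Integral (ι n)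
  ι-integral n = n , 0 , trans (solve 1 (λ x → x := x :- con (0 , 0)) refl (ι n)) (cong (λ z → ι n - z) (sym ι-0))

  +-integral : ∀ {x y} → Integral x → Integral y → Integral (x + y)
  +-integral (a , b , refl) (c , d , refl) = a ℕ.+ c , b ℕ.+ d , trans
    (solve 4 (λ a b c d → (a :- b) :+ (c :- d) := (a :+ c) :- (b :+ d)) refl (ι a) (ι b) (ι c) (ι d))
    (sym (cong₂ _-_ (ι-+ a c) (ι-+ b d)))

  neg-integral : ∀ {x} → Integral x → Integral (- x)
  neg-integral (a , b , refl) = b , a , solve 2 (λ a b → :- (a :- b) := b :- a) refl (ι a) (ι b)

  *-integral : ∀ {x y} → Integral x → Integral y → Integral (x * y)
  *-integral (a , b , refl) (c , d , refl) = a ℕ.* c ℕ.+ b ℕ.* d , a ℕ.* d ℕ.+ b ℕ.* c , trans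
    (solve 4 (λ a b c d → (a :- b) :* (c :- d) := (a :* c :+ b :* d) :- (a :* d :+ b :* c)) refl (ι a) (ι b) (ι c) (ι d))
    (sym (cong₂ _-_ (trans (ι-+ (a ℕ.* c) (b ℕ.* d)) (cong₂ _+_ (ι-* a c) (ι-* b d)))
                    (trans (ι-+ (a ℕ.* d) (b ℕ.* c)) (cong₂ _+_ (ι-* a d) (ι-* b c)))))

  ind-integral : ∀ b → Integral (∑ℚ.ind b)
  ind-integral b = subst Integral (ι-ind b) (ι-integral (∑ℕ.ind b))

  sum-integral : ∀ {A : Set} {f : A → ℚ} xs → (∀ x → Integral (f x)) → Integral (∑ℚ.sum f xs)
  sum-integral []       h = ind-integral false
  sum-integral (x ∷ xs) h = +-integral (h x) (sum-integral xs h)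

  -- With x = a - b the equation becomes f b + 1 = f a in ℕ, so f divides 1.
  integral-unit : ∀ f {x} → Integral x → 1ℚ ≡ ι f * x → f ≡ 1
  integral-unit f (a , b , refl) eq = ∣1⇒≡1 (∣m+n∣m⇒∣n (divides a (trans lemma (ℕP.*-comm f a))) (m∣m*n b))
    where
    lemma : f ℕ.* b ℕ.+ 1 ≡ f ℕ.* a
    lemma = ι-injective _ _ (begin
      ι (f ℕ.* b ℕ.+ 1)                ≡⟨ trans (ι-+ (f ℕ.* b) 1) (cong₂ _+_ (ι-* f b) ι-1) ⟩
      ι f * ι b + 1ℚ                   ≡⟨ cong (ι f * ι b +_) eq ⟩
      ι f * ι b + ι f * (ι a - ι b)    ≡⟨ solve 3 (λ f a b → f :* b :+ f :* (a :- b) := f :* a) refl (ι f) (ι a) (ι b) ⟩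
      ι f * ι a                        ≡⟨ ι-* f a ⟨
      ι (f ℕ.* a)                      ∎)
      where open ≡-Reasoning

open IntegralNumbers

-- Here `a` is the 0-1 matrix A of the overview. By `fibre` the T-steps out of u enter the fibre
-- over y exactly K times or never, so P descends to S; `degree-eq` then makes 2 P equal to A / f,
-- and `square` is A² + A ≡ 0 modulo f. The last three arguments provide an entry 1 of A.
module PeriodicQuotient
  (R : FinCommRing) {S : Set} (ES : Enumeration S) (π : FinCommRing.Carrier R → S)
  (a : S → S → Bool) (f K : ℕ)
  (degree-eq : QuadraticUnits.degree R ≡ 2 ℕ.* (f ℕ.* K))
  (fibre : ∀ u y → (∑ℕ.∑ (enumeration R) λ t → ∑ℕ.ind (inT R t) ℕ.*
             ∑ℕ.ind (Enumeration._==_ ES (π (FinCommRing._+_ R u t)) y)) ≡ K ℕ.* ∑ℕ.ind (a (π u) y))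
  (square : ∀ x y → ∃ λ k → (∑ℕ.∑ ES λ z → ∑ℕ.ind (a x z) ℕ.* ∑ℕ.ind (a z y)) ℕ.+ ∑ℕ.ind (a x y) ≡ f ℕ.* k)
  (u₀ : FinCommRing.Carrier R) (y₀ : S) (a₀ : a (π u₀) y₀ ≡ true)
  where

  open QuadraticUnits R using (E; degree; recip-deg; recip-degree; average-T; periodic⇒cheb; adj-sym)
  open Walk E (adjR R) adj-sym using (average; chebyshev; average-cong)
  open Grover (Enumeration._≟_ E) (Enumeration.elems E) (adjR R) using (recip)
  open Enumeration ES using (_==_) renaming (elems to ys)
  module ES = Enumeration ES
  open ∑ℚ
  open import Data.Rational using (_+_; _*_; _-_; -_)
  open ℚ-solver using (solve; con; _:=_; _:+_; _:*_; _:-_; :-_)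
  open ≡-Reasoning

  operator : (S → ℚ) → S → ℚ
  operator g x = ∑ ES λ z → ind (a x z) * g z

  private
    xs = Enumeration.elems E
    r = recip degree
    _⊹_ = FinCommRing._+_ R

  average-operator : ∀ g u → average (g ∘ π) u ≡ (r * ι K) * operator g (π u)
  average-operator g u = begin
    average (g ∘ π) u
      ≡⟨ average-T (g ∘ π) u ⟩
    r * (∑ E λ t → ind (inT R t) * g (π (u ⊹ t)))
      ≡⟨ cong (r *_) (∑-fibre E ES (λ t → π (u ⊹ t)) (ind ∘ inT R) g) ⟩
    r * (∑ ES λ y → (∑ E λ t → ind (inT R t) * ind (π (u ⊹ t) == y)) * g y)
      ≡⟨ cong (r *_) (sum-cong ys λ y → trans (cong (_* g y) (fibre-ℚ y))
           (ℚP.*-assoc (ι K) (ind (a (π u) y)) (g y))) ⟩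
    r * (∑ ES λ y → ι K * (ind (a (π u) y) * g y))
      ≡⟨ cong (r *_) (sum-*ˡ (ι K) (λ y → ind (a (π u) y) * g y) ys) ⟩
    r * (ι K * operator g (π u))
      ≡⟨ ℚP.*-assoc r (ι K) (operator g (π u)) ⟨
    (r * ι K) * operator g (π u) ∎
    where
    fibre-ℚ : ∀ y → (∑ E λ t → ind (inT R t) * ind (π (u ⊹ t) == y)) ≡ ι K * ind (a (π u) y)
    fibre-ℚ y = begin
      (∑ E λ t → ind (inT R t) * ind (π (u ⊹ t) == y))
        ≡⟨ sum-cong xs (λ t → trans (cong₂ _*_ (sym (ι-ind (inT R t))) (sym (ι-ind (π (u ⊹ t) == y))))
             (sym (ι-* (∑ℕ.ind (inT R t)) (∑ℕ.ind (π (u ⊹ t) == y))))) ⟩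
      (∑ E λ t → ι (∑ℕ.ind (inT R t) ℕ.* ∑ℕ.ind (π (u ⊹ t) == y)))
        ≡⟨ ι-sum (λ t → ∑ℕ.ind (inT R t) ℕ.* ∑ℕ.ind (π (u ⊹ t) == y)) xs ⟨
      ι (∑ℕ.∑ E λ t → ∑ℕ.ind (inT R t) ℕ.* ∑ℕ.ind (π (u ⊹ t) == y))
        ≡⟨ cong ι (fibre u y) ⟩
      ι (K ℕ.* ∑ℕ.ind (a (π u) y))
        ≡⟨ trans (ι-* K (∑ℕ.ind (a (π u) y))) (cong (ι K *_) (ι-ind (a (π u) y))) ⟩
      ι K * ind (a (π u) y) ∎

  normalisation : ι 2 * ι f * (r * ι K) ≡ 1ℚ
  normalisation = begin
    ι 2 * ι f * (r * ι K)    ≡⟨ solve 4 (λ t f r k → t :* f :* (r :* k) := r :* (t :* (f :* k))) refl (ι 2) (ι f) r (ι K) ⟩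
    r * (ι 2 * (ι f * ι K))  ≡⟨ cong (r *_) (trans (cong (ι 2 *_) (sym (ι-* f K))) (sym (ι-* 2 (f ℕ.* K)))) ⟩
    r * ι (2 ℕ.* (f ℕ.* K))  ≡⟨ cong (λ d → r * ι d) degree-eq ⟨
    r * ι degree             ≡⟨ recip-degree ⟩
    1ℚ                       ∎

  operator-average : ∀ g u → ι 2 * ι f * average (g ∘ π) u ≡ operator g (π u)
  operator-average g u = begin
    ι 2 * ι f * average (g ∘ π) u
      ≡⟨ cong (ι 2 * ι f *_) (average-operator g u) ⟩
    ι 2 * ι f * ((r * ι K) * operator g (π u))
      ≡⟨ ℚP.*-assoc (ι 2 * ι f) (r * ι K) (operator g (π u)) ⟨
    ι 2 * ι f * (r * ι K) * operator g (π u)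
      ≡⟨ cong (_* operator g (π u)) normalisation ⟩
    1ℚ * operator g (π u)
      ≡⟨ ℚP.*-identityˡ (operator g (π u)) ⟩
    operator g (π u) ∎

  average-scale : ∀ c g u → average (λ w → c * g w) u ≡ c * average g u
  average-scale c g u = begin
    average (λ w → c * g w) u
      ≡⟨ cong (s *_) (trans (sum-cong xs λ w → *-swap (ind (adjR R w u)) c (g w))
           (sum-*ˡ c (λ w → ind (adjR R w u) * g w) xs)) ⟩
    s * (c * (∑ E λ w → ind (adjR R w u) * g w))
      ≡⟨ *-swap s c (∑ E λ w → ind (adjR R w u) * g w) ⟩
    c * average g u ∎
    where
    s = recip (Grover.deg (Enumeration._≟_ E) (Enumeration.elems E) (adjR R) u)

  -- A point mass as test function: A sends it to the column of A at y₀.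
  δ₀ : S → ℚ
  δ₀ y = ind (y == y₀)

  -- Y n is 2 fⁿ Tₙ(P) δ₀ for the random walk P; the factor 2 fⁿ makes it integral.
  Y : ℕ → S → ℚ
  Y zero          x = ι 2 * δ₀ x
  Y (suc zero)    x = operator δ₀ x
  Y (suc (suc n)) x = operator (Y (suc n)) x - ι f * ι f * Y n x

  f^ : ℕ → ℚ
  f^ zero    = 1ℚ
  f^ (suc n) = ι f * f^ n

  f^-integral : ∀ n → Integral (f^ n)
  f^-integral zero    = ind-integral true
  f^-integral (suc n) = *-integral {ι f} {f^ n} (ι-integral f) (f^-integral n)

  cheb : ℕ → FinCommRing.Carrier R → ℚ
  cheb n = chebyshev recip-deg n (δ₀ ∘ π)

  -- Multiplying the Chebyshev recursion by 2 f^(n+2) absorbs one factor 2 f into 2 f P = A and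
  -- leaves f² in front of the older term.
  Y-chebyshev : ∀ n u → ι 2 * f^ n * cheb n u ≡ Y n (π u)
  Y-chebyshev zero u = cong (_* δ₀ (π u)) (ℚP.*-identityʳ (ι 2))
  Y-chebyshev (suc zero) u = trans
    (cong (λ x → ι 2 * x * average (δ₀ ∘ π) u) (ℚP.*-identityʳ (ι f)))
    (operator-average δ₀ u)
  Y-chebyshev (suc (suc n)) u = begin
    ι 2 * (ι f * (ι f * f^ n)) * (ι 2 * average (cheb (suc n)) u - cheb n u)
      ≡⟨ solve 5 (λ t f p x y → t :* (f :* (f :* p)) :* (t :* x :- y)
                   := t :* f :* (t :* (f :* p) :* x) :- f :* f :* (t :* p :* y))
           refl (ι 2) (ι f) (f^ n) (average (cheb (suc n)) u) (cheb n u) ⟩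
    ι 2 * ι f * (ι 2 * f^ (suc n) * average (cheb (suc n)) u) - ι f * ι f * (ι 2 * f^ n * cheb n u)
      ≡⟨ cong₂ (λ x y → ι 2 * ι f * x - ι f * ι f * y)
           (sym (average-scale (ι 2 * f^ (suc n)) (cheb (suc n)) u)) (Y-chebyshev n u) ⟩
    ι 2 * ι f * average (λ w → ι 2 * f^ (suc n) * cheb (suc n) w) u - ι f * ι f * Y n (π u)
      ≡⟨ cong (λ x → ι 2 * ι f * x - ι f * ι f * Y n (π u))
           (average-cong recip-deg (Y-chebyshev (suc n)) u) ⟩
    ι 2 * ι f * average (Y (suc n) ∘ π) u - ι f * ι f * Y n (π u)
      ≡⟨ cong (_- ι f * ι f * Y n (π u)) (operator-average (Y (suc n)) u) ⟩
    Y (suc (suc n)) (π u) ∎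

  Y-integral : ∀ n x → Integral (Y n x)
  Y-integral zero          x = *-integral {ι 2} {δ₀ x} (ι-integral 2) (ind-integral (x == y₀))
  Y-integral (suc zero)    x = sum-integral ys λ z → *-integral {ind (a x z)} {δ₀ z} (ind-integral (a x z)) (ind-integral (z == y₀))
  Y-integral (suc (suc n)) x = +-integral {operator (Y (suc n)) x} { - (ι f * ι f * Y n x)}
    (sum-integral ys λ z → *-integral {ind (a x z)} {Y (suc n) z} (ind-integral (a x z)) (Y-integral (suc n) z))
    (neg-integral {ι f * ι f * Y n x} (*-integral {ι f * ι f} {Y n x}
      (*-integral {ι f} {ι f} (ι-integral f) (ι-integral f)) (Y-integral n x)))

  column-square : ∀ x → ∃ λ k → (∑ ES λ z → ind (a x z) * ind (a z y₀)) ≡ ι f * ι k - ind (a x y₀)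
  column-square x with square x y₀
  ... | k , eq = k , (begin
    s                                 ≡⟨ solve 2 (λ s i → s := (s :+ i) :- i) refl s (ind (a x y₀)) ⟩
    s + ind (a x y₀) - ind (a x y₀)   ≡⟨ cong (_- ind (a x y₀)) sum-ℚ ⟩
    ι f * ι k - ind (a x y₀)          ∎)
    where
    s = ∑ ES λ z → ind (a x z) * ind (a z y₀)
    sum-ℚ : s + ind (a x y₀) ≡ ι f * ι k
    sum-ℚ = begin
      s + ind (a x y₀)
        ≡⟨ cong₂ _+_ (trans (sum-cong ys λ z → trans (cong₂ _*_ (sym (ι-ind (a x z))) (sym (ι-ind (a z y₀))))
             (sym (ι-* (∑ℕ.ind (a x z)) (∑ℕ.ind (a z y₀)))))
             (sym (ι-sum (λ z → ∑ℕ.ind (a x z) ℕ.* ∑ℕ.ind (a z y₀)) ys))) (sym (ι-ind (a x y₀))) ⟩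
      ι (∑ℕ.∑ ES λ z → ∑ℕ.ind (a x z) ℕ.* ∑ℕ.ind (a z y₀)) + ι (∑ℕ.ind (a x y₀))
        ≡⟨ ι-+ (∑ℕ.∑ ES λ z → ∑ℕ.ind (a x z) ℕ.* ∑ℕ.ind (a z y₀)) (∑ℕ.ind (a x y₀)) ⟨
      ι ((∑ℕ.∑ ES λ z → ∑ℕ.ind (a x z) ℕ.* ∑ℕ.ind (a z y₀)) ℕ.+ ∑ℕ.ind (a x y₀))
        ≡⟨ trans (cong ι eq) (ι-* f k) ⟩
      ι f * ι k ∎

  -- Modulo f the recursion for Y loses its last term and the operator squares to its negative.
  Y-mod : ∀ n → ∃ λ s → s * s ≡ 1ℚ × Integral s ×
          (∀ x → ∃ λ y → Integral y × Y (suc n) x ≡ s * ind (a x y₀) + ι f * y)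
  Y-mod zero = 1ℚ , ℚP.*-identityˡ 1ℚ , ind-integral true , λ x → 0ℚ , ind-integral false , (begin
    operator δ₀ x                  ≡⟨ sum-cong ys (λ z → ℚP.*-comm (ind (a x z)) (δ₀ z)) ⟩
    (∑ ES λ z → δ₀ z * ind (a x z))  ≡⟨ ∑-δ ES y₀ (λ z → ind (a x z)) ⟩
    ind (a x y₀)
      ≡⟨ solve 2 (λ i f → i := con (1 , 0) :* i :+ f :* con (0 , 0)) refl (ind (a x y₀)) (ι f) ⟩
    1ℚ * ind (a x y₀) + ι f * 0ℚ   ∎)
  Y-mod (suc n) with Y-mod n
  ... | s , s² , s-int , approx = - s , trans (solve 1 (λ s → :- s :* :- s := s :* s) refl s) s² , neg-integral {s} s-int , step
    where
    step : ∀ x → ∃ λ y → Integral y × Y (suc (suc n)) x ≡ - s * ind (a x y₀) + ι f * y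
    -- The new error collects the quotient of A² + A by f, the old error pushed through A, and the
    -- older term of the recursion divided by f.
    step x = s * ι k + Q - ι f * Y n x
           , +-integral {s * ι k + Q} { - (ι f * Y n x)}
               (+-integral {s * ι k} {Q} (*-integral {s} {ι k} s-int (ι-integral k))
                 (sum-integral ys λ z → *-integral {ind (a x z)} {rest z} (ind-integral (a x z)) (proj₁ (proj₂ (approx z)))))
               (neg-integral {ι f * Y n x} (*-integral {ι f} {Y n x} (ι-integral f) (Y-integral n x)))
           , (begin
      operator (Y (suc n)) x - ι f * ι f * Y n x
        ≡⟨ cong (_- ι f * ι f * Y n x) split ⟩
      s * P + ι f * Q - ι f * ι f * Y n x
        ≡⟨ cong (λ p → s * p + ι f * Q - ι f * ι f * Y n x) (proj₂ (column-square x)) ⟩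
      s * (ι f * ι k - ind (a x y₀)) + ι f * Q - ι f * ι f * Y n x
        ≡⟨ solve 6 (λ s f k i q y → s :* (f :* k :- i) :+ f :* q :- f :* f :* y
                      := :- s :* i :+ f :* (s :* k :+ q :- f :* y))
             refl s (ι f) (ι k) (ind (a x y₀)) Q (Y n x) ⟩
      - s * ind (a x y₀) + ι f * (s * ι k + Q - ι f * Y n x) ∎)
      where
      k = proj₁ (column-square x)
      P = ∑ ES λ z → ind (a x z) * ind (a z y₀)
      rest : S → ℚ
      rest z = proj₁ (approx z)
      Q = ∑ ES λ z → ind (a x z) * rest z
      split : operator (Y (suc n)) x ≡ s * P + ι f * Q
      split = begin
        (∑ ES λ z → ind (a x z) * Y (suc n) z)
          ≡⟨ sum-cong ys (λ z → trans (cong (ind (a x z) *_) (proj₂ (proj₂ (approx z))))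
               (solve 5 (λ i s j f y → i :* (s :* j :+ f :* y) := s :* (i :* j) :+ f :* (i :* y))
                 refl (ind (a x z)) s (ind (a z y₀)) (ι f) (rest z))) ⟩
        (∑ ES λ z → s * (ind (a x z) * ind (a z y₀)) + ι f * (ind (a x z) * rest z))
          ≡⟨ sum-+ (λ z → s * (ind (a x z) * ind (a z y₀))) (λ z → ι f * (ind (a x z) * rest z)) ys ⟩
        (∑ ES λ z → s * (ind (a x z) * ind (a z y₀))) + (∑ ES λ z → ι f * (ind (a x z) * rest z))
          ≡⟨ cong₂ _+_ (sum-*ˡ s (λ z → ind (a x z) * ind (a z y₀)) ys) (sum-*ˡ (ι f) (λ z → ind (a x z) * rest z) ys) ⟩
        s * P + ι f * Q ∎

  -- At the entry 1 the two descriptions of Y give s + f y = 2 f^(n+1) d. As n + 1 is positive, f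
  -- divides s, and multiplication by s turns this into a factorisation of 1.
  approximation⇒f≡1 : ∀ n s y → s * s ≡ 1ℚ → Integral s → Integral y →
                      Y (suc n) (π u₀) ≡ s * ind (a (π u₀) y₀) + ι f * y →
                      cheb (suc n) u₀ ≡ δ₀ (π u₀) → f ≡ 1
  approximation⇒f≡1 n s y s² s-int y-int eq returns =
    integral-unit f {s * (ι 2 * f^ n * d - y)}
      (*-integral {s} {ι 2 * f^ n * d - y} s-int
        (+-integral {ι 2 * f^ n * d} { - y}
          (*-integral {ι 2 * f^ n} {d} (*-integral {ι 2} {f^ n} (ι-integral 2) (f^-integral n))
            (ind-integral (π u₀ == y₀)))
          (neg-integral {y} y-int)))
      (begin
        1ℚ                                       ≡⟨ s² ⟨
        s * s                                    ≡⟨ solve 2 (λ s z → s :* s := s :* ((s :+ z) :- z)) refl s (ι f * y) ⟩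
        s * ((s + ι f * y) - ι f * y)            ≡⟨ cong (λ x → s * (x - ι f * y)) value ⟩
        s * (ι 2 * (ι f * f^ n) * d - ι f * y)
          ≡⟨ solve 6 (λ s t f p d y → s :* (t :* (f :* p) :* d :- f :* y) := f :* (s :* (t :* p :* d :- y)))
               refl s (ι 2) (ι f) (f^ n) d y ⟩
        ι f * (s * (ι 2 * f^ n * d - y)) ∎)
    where
    d = δ₀ (π u₀)
    value : s + ι f * y ≡ ι 2 * f^ (suc n) * d
    value = begin
      s + ι f * y                           ≡⟨ cong (_+ ι f * y) (ℚP.*-identityʳ s) ⟨
      s * 1ℚ + ι f * y                      ≡⟨ cong (λ b → s * ind b + ι f * y) a₀ ⟨
      s * ind (a (π u₀) y₀) + ι f * y       ≡⟨ eq ⟨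
      Y (suc n) (π u₀)                      ≡⟨ Y-chebyshev (suc n) u₀ ⟨
      ι 2 * f^ (suc n) * cheb (suc n) u₀    ≡⟨ cong (ι 2 * f^ (suc n) *_) returns ⟩
      ι 2 * f^ (suc n) * d                  ∎

  periodic⇒f≡1 : PeriodicQUCG R → f ≡ 1
  periodic⇒f≡1 per =
    let n , returns            = periodic⇒cheb per
        s , s² , s-int , approx = Y-mod n
        y , y-int , eq          = approx (π u₀)
    in approximation⇒f≡1 n s y s² s-int y-int eq (returns (δ₀ ∘ π) u₀)

-- Local rings and residue fields

module Ideals (R : FinCommRing) where
  open QuadraticUnits R

  _⊑_ : Subset R → Subset R → Set
  I ⊑ J = ∀ x → I x ≡ true → J x ≡ true

  -- The ideal I + R y; ideals are Boolean predicates, so the coefficient is searched for.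
  adjoin : Subset R → Carrier → Subset R
  adjoin I y x = any λ r → I (x + - (r * y))

  adjoin⁺ : ∀ I y {x} r → I (x + - (r * y)) ≡ true → adjoin I y x ≡ true
  adjoin⁺ I y {x} r = any-complete (λ r → I (x + - (r * y)))

  adjoin⁻ : ∀ I y {x} → adjoin I y x ≡ true → ∃ λ r → I (x + - (r * y)) ≡ true
  adjoin⁻ I y {x} = any-sound (λ r → I (x + - (r * y)))

  adjoin-mono : ∀ {I J} → I ⊑ J → ∀ y → adjoin I y ⊑ adjoin J y
  adjoin-mono {I} {J} I⊑J y x h with adjoin⁻ I y h
  ... | r , p = adjoin⁺ J y r (I⊑J _ p)

  ⊑-adjoin : ∀ I y → I ⊑ adjoin I y
  ⊑-adjoin I y x h = adjoin⁺ I y 0# (trans (cong I (solve 2 (λ x y → x :+ :- (con (0 , 0) :* y) := x) refl x y)) h)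

  module _ {I} (ideal : IsIdeal R I) where
    open IsIdeal ideal

    adjoin-self : ∀ y → adjoin I y y ≡ true
    adjoin-self y = adjoin⁺ I y 1#
      (trans (cong I (trans (cong (λ z → y + - z) (*-identityˡ y)) (-‿inverseʳ y))) zero-mem)

    adjoin-ideal : ∀ y → IsIdeal R (adjoin I y)
    adjoin-ideal y = record
      { zero-mem = ⊑-adjoin I y 0# zero-mem
      ; +-closed = λ x x′ h h′ → let (r , p) = adjoin⁻ I y h; (r′ , p′) = adjoin⁻ I y h′ in
          adjoin⁺ I y (r + r′) (trans (cong I (solve 5 (λ x x′ r r′ y →
            (x :+ x′) :+ :- ((r :+ r′) :* y) := (x :+ :- (r :* y)) :+ (x′ :+ :- (r′ :* y))) refl x x′ r r′ y))
            (+-closed _ _ p p′))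
      ; neg-closed = λ x h → let (r , p) = adjoin⁻ I y h in
          adjoin⁺ I y (- r) (trans (cong I (solve 3 (λ x r y →
            :- x :+ :- (:- r :* y) := :- (x :+ :- (r :* y))) refl x r y)) (neg-closed _ p))
      ; *-closed = λ s x h → let (r , p) = adjoin⁻ I y h in
          adjoin⁺ I y (s * r) (trans (cong I (solve 4 (λ s x r y →
            s :* x :+ :- ((s :* r) :* y) := s :* (x :+ :- (r :* y))) refl s x r y)) (*-closed s _ p))
      }

    contains-1 : I 1# ≡ true → ∀ x → I x ≡ true
    contains-1 h x = trans (cong I (sym (*-identityʳ x))) (*-closed x 1# h)

  -- One step of a greedy construction of a maximal ideal: y is adjoined unless that would produce
  -- 1.
  extend : Subset R → Carrier → Subset R
  extend I y = if adjoin I y 1# then I else adjoin I y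

  grow : List Carrier → Subset R → Subset R
  grow []       I = I
  grow (y ∷ ys) I = grow ys (extend I y)

  extend-ideal : ∀ {I} → IsIdeal R I → ∀ y → IsIdeal R (extend I y)
  extend-ideal {I} ideal y with adjoin I y 1#
  ... | true  = ideal
  ... | false = adjoin-ideal ideal y

  ⊑-extend : ∀ I y → I ⊑ extend I y
  ⊑-extend I y x h with adjoin I y 1#
  ... | true  = h
  ... | false = ⊑-adjoin I y x h

  extend-proper : ∀ {I} y → I 1# ≡ false → extend I y 1# ≡ false
  extend-proper {I} y h with adjoin I y 1# in eq
  ... | true  = h
  ... | false = eq

  extend-decides : ∀ {I} → IsIdeal R I → ∀ y → extend I y y ≡ true ⊎ adjoin (extend I y) y 1# ≡ true
  extend-decides {I} ideal y with adjoin I y 1# in eq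
  ... | true  = inj₂ eq
  ... | false = inj₁ (adjoin-self ideal y)

  grow-ideal : ∀ ys {I} → IsIdeal R I → IsIdeal R (grow ys I)
  grow-ideal []       ideal = ideal
  grow-ideal (y ∷ ys) ideal = grow-ideal ys (extend-ideal ideal y)

  ⊑-grow : ∀ ys I → I ⊑ grow ys I
  ⊑-grow []       I x h = h
  ⊑-grow (y ∷ ys) I x h = ⊑-grow ys (extend I y) x (⊑-extend I y x h)

  grow-proper : ∀ ys {I} → I 1# ≡ false → grow ys I 1# ≡ false
  grow-proper []       h = h
  grow-proper (y ∷ ys) {I} h = grow-proper ys (extend-proper {I} y h)

  -- A refusal is final: if 1 lay in I + R y when y was tried, it still does for every larger ideal.
  grow-decides : ∀ {ys} {I} → IsIdeal R I → ∀ {y} → y ∈ ys → grow ys I y ≡ true ⊎ adjoin (grow ys I) y 1# ≡ true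
  grow-decides {y ∷ ys} {I} ideal (here refl) with extend-decides ideal y
  ... | inj₁ h = inj₁ (⊑-grow ys (extend I y) y h)
  ... | inj₂ h = inj₂ (adjoin-mono (⊑-grow ys (extend I y)) y 1# h)
  grow-decides {z ∷ ys} ideal (there y∈) = grow-decides (extend-ideal ideal z) y∈

  -- An ideal J that goes beyond the grown one contains a refused y. Then 1 = i + r y with i in the
  -- grown ideal, so 1 lies in J.
  grow-maximal : ∀ {I} → IsIdeal R I → I 1# ≡ false → IsMaximalIdeal R (grow elems I)
  grow-maximal {I} ideal proper = record
    { ideal = grow-ideal elems ideal
    ; proper = 1# , grow-proper elems {I} proper
    ; maximal = dichotomy
    }
    where
    dichotomy : ∀ J → IsIdeal R J → grow elems I ⊑ J → J ⊑ grow elems I ⊎ (∀ x → J x ≡ true)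
    dichotomy J J-ideal I⊑J with search (λ y → J y ∧ not (grow elems I y))
    ... | inj₂ none = inj₁ λ x Jx → case (true-or (grow elems I x)) Jx (none x)
      where
      case : ∀ {a b} → b ≡ true ⊎ b ≢ true → a ≡ true → a ∧ not b ≡ false → b ≡ true
      case (inj₁ h) _ _ = h
      case (inj₂ h) p q = contradiction (∧-true p (not-true⁻ h)) (false≢true q)
    ... | inj₁ (y , h) with grow-decides ideal (complete y)
    ...   | inj₁ y∈ = contradiction y∈ (not-true (∧-trueʳ {J y} h))
    ...   | inj₂ p with adjoin⁻ (grow elems I) y p
    ...     | r , q = inj₂ (contains-1 J-ideal (trans
              (cong J (solve 2 (λ o z → o := (o :+ :- z) :+ z) refl 1# (r * y)))
              (+-closed _ _ (I⊑J _ q) (*-closed r y (∧-trueˡ h)))))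
      where open IsIdeal J-ideal

  principal : Carrier → Subset R
  principal = adjoin (_== 0#)

  zero-ideal : IsIdeal R (_== 0#)
  zero-ideal = record
    { zero-mem = ==-complete refl
    ; +-closed = λ x y p q → ==-complete (trans (cong₂ _+_ (==-sound p) (==-sound q)) (+-identityˡ 0#))
    ; neg-closed = λ x p → ==-complete (trans (cong -_ (==-sound p)) (solve 0 (:- con (0 , 0) := con (0 , 0)) refl))
    ; *-closed = λ r x p → ==-complete (trans (cong (r *_) (==-sound p)) (zeroʳ r))
    }

  module _ {M} (local : IsLocalWith R M) where
    open IsLocalWith local
    open IsMaximalIdeal max using () renaming (ideal to M-ideal; proper to M-proper)

    M-1 : M 1# ≡ false
    M-1 = ≢true λ h → false≢true (proj₂ M-proper) (contains-1 M-ideal h (proj₁ M-proper))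

    -- If the principal ideal of x were proper, it would grow to a maximal ideal, which is M by
    -- uniqueness, and x would lie in M.
    ∉M⇒Unit : ∀ {x} → M x ≡ false → Unit x
    ∉M⇒Unit {x} x∉M with true-or (principal x 1#)
    ... | inj₁ h with adjoin⁻ (_== 0#) x h
    ...   | r , p = r , trans (*-comm x r) (sym (difference-0 (==-sound p)))
    ∉M⇒Unit {x} x∉M | inj₂ h = contradiction
      (trans (sym (unique-max _ (grow-maximal (adjoin-ideal zero-ideal x) (≢true h)) x))
        (⊑-grow elems (principal x) x (adjoin-self zero-ideal x)))
      (false≢true x∉M)

first : ∀ {A : Set} → (A → Bool) → List A → A → A
first p []       d = d
first p (x ∷ xs) d = if p x then x else first p xs d

first-true : ∀ {A : Set} (p : A → Bool) {xs x} d → x ∈ xs → p x ≡ true → p (first p xs d) ≡ true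
first-true p {y ∷ ys} d x∈ px with p y in eq
... | true = eq
first-true p {y ∷ ys} d (here refl) px | false = contradiction px (false≢true eq)
first-true p {y ∷ ys} d (there x∈)  px | false = first-true p d x∈ px

first-cong : ∀ {A : Set} {p q : A → Bool} → (∀ x → p x ≡ q x) → ∀ xs d → first p xs d ≡ first q xs d
first-cong eq []       d = refl
first-cong eq (x ∷ xs) d = cong₂ (λ b r → if b then x else r) (eq x) (first-cong eq xs d)

module Quotient (R : FinCommRing) (I : Subset R) (ideal : IsIdeal R I)
                (I-1 : I (FinCommRing.1# R) ≡ false) where
  open QuadraticUnits R
  open IsIdeal ideal
  open ≡-Reasoning

  infix 4 _~_
  _~_ : Carrier → Carrier → Set
  x ~ y = I (x + - y) ≡ true

  ~-refl : ∀ {x} → x ~ x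
  ~-refl {x} = trans (cong I (-‿inverseʳ x)) zero-mem

  ~-reflexive : ∀ {x y} → x ≡ y → x ~ y
  ~-reflexive refl = ~-refl

  ~-sym : ∀ {x y} → x ~ y → y ~ x
  ~-sym {x} {y} p = trans (cong I (solve 2 (λ x y → y :+ :- x := :- (x :+ :- y)) refl x y)) (neg-closed _ p)

  ~-trans : ∀ {x y z} → x ~ y → y ~ z → x ~ z
  ~-trans {x} {y} {z} p q = trans
    (cong I (solve 3 (λ x y z → x :+ :- z := (x :+ :- y) :+ (y :+ :- z)) refl x y z)) (+-closed _ _ p q)

  ~-+ : ∀ {x x′ y y′} → x ~ x′ → y ~ y′ → x + y ~ x′ + y′
  ~-+ {x} {x′} {y} {y′} p q = trans (cong I (solve 4 (λ x x′ y y′ →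
    (x :+ y) :+ :- (x′ :+ y′) := (x :+ :- x′) :+ (y :+ :- y′)) refl x x′ y y′)) (+-closed _ _ p q)

  ~-* : ∀ {x x′ y y′} → x ~ x′ → y ~ y′ → x * y ~ x′ * y′
  ~-* {x} {x′} {y} {y′} p q = trans (cong I (solve 4 (λ x x′ y y′ →
    (x :* y) :+ :- (x′ :* y′) := y :* (x :+ :- x′) :+ x′ :* (y :+ :- y′)) refl x x′ y y′))
    (+-closed _ _ (*-closed y _ p) (*-closed x′ _ q))

  opaque
    -- Congruent elements have the same search predicate, hence the same first hit. Such canonical
    -- representatives let the quotient ring use propositional equality. The search always succeeds,
    -- at x at the latest.
    rep : Carrier → Carrier
    rep x = first (λ y → I (x + - y)) elems 0#

    rep-~ : ∀ x → x ~ rep x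
    rep-~ x = first-true (λ y → I (x + - y)) 0# (complete x) ~-refl

    rep-cong : ∀ {x y} → x ~ y → rep x ≡ rep y
    rep-cong p = first-cong (λ z → Bool-ext (~-trans (~-sym p)) (~-trans p)) elems 0#

    rep-idem : ∀ x → rep (rep x) ≡ rep x
    rep-idem x = rep-cong (~-sym (rep-~ x))

  Class : Set
  Class = Σ Carrier λ x → rep x ≡ x

  lift : Class → Carrier
  lift = proj₁

  class : Carrier → Class
  class x = rep x , rep-idem x

  Class-≡ : ∀ {a b : Class} → lift a ≡ lift b → a ≡ b
  Class-≡ {x , p} {.x , q} refl = cong (x ,_) (uip p q)
    where
    uip : ∀ {u v : Carrier} (p q : u ≡ v) → p ≡ q
    uip refl refl = refl

  class-cong : ∀ {x y} → x ~ y → class x ≡ class y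
  class-cong p = Class-≡ (rep-cong p)

  class-exact : ∀ {x y} → class x ≡ class y → x ~ y
  class-exact {x} {y} p = ~-trans (rep-~ x) (~-sym (subst (y ~_) (sym (cong lift p)) (rep-~ y)))

  class-lift : ∀ a → class (lift a) ≡ a
  class-lift (x , p) = Class-≡ p

  lift-class : ∀ x → lift (class x) ~ x
  lift-class x = ~-sym (rep-~ x)

  _⊕_ _⊗_ : Class → Class → Class
  a ⊕ b = class (lift a + lift b)
  a ⊗ b = class (lift a * lift b)

  ⊝_ : Class → Class
  ⊝ a = class (- lift a)

  class-+ : ∀ x y → class (x + y) ≡ class x ⊕ class y
  class-+ x y = class-cong (~-+ (rep-~ x) (rep-~ y))

  class-* : ∀ x y → class (x * y) ≡ class x ⊗ class y
  class-* x y = class-cong (~-* (rep-~ x) (rep-~ y))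

  private
    ⊕-comm : ∀ a b → a ⊕ b ≡ b ⊕ a
    ⊕-comm a b = cong class (+-comm (lift a) (lift b))

    ⊗-comm : ∀ a b → a ⊗ b ≡ b ⊗ a
    ⊗-comm a b = cong class (*-comm (lift a) (lift b))

    ⊕-assoc : ∀ a b c → (a ⊕ b) ⊕ c ≡ a ⊕ (b ⊕ c)
    ⊕-assoc a@(x , _) b@(y , _) c@(z , _) = class-cong {lift (a ⊕ b) + z} {x + lift (b ⊕ c)}
      (~-trans (~-+ (lift-class (x + y)) (~-refl {z}))
        (~-trans (~-reflexive (+-assoc x y z)) (~-+ (~-refl {x}) (rep-~ (y + z)))))

    ⊗-assoc : ∀ a b c → (a ⊗ b) ⊗ c ≡ a ⊗ (b ⊗ c)
    ⊗-assoc a@(x , _) b@(y , _) c@(z , _) = class-cong {lift (a ⊗ b) * z} {x * lift (b ⊗ c)}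
      (~-trans (~-* (lift-class (x * y)) (~-refl {z}))
        (~-trans (~-reflexive (*-assoc x y z)) (~-* (~-refl {x}) (rep-~ (y * z)))))

    ⊕-identityˡ : ∀ a → class 0# ⊕ a ≡ a
    ⊕-identityˡ a@(x , _) = trans (class-cong {lift (class 0#) + x} {x}
      (~-trans (~-+ (lift-class 0#) (~-refl {x})) (~-reflexive (+-identityˡ x)))) (class-lift a)

    ⊗-identityˡ : ∀ a → class 1# ⊗ a ≡ a
    ⊗-identityˡ a@(x , _) = trans (class-cong {lift (class 1#) * x} {x}
      (~-trans (~-* (lift-class 1#) (~-refl {x})) (~-reflexive (*-identityˡ x)))) (class-lift a)

    ⊕-inverseˡ : ∀ a → (⊝ a) ⊕ a ≡ class 0#
    ⊕-inverseˡ a@(x , _) = class-cong {lift (⊝ a) + x} {0#}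
      (~-trans (~-+ (lift-class (- x)) (~-refl {x})) (~-reflexive (-‿inverseˡ x)))

    ⊗-distribˡ : ∀ a b c → a ⊗ (b ⊕ c) ≡ (a ⊗ b) ⊕ (a ⊗ c)
    ⊗-distribˡ a@(x , _) b@(y , _) c@(z , _) =
      class-cong {x * lift (b ⊕ c)} {lift (a ⊗ b) + lift (a ⊗ c)}
        (~-trans (~-* (~-refl {x}) (lift-class (y + z)))
          (~-trans (~-reflexive (distribˡ x y z)) (~-+ (rep-~ (x * y)) (rep-~ (x * z)))))

  isCommutativeRing-Class : IsCommutativeRing _≡_ _⊕_ _⊗_ ⊝_ (class 0#) (class 1#)
  isCommutativeRing-Class = record
    { isRing = record
      { +-isAbelianGroup = record
        { isGroup = record
          { isMonoid = record
            { isSemigroup = record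
              { isMagma = record { isEquivalence = isEquivalence ; ∙-cong = cong₂ _⊕_ }
              ; assoc = ⊕-assoc
              }
            ; identity = ⊕-identityˡ , λ a → trans (⊕-comm a (class 0#)) (⊕-identityˡ a)
            }
          ; inverse = ⊕-inverseˡ , λ a → trans (⊕-comm a (⊝ a)) (⊕-inverseˡ a)
          ; ⁻¹-cong = cong ⊝_
          }
        ; comm = ⊕-comm
        }
      ; *-cong = cong₂ _⊗_
      ; *-assoc = ⊗-assoc
      ; *-identity = ⊗-identityˡ , λ a → trans (⊗-comm a (class 1#)) (⊗-identityˡ a)
      ; distrib = ⊗-distribˡ , λ a b c → trans (⊗-comm (b ⊕ c) a)
          (trans (⊗-distribˡ a b c) (cong₂ _⊕_ (⊗-comm a b) (⊗-comm a c)))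
      }
    ; *-comm = ⊗-comm
    }

  _≟ᶜ_ : DecidableEquality Class
  a ≟ᶜ b = map′ Class-≡ (cong lift) (lift a ≟ lift b)

  classRing : FinCommRing
  classRing = record
    { Carrier = Class
    ; isCommutativeRing = isCommutativeRing-Class
    ; _≟_ = _≟ᶜ_
    ; elems = deduplicate _≟ᶜ_ (map class elems)
    ; complete = λ a → ∈-deduplicate⁺ _≟ᶜ_
        (subst (_∈ map class elems) (class-lift a) (∈-map⁺ class (complete (lift a))))
    ; unique = DecUnique.deduplicate-! _≟ᶜ_ (map class elems)
    ; nontrivial = λ p → false≢true I-1 (trans (cong I 1-0) (class-exact p))
    }
    where
    1-0 : 1# ≡ 1# + - 0#
    1-0 = solve 1 (λ x → x := x :+ :- con (0 , 0)) refl 1#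

  class-0⇒I : ∀ {x} → class x ≡ class 0# → I x ≡ true
  class-0⇒I {x} p = trans (cong I (solve 1 (λ x → x := x :+ :- con (0 , 0)) refl x)) (class-exact p)

  I⇒class-0 : ∀ {x} → I x ≡ true → class x ≡ class 0#
  I⇒class-0 {x} p = class-cong (trans (cong I (solve 1 (λ x → x :+ :- con (0 , 0) := x) refl x)) p)

  private
    module C = Enumeration (enumeration classRing)

  -- The fibre over a is the coset `lift a` + I, and translation identifies it with I.
  class-fibre : ∀ a → (∑ℕ.∑ E λ x → ∑ℕ.ind (class x C.== a)) ≡ ∑ℕ.∑ E (∑ℕ.ind ∘ I)
  class-fibre a = trans (sym (ℕ-sums.∑-translate (lift a) λ x → ∑ℕ.ind (class x C.== a)))
    (∑ℕ.sum-cong elems λ x → cong ∑ℕ.ind (Bool-ext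
      (λ p → trans (cong I (shift x)) (class-exact (trans (C.==-sound p) (sym (class-lift a)))))
      (λ p → C.==-complete (trans (class-cong (trans (cong I (sym (shift x))) p)) (class-lift a)))))
    where
    shift : ∀ x → x ≡ (lift a + x) + - lift a
    shift x = solve 2 (λ a x → x := (a :+ x) :+ :- a) refl (lift a) x

  size-class : size E ≡ size (enumeration classRing) ℕ.* ∑ℕ.∑ E (∑ℕ.ind ∘ I)
  size-class = begin
    size E
      ≡⟨ ∑ℕ.∑-fibre-1 E (enumeration classRing) class (λ _ → 1) ⟩
    (∑ℕ.∑ (enumeration classRing) λ a → (∑ℕ.∑ E λ x → ∑ℕ.ind (class x C.== a)) ℕ.* 1)
      ≡⟨ ∑ℕ.sum-cong C.elems (λ a → trans (ℕP.*-identityʳ _)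
           (trans (class-fibre a) (sym (ℕP.*-identityˡ _)))) ⟩
    (∑ℕ.∑ (enumeration classRing) λ a → 1 ℕ.* ∑ℕ.∑ E (∑ℕ.ind ∘ I))
      ≡⟨ ∑ℕ.sum-*ʳ _ (λ _ → 1) C.elems ⟩
    size (enumeration classRing) ℕ.* ∑ℕ.∑ E (∑ℕ.ind ∘ I) ∎

  -- By `size-class` the division is exact, and its divisor is positive because 0 lies in I.
  resSize-class : resSize R I ≡ size (enumeration classRing)
  resSize-class with card R I in eq
  ... | zero  = contradiction
    (sum-tight {f = λ _ → 0} elems (λ _ → z≤n)
      (trans (∑ℕ.sum-0 elems) (trans (sym eq) (countB-sum I elems))) (complete 0#))
    λ p → contradiction (trans p (cong ∑ℕ.ind zero-mem)) λ ()
  ... | suc m = trans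
    (cong (λ n → divℕ n (suc m)) (trans (countB-sum (λ _ → true) elems)
      (trans size-class (cong (size (enumeration classRing) ℕ.*_) (trans (sym (countB-sum I elems)) eq)))))
    (m*n/n≡m (size (enumeration classRing)) (suc m))

-- Sums of two elements of T

-- In a complete graph on n + 1 vertices A² + A = n J.
complete-square : ∀ {S : Set} (ES : Enumeration S) {n} → size ES ≡ suc n → let open Enumeration ES; open ∑ℕ in
                  ∀ x y → (∑ ES λ z → ind (not (x == z)) ℕ.* ind (not (z == y))) ℕ.+ ind (not (x == y)) ≡ n
complete-square ES {n} size-eq x y = ℕP.+-cancelˡ-≡ 2 _ _ (begin
  2 ℕ.+ (P ℕ.+ ind (not (x == y)))                          ≡⟨ arrange P (ind (not (x == y))) ⟩
  (P ℕ.+ (1 ℕ.+ 1)) ℕ.+ ind (not (x == y))                  ≡⟨ cong (ℕ._+ ind (not (x == y))) total ⟩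
  (suc n ℕ.+ ind (x == y)) ℕ.+ ind (not (x == y))           ≡⟨ ℕP.+-assoc (suc n) (ind (x == y)) _ ⟩
  suc n ℕ.+ (ind (x == y) ℕ.+ ind (not (x == y)))           ≡⟨ cong (suc n ℕ.+_) (excluded-middle (x == y)) ⟩
  suc n ℕ.+ 1                                               ≡⟨ ℕP.+-comm (suc n) 1 ⟩
  2 ℕ.+ n                                                   ∎)
  where
  open Enumeration ES
  open ∑ℕ
  open ≡-Reasoning
  P = ∑ ES λ z → ind (not (x == z)) ℕ.* ind (not (z == y))
  arrange : ∀ p i → 2 ℕ.+ (p ℕ.+ i) ≡ (p ℕ.+ 2) ℕ.+ i
  arrange = solve-∀
  excluded-middle : ∀ b → ind b ℕ.+ ind (not b) ≡ 1
  excluded-middle true  = refl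
  excluded-middle false = refl
  -- (1 - p)(1 - q) = 1 - p - q + p q, with the negative terms moved across.
  inclusion-exclusion : ∀ p q → ind (not p) ℕ.* ind (not q) ℕ.+ (ind p ℕ.+ ind q) ≡ 1 ℕ.+ ind p ℕ.* ind q
  inclusion-exclusion true  true  = refl
  inclusion-exclusion true  false = refl
  inclusion-exclusion false true  = refl
  inclusion-exclusion false false = refl
  total : P ℕ.+ (1 ℕ.+ 1) ≡ suc n ℕ.+ ind (x == y)
  total = begin
    P ℕ.+ (1 ℕ.+ 1)
      ≡⟨ cong (P ℕ.+_) (cong₂ ℕ._+_
           (sym (trans (sum-cong elems λ z → sym (ℕP.*-identityʳ _)) (∑-δ′ ES x λ _ → 1))) (sym (∑-δ-1 ES y))) ⟩
    P ℕ.+ ((∑ ES λ z → ind (x == z)) ℕ.+ (∑ ES λ z → ind (z == y)))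
      ≡⟨ cong (P ℕ.+_) (sum-+ _ _ elems) ⟨
    P ℕ.+ (∑ ES λ z → ind (x == z) ℕ.+ ind (z == y))
      ≡⟨ sum-+ _ _ elems ⟨
    (∑ ES λ z → ind (not (x == z)) ℕ.* ind (not (z == y)) ℕ.+ (ind (x == z) ℕ.+ ind (z == y)))
      ≡⟨ sum-cong elems (λ z → inclusion-exclusion (x == z) (z == y)) ⟩
    (∑ ES λ z → 1 ℕ.+ ind (x == z) ℕ.* ind (z == y))
      ≡⟨ sum-+ _ _ elems ⟩
    size ES ℕ.+ (∑ ES λ z → ind (x == z) ℕ.* ind (z == y))
      ≡⟨ cong₂ ℕ._+_ size-eq (∑-δ′ ES x λ z → ind (z == y)) ⟩
    suc n ℕ.+ ind (x == y) ∎

-- The adjacency operator of a field satisfies A² ≡ − A modulo half its degree.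
record SquareCongruence (F : FinCommRing) (e : ℕ) : Set where
  open QuadraticUnits F using (E; degree; _+_; -_)
  open ∑ℕ
  field
    half        : ℕ
    degree≡half : degree ≡ 2 ℕ.* half
    square      : ∀ x y → ∃ λ k → (∑ E λ z → ind (inT F (z + - x)) ℕ.* ind (inT F (y + - z)))
                    ℕ.+ ind (inT F (y + - x)) ≡ half ℕ.* k
    -- `half` is e or 2 e; this field lets later arguments treat both alike, since 2 e = 1 is
    -- absurd.
    half≡1⇒e≡1  : half ≡ 1 → e ≡ 1

module FieldSums (F : FinCommRing) (invertible : ∀ x → x ≢ FinCommRing.0# F → QuadraticUnits.Unit F x)
                 (e : ℕ) (size-eq : size (enumeration F) ≡ suc (4 ℕ.* e)) where
  open QuadraticUnits F
  open ∑ℕ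
  open ≡-Reasoning

  nonzero : Carrier → Bool
  nonzero x = not (x == 0#)

  nonzero⇒≢0 : ∀ {x} → nonzero x ≡ true → x ≢ 0#
  nonzero⇒≢0 h p = not-true h (==-complete p)

  T⇒≢0 : ∀ {x} → inT F x ≡ true → x ≢ 0#
  T⇒≢0 h refl = ¬Unit-0 (T⇒Unit (inT⁻ h))

  inT-0 : inT F 0# ≡ false
  inT-0 = ≢true λ h → T⇒≢0 h refl

  ∑-nonzero : (∑ E λ x → ind (nonzero x)) ≡ 4 ℕ.* e
  ∑-nonzero = ℕP.suc-injective (begin
    1 ℕ.+ (∑ E λ x → ind (nonzero x))                          ≡⟨ cong (ℕ._+ (∑ E λ x → ind (nonzero x))) (∑-δ-1 E 0#) ⟨
    (∑ E λ x → ind (x == 0#)) ℕ.+ (∑ E λ x → ind (nonzero x))  ≡⟨ sum-+ _ _ elems ⟨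
    (∑ E λ x → ind (x == 0#) ℕ.+ ind (nonzero x))              ≡⟨ sum-cong elems (λ x → excluded-middle (x == 0#)) ⟩
    size E                                                     ≡⟨ size-eq ⟩
    suc (4 ℕ.* e)                                              ∎)
    where
    excluded-middle : ∀ b → ind b ℕ.+ ind (not b) ≡ 1
    excluded-middle true  = refl
    excluded-middle false = refl

  ind-≤ : ∀ {a} {n} → (a ≡ true → 1 ℕ.≤ n) → ind a ℕ.≤ n
  ind-≤ {true}  h = h refl
  ind-≤ {false} h = z≤n

  -- If x² = w² with x ≠ w, cancelling x - w leaves x = - w, so y has at most two square roots; if
  -- it has one at all, y is in T.
  square-fibre-≤ : ∀ y → (∑ E λ x → ind (nonzero x) ℕ.* ind ((x * x) == y)) ℕ.≤ 2 ℕ.* ind (inT F y)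
  square-fibre-≤ y with search (λ x → nonzero x ∧ ((x * x) == y))
  ... | inj₂ none = ℕP.≤-trans (ℕP.≤-reflexive (trans
          (sum-cong elems λ x → trans (sym (ind-∧ (nonzero x) ((x * x) == y))) (cong ind (none x))) (sum-0 elems))) z≤n
  ... | inj₁ (w , h) = ℕP.≤-trans (sum-mono elems pointwise) (ℕP.≤-reflexive (begin
          (∑ E λ x → ind (x == w) ℕ.+ ind (x == (- w)))                ≡⟨ sum-+ _ _ elems ⟩
          (∑ E λ x → ind (x == w)) ℕ.+ (∑ E λ x → ind (x == (- w)))    ≡⟨ cong₂ ℕ._+_ (∑-δ-1 E w) (∑-δ-1 E (- w)) ⟩
          2                                                            ≡⟨ cong (λ b → 2 ℕ.* ind b) y∈T ⟨
          2 ℕ.* ind (inT F y)                                          ∎))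
    where
    w²≡y : w * w ≡ y
    w²≡y = ==-sound (∧-trueʳ {nonzero w} h)
    y∈T : inT F y ≡ true
    y∈T = inT⁺ (subst T w²≡y (T-square (invertible w (nonzero⇒≢0 (∧-trueˡ h)))))
    pointwise : ∀ x → ind (nonzero x) ℕ.* ind ((x * x) == y) ℕ.≤ ind (x == w) ℕ.+ ind (x == (- w))
    pointwise x = subst (ℕ._≤ _) (ind-∧ (nonzero x) ((x * x) == y)) (ind-≤ λ p → case x p (search-root x))
      where
      search-root : ∀ x → x ≡ w ⊎ x ≢ w
      search-root x with x ≟ w
      ... | yes p = inj₁ p
      ... | no p  = inj₂ p
      case : ∀ x → nonzero x ∧ ((x * x) == y) ≡ true → x ≡ w ⊎ x ≢ w → 1 ℕ.≤ ind (x == w) ℕ.+ ind (x == (- w))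
      case x p (inj₁ x≡w) = ℕP.≤-trans (ℕP.≤-reflexive (cong ind (sym (==-complete x≡w)))) (ℕP.m≤m+n _ _)
      case x p (inj₂ x≢w) = ℕP.≤-trans (ℕP.≤-reflexive (cong ind (sym (==-complete x≡-w)))) (ℕP.m≤n+m _ _)
        where
        x≡-w : x ≡ - w
        x≡-w = Unit-cancel (invertible (x + - w) (x≢w ∘ difference-0)) (begin
          (x + - w) * x
            ≡⟨ solve 2 (λ x w → (x :+ :- w) :* x := (x :* x) :+ (:- (w :* w)) :+ ((x :+ :- w) :* :- w)) refl x w ⟩
          x * x + - (w * w) + (x + - w) * - w
            ≡⟨ cong (λ z → z + (x + - w) * - w) (trans (cong₂ (λ a b → a + - b)
                 (==-sound (∧-trueʳ {nonzero x} p)) w²≡y) (-‿inverseʳ y)) ⟩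
          0# + (x + - w) * - w  ≡⟨ +-identityˡ _ ⟩
          (x + - w) * - w       ∎)

  -- Squaring maps the 4 e units into T at most two to one, so T has index at most two in the units.
  nonzero≤2T : 4 ℕ.* e ℕ.≤ 2 ℕ.* degree
  nonzero≤2T = ℕP.≤-trans (ℕP.≤-reflexive (begin
    4 ℕ.* e                                                               ≡⟨ ∑-nonzero ⟨
    (∑ E λ x → ind (nonzero x))                                           ≡⟨ sum-cong elems (λ x → ℕP.*-identityʳ _) ⟨
    (∑ E λ x → ind (nonzero x) ℕ.* 1)                                     ≡⟨ ∑-fibre E E (λ x → x * x) (ind ∘ nonzero) (λ _ → 1) ⟩
    (∑ E λ y → (∑ E λ x → ind (nonzero x) ℕ.* ind ((x * x) == y)) ℕ.* 1)  ≡⟨ sum-cong elems (λ y → ℕP.*-identityʳ _) ⟩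
    (∑ E λ y → ∑ E λ x → ind (nonzero x) ℕ.* ind ((x * x) == y))          ∎))
    (ℕP.≤-trans (sum-mono elems square-fibre-≤) (ℕP.≤-reflexive (sum-*ˡ 2 (λ y → ind (inT F y)) elems)))

  module AllUnits (all : ∀ x → nonzero x ≡ true → inT F x ≡ true) where

    inT≡nonzero : ∀ x → inT F x ≡ nonzero x
    inT≡nonzero x = Bool-ext (λ h → not-true⁻ (T⇒≢0 h ∘ ==-sound)) (all x)

    inT-difference : ∀ x y → inT F (y + - x) ≡ not (x == y)
    inT-difference x y = trans (inT≡nonzero (y + - x)) (cong not (Bool-ext
      (λ p → ==-complete (sym (difference-0 (==-sound p))))
      (λ p → ==-complete (trans (cong (y +_) (cong -_ (==-sound p))) (-‿inverseʳ y)))))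

    congruence : SquareCongruence F e
    congruence = record
      { half = 2 ℕ.* e
      ; degree≡half = trans (sum-cong elems λ x → cong ind (inT≡nonzero x)) (trans ∑-nonzero (double e))
      -- The graph is complete on 4 e + 1 vertices: A² + A has all entries 4 e = 2 e · 2.
      ; square = λ x y → 2 , trans
          (cong₂ ℕ._+_ (sum-cong elems λ z → cong₂ (λ a b → ind a ℕ.* ind b) (inT-difference x z) (inT-difference z y))
                       (cong ind (inT-difference x y)))
          (trans (complete-square E size-eq x y) (double′ e))
      ; half≡1⇒e≡1 = λ p → contradiction (ℕP.m*n≡1⇒m≡1 2 e p) λ ()
      }
      where
      double : ∀ e → 4 ℕ.* e ≡ 2 ℕ.* (2 ℕ.* e)
      double = solve-∀
      double′ : ∀ e → 4 ℕ.* e ≡ 2 ℕ.* e ℕ.* 2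
      double′ = solve-∀

  nonT : Carrier → Bool
  nonT x = nonzero x ∧ not (inT F x)

  nonT⇒≢0 : ∀ {x} → nonT x ≡ true → x ≢ 0#
  nonT⇒≢0 h = nonzero⇒≢0 (∧-trueˡ h)

  nonT⇒¬T : ∀ {x} → nonT x ≡ true → ¬ T x
  nonT⇒¬T {x} h t = not-true (∧-trueʳ {nonzero x} h) (inT⁺ t)

  trichotomy : ∀ x → ind (x == 0#) ℕ.+ (ind (inT F x) ℕ.+ ind (nonT x)) ≡ 1
  trichotomy x with x == 0# in eq | inT F x in h
  ... | true  | true  = contradiction (==-sound eq) (T⇒≢0 h)
  ... | true  | false = refl
  ... | false | true  = refl
  ... | false | false = refl

  inT-scale-0 : ∀ {s} → Unit s → (∑ E λ x → ind (inT F (s * x))) ≡ degree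
  inT-scale-0 u = ℕ-sums.∑-scale u λ x → ind (inT F x)

  -- The product of a t and b t is a b t², and dividing by the square of a unit stays in T.
  T-ratio : ∀ {a b t} → T (a * t) → T (b * t) → T (a * b)
  T-ratio {a} {b} {t} p q with T⇒Unit (subst T (*-comm b t) q)
  ... | u with Unit-factor u
  ...   | t′ , tt′ = subst T (begin
    ((a * t) * (b * t)) * (t′ * t′)
      ≡⟨ solve 4 (λ a b t t′ → ((a :* t) :* (b :* t)) :* (t′ :* t′) := (a :* b) :* ((t :* t′) :* (t :* t′))) refl a b t t′ ⟩
    (a * b) * ((t * t′) * (t * t′))  ≡⟨ cong (λ z → (a * b) * (z * z)) tt′ ⟩
    (a * b) * (1# * 1#)              ≡⟨ cong ((a * b) *_) (*-identityˡ 1#) ⟩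
    (a * b) * 1#                     ≡⟨ *-identityʳ _ ⟩
    a * b                            ∎)
    (T-* (T-* p q) (T-square (t , trans (*-comm t′ t) tt′)))

  at-most-one : ∀ a b c → ¬ (a ≡ true × b ≡ true) → ¬ (a ≡ true × c ≡ true) → ¬ (b ≡ true × c ≡ true) →
                ind a ℕ.+ (ind b ℕ.+ ind c) ℕ.≤ 1
  at-most-one true  true  c     p q r = contradiction (refl , refl) p
  at-most-one true  false true  p q r = contradiction (refl , refl) q
  at-most-one true  false false p q r = s≤s z≤n
  at-most-one false true  true  p q r = contradiction (refl , refl) r
  at-most-one false true  false p q r = s≤s z≤n
  at-most-one false false c     p q r = ind-≤ λ _ → s≤s z≤n

  -- If x y were not in T, then T, x⁻¹ T and y⁻¹ T would be disjoint, but there are at most 2 |T| units.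
  nonT-* : ∀ {x y} → nonT x ≡ true → nonT y ≡ true → inT F (x * y) ≡ true
  nonT-* {x} {y} x∉ y∉ with true-or (inT F (x * y))
  ... | inj₁ h = h
  ... | inj₂ h = contradiction three≤two three≰two
    where
    -- A unit t lying in two of the three sets would, by `T-ratio`, put x, y or x y into T.
    disjoint : ∀ t → ind (inT F t) ℕ.+ (ind (inT F (x * t)) ℕ.+ ind (inT F (y * t))) ℕ.≤ ind (nonzero t)
    disjoint t with t ≟ 0#
    ... | yes refl = ℕP.≤-reflexive (cong₂ ℕ._+_ (cong ind inT-0) (cong₂ ℕ._+_
            (cong ind (trans (cong (inT F) (zeroʳ x)) inT-0)) (cong ind (trans (cong (inT F) (zeroʳ y)) inT-0))))
    ... | no _ = at-most-one _ _ _
            (λ (p , q) → nonT⇒¬T x∉ (subst T (*-identityʳ x)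
              (T-ratio {x} {1#} (inT⁻ q) (subst T (sym (*-identityˡ t)) (inT⁻ p)))))
            (λ (p , q) → nonT⇒¬T y∉ (subst T (*-identityʳ y)
              (T-ratio {y} {1#} (inT⁻ q) (subst T (sym (*-identityˡ t)) (inT⁻ p)))))
            (λ (p , q) → h (inT⁺ (T-ratio (inT⁻ p) (inT⁻ q))))
    three≤two : degree ℕ.+ (degree ℕ.+ degree) ℕ.≤ 2 ℕ.* degree
    three≤two = ℕP.≤-trans (ℕP.≤-reflexive (begin
      degree ℕ.+ (degree ℕ.+ degree)
        ≡⟨ cong (degree ℕ.+_) (cong₂ ℕ._+_ (inT-scale-0 (invertible x (nonT⇒≢0 x∉))) (inT-scale-0 (invertible y (nonT⇒≢0 y∉)))) ⟨
      degree ℕ.+ ((∑ E λ t → ind (inT F (x * t))) ℕ.+ (∑ E λ t → ind (inT F (y * t))))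
        ≡⟨ cong (degree ℕ.+_) (sum-+ _ _ elems) ⟨
      degree ℕ.+ (∑ E λ t → ind (inT F (x * t)) ℕ.+ ind (inT F (y * t)))
        ≡⟨ sum-+ _ _ elems ⟨
      (∑ E λ t → ind (inT F t) ℕ.+ (ind (inT F (x * t)) ℕ.+ ind (inT F (y * t)))) ∎))
      (ℕP.≤-trans (sum-mono elems disjoint) (ℕP.≤-trans (ℕP.≤-reflexive ∑-nonzero) nonzero≤2T))
    three≰two : ¬ (degree ℕ.+ (degree ℕ.+ degree) ℕ.≤ 2 ℕ.* degree)
    three≰two le = degree≢0 (ℕP.n≤0⇒n≡0 (ℕP.+-cancelʳ-≤ (degree ℕ.+ degree) _ _
      (ℕP.≤-trans le (ℕP.≤-reflexive (cong (degree ℕ.+_) (ℕP.+-identityʳ degree))))))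

  -- Multiplication by an element outside T swaps the two cosets: y and x y cannot both lie in T,
  -- and `nonT-*` covers the case that neither factor does.
  inT-nonT : ∀ {x} → nonT x ≡ true → ∀ y → inT F (x * y) ≡ nonT y
  inT-nonT {x} x∉ y = Bool-ext
    (λ h → ∧-true
      (not-true⁻ λ p → T⇒≢0 h (trans (cong (x *_) (==-sound p)) (zeroʳ x)))
      (not-true⁻ λ p → nonT⇒¬T x∉ (subst T (*-identityʳ x)
        (T-ratio {x} {1#} (inT⁻ h) (subst T (sym (*-identityˡ y)) (inT⁻ p))))))
    (nonT-* x∉)

  module HalfUnits (ν : Carrier) (ν∉T : nonT ν ≡ true) where

    ∑-nonT : (∑ E λ x → ind (nonT x)) ≡ degree
    ∑-nonT = trans (sum-cong elems λ x → cong ind (sym (inT-nonT ν∉T x))) (inT-scale-0 (invertible ν (nonT⇒≢0 ν∉T)))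

    degree≡2e : degree ≡ 2 ℕ.* e
    degree≡2e = ℕP.*-cancelˡ-≡ _ _ 2 (begin
      2 ℕ.* degree                                       ≡⟨ cong (degree ℕ.+_) (ℕP.+-identityʳ degree) ⟩
      degree ℕ.+ degree                                  ≡⟨ cong (degree ℕ.+_) ∑-nonT ⟨
      degree ℕ.+ (∑ E λ x → ind (nonT x))                ≡⟨ sum-+ _ _ elems ⟨
      (∑ E λ x → ind (inT F x) ℕ.+ ind (nonT x))         ≡⟨ sum-cong elems union ⟩
      (∑ E λ x → ind (nonzero x))                        ≡⟨ ∑-nonzero ⟩
      4 ℕ.* e                                            ≡⟨ double e ⟩
      2 ℕ.* (2 ℕ.* e)                                    ∎)
      where
      double : ∀ e → 4 ℕ.* e ≡ 2 ℕ.* (2 ℕ.* e)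
      double = solve-∀
      union : ∀ x → ind (inT F x) ℕ.+ ind (nonT x) ≡ ind (nonzero x)
      union x with x == 0# in eq | inT F x in h
      ... | true  | true  = contradiction (==-sound eq) (T⇒≢0 h)
      ... | true  | false = refl
      ... | false | true  = refl
      ... | false | false = refl

    -- Cyclotomic numbers of order two: they count the ways to write 1 as a sum of two elements, by
    -- the cosets of the summands. Three linear equations will give α = e - 1 and β = γ = e.
    α β γ : ℕ
    α = ∑ E λ c → ind (inT F c) ℕ.* ind (inT F (1# + - c))
    β = ∑ E λ c → ind (inT F c) ℕ.* ind (nonT (1# + - c))
    γ = ∑ E λ c → ind (nonT c) ℕ.* ind (nonT (1# + - c))

    r : Carrier → ℕ
    r z = ∑ E λ c → ind (inT F c) ℕ.* ind (inT F (z + - c))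

    scale-sub : ∀ z c → z + - (z * c) ≡ z * (1# + - c)
    scale-sub z c = solve 2 (λ z c → z :+ :- (z :* c) := z :* (con (1 , 0) :+ :- c)) refl z c

    ind-square : ∀ b → ind b ℕ.* ind b ≡ ind b
    ind-square true  = refl
    ind-square false = refl

    r-0 : r 0# ≡ degree
    r-0 = sum-cong elems λ c → trans
      (cong (λ b → ind (inT F c) ℕ.* ind b) (trans (cong (inT F) (+-identityˡ (- c))) (inT-neg c)))
      (ind-square (inT F c))

    -- Replacing c by z c turns a splitting of z into a splitting of 1 with both parts scaled by z.
    -- Hence z in T leads to α, while z outside T swaps the cosets and leads to γ.
    r-scaled : ∀ {z} → Unit z → r z ≡ ∑ E λ c → ind (inT F (z * c)) ℕ.* ind (inT F (z * (1# + - c)))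
    r-scaled {z} u = trans (sym (ℕ-sums.∑-scale u λ c → ind (inT F c) ℕ.* ind (inT F (z + - c))))
      (sum-cong elems λ c → cong (λ w → ind (inT F (z * c)) ℕ.* ind (inT F w)) (scale-sub z c))

    r-T : ∀ {z} → inT F z ≡ true → r z ≡ α
    r-T {z} h = trans (r-scaled (T⇒Unit (inT⁻ h)))
      (sum-cong elems λ c → cong₂ (λ a b → ind a ℕ.* ind b) (inT-scale (inT⁻ h) c) (inT-scale (inT⁻ h) (1# + - c)))

    r-nonT : ∀ {z} → nonT z ≡ true → r z ≡ γ
    r-nonT {z} h = trans (r-scaled (invertible z (nonT⇒≢0 h)))
      (sum-cong elems λ c → cong₂ (λ a b → ind a ℕ.* ind b) (inT-nonT h c) (inT-nonT h (1# + - c)))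

    r-value : ∀ z → r z ≡ ind (z == 0#) ℕ.* degree ℕ.+ (ind (inT F z) ℕ.* α ℕ.+ ind (nonT z) ℕ.* γ)
    r-value z with z == 0# in eq | inT F z in h
    ... | true  | true  = contradiction (==-sound eq) (T⇒≢0 h)
    ... | true  | false = trans (cong r (==-sound eq)) (trans r-0
            (sym (trans (ℕP.+-identityʳ _) (ℕP.*-identityˡ degree))))
    ... | false | true  = trans (r-T h) (sym (trans (ℕP.+-identityʳ _) (ℕP.*-identityˡ α)))
    ... | false | false = trans (r-nonT (∧-true (cong not eq) (cong not h))) (sym (ℕP.*-identityˡ γ))

    ∑-reflect : ∀ (g : Carrier → ℕ) → (∑ E λ c → g (1# + - c)) ≡ ∑ E g
    ∑-reflect g = trans (ℕ-sums.∑-neg λ c → g (1# + c)) (ℕ-sums.∑-translate 1# g)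

    ∑-r : (∑ E r) ≡ degree ℕ.* degree
    ∑-r = begin
      (∑ E λ z → ∑ E λ c → ind (inT F c) ℕ.* ind (inT F (z + - c)))
        ≡⟨ sum-swap _ elems elems ⟩
      (∑ E λ c → ∑ E λ z → ind (inT F c) ℕ.* ind (inT F (z + - c)))
        ≡⟨ sum-cong elems (λ c → trans (sum-*ˡ (ind (inT F c)) _ elems) (cong (ind (inT F c) ℕ.*_)
             (trans (sum-cong elems λ z → cong (λ w → ind (inT F w)) (+-comm z (- c)))
               (ℕ-sums.∑-translate (- c) λ z → ind (inT F z))))) ⟩
      (∑ E λ c → ind (inT F c) ℕ.* degree)
        ≡⟨ sum-*ʳ degree _ elems ⟩
      degree ℕ.* degree ∎

    ∑-r-value : (∑ E r) ≡ degree ℕ.+ (degree ℕ.* α ℕ.+ degree ℕ.* γ)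
    ∑-r-value = begin
      (∑ E r)
        ≡⟨ sum-cong elems r-value ⟩
      (∑ E λ z → ind (z == 0#) ℕ.* degree ℕ.+ (ind (inT F z) ℕ.* α ℕ.+ ind (nonT z) ℕ.* γ))
        ≡⟨ trans (sum-+ _ _ elems) (cong₂ ℕ._+_ (∑-δ E 0# λ _ → degree) (sum-+ _ _ elems)) ⟩
      degree ℕ.+ ((∑ E λ z → ind (inT F z) ℕ.* α) ℕ.+ (∑ E λ z → ind (nonT z) ℕ.* γ))
        ≡⟨ cong (degree ℕ.+_) (cong₂ ℕ._+_ (sum-*ʳ α _ elems)
             (trans (sum-*ʳ γ _ elems) (cong (ℕ._* γ) ∑-nonT))) ⟩
      degree ℕ.+ (degree ℕ.* α ℕ.+ degree ℕ.* γ) ∎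

    -- Count the pairs in T × T by their sum: 0 occurs |T| times, each element of T occurs α times,
    -- each remaining unit γ times. Then cancel |T|.
    1+α+γ≡2e : 1 ℕ.+ (α ℕ.+ γ) ≡ 2 ℕ.* e
    1+α+γ≡2e = cancel degree degree≢0 (begin
      degree ℕ.* (1 ℕ.+ (α ℕ.+ γ))                ≡⟨ expand degree α γ ⟩
      degree ℕ.+ (degree ℕ.* α ℕ.+ degree ℕ.* γ)  ≡⟨ ∑-r-value ⟨
      (∑ E r)                                     ≡⟨ ∑-r ⟩
      degree ℕ.* degree                           ≡⟨ cong (degree ℕ.*_) degree≡2e ⟩
      degree ℕ.* (2 ℕ.* e)                        ∎)
      where
      expand : ∀ d a c → d ℕ.* (1 ℕ.+ (a ℕ.+ c)) ≡ d ℕ.+ (d ℕ.* a ℕ.+ d ℕ.* c)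
      expand = solve-∀
      cancel : ∀ d → d ≢ 0 → ∀ {m n} → d ℕ.* m ≡ d ℕ.* n → m ≡ n
      cancel zero    p _  = contradiction refl p
      cancel (suc d) p eq = ℕP.*-cancelˡ-≡ _ _ (suc d) eq

    -- Sort the c in T by the kind of 1 - c; it vanishes only for c = 1, which gives the summand 1.
    1+α+β≡2e : 1 ℕ.+ (α ℕ.+ β) ≡ 2 ℕ.* e
    1+α+β≡2e = begin
      1 ℕ.+ (α ℕ.+ β)
        ≡⟨ cong₂ ℕ._+_ at-0 (sum-+ _ _ elems) ⟨
      (∑ E λ c → ind (inT F c) ℕ.* ind ((1# + - c) == 0#)) ℕ.+
      (∑ E λ c → ind (inT F c) ℕ.* ind (inT F (1# + - c)) ℕ.+ ind (inT F c) ℕ.* ind (nonT (1# + - c)))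
        ≡⟨ sum-+ _ _ elems ⟨
      (∑ E λ c → ind (inT F c) ℕ.* ind ((1# + - c) == 0#) ℕ.+
         (ind (inT F c) ℕ.* ind (inT F (1# + - c)) ℕ.+ ind (inT F c) ℕ.* ind (nonT (1# + - c))))
        ≡⟨ sum-cong elems (λ c → trans (collect (ind (inT F c)) _ _ _)
             (trans (cong (ind (inT F c) ℕ.*_) (trichotomy (1# + - c))) (ℕP.*-identityʳ _))) ⟩
      degree   ≡⟨ degree≡2e ⟩
      2 ℕ.* e  ∎
      where
      collect : ∀ i a b c → i ℕ.* a ℕ.+ (i ℕ.* b ℕ.+ i ℕ.* c) ≡ i ℕ.* (a ℕ.+ (b ℕ.+ c))
      collect = solve-∀
      at-0 : (∑ E λ c → ind (inT F c) ℕ.* ind ((1# + - c) == 0#)) ≡ 1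
      at-0 = begin
        (∑ E λ c → ind (inT F c) ℕ.* ind ((1# + - c) == 0#))
          ≡⟨ sum-cong elems (λ c → trans (ℕP.*-comm (ind (inT F c)) _) (cong (λ b → ind b ℕ.* ind (inT F c)) (Bool-ext
               (λ p → ==-complete (difference-0 (==-sound p)))
               (λ p → ==-complete (trans (cong (_+ - c) (==-sound p)) (-‿inverseʳ c)))))) ⟩
        (∑ E λ c → ind (1# == c) ℕ.* ind (inT F c))  ≡⟨ ∑-δ′ E 1# (λ c → ind (inT F c)) ⟩
        ind (inT F 1#)                               ≡⟨ cong ind (inT⁺ T-1) ⟩
        1                                            ∎

    -- Sort the c with 1 - c a unit outside T by the kind of c. The value c = 0 does not occur,
    -- since 1 is in T.
    β+γ≡2e : β ℕ.+ γ ≡ 2 ℕ.* e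
    β+γ≡2e = begin
      0 ℕ.+ (β ℕ.+ γ)
        ≡⟨ cong₂ ℕ._+_ at-0 (sum-+ _ _ elems) ⟨
      (∑ E λ c → ind (c == 0#) ℕ.* ind (nonT (1# + - c))) ℕ.+
      (∑ E λ c → ind (inT F c) ℕ.* ind (nonT (1# + - c)) ℕ.+ ind (nonT c) ℕ.* ind (nonT (1# + - c)))
        ≡⟨ sum-+ _ _ elems ⟨
      (∑ E λ c → ind (c == 0#) ℕ.* ind (nonT (1# + - c)) ℕ.+
         (ind (inT F c) ℕ.* ind (nonT (1# + - c)) ℕ.+ ind (nonT c) ℕ.* ind (nonT (1# + - c))))
        ≡⟨ sum-cong elems (λ c → trans (collect (ind (nonT (1# + - c))) (ind (c == 0#)) (ind (inT F c)) (ind (nonT c)))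
             (trans (cong (ℕ._* ind (nonT (1# + - c))) (trichotomy c)) (ℕP.*-identityˡ _))) ⟩
      (∑ E λ c → ind (nonT (1# + - c)))  ≡⟨ ∑-reflect (ind ∘ nonT) ⟩
      (∑ E λ c → ind (nonT c))           ≡⟨ ∑-nonT ⟩
      degree                             ≡⟨ degree≡2e ⟩
      2 ℕ.* e                            ∎
      where
      collect : ∀ i a b c → a ℕ.* i ℕ.+ (b ℕ.* i ℕ.+ c ℕ.* i) ≡ (a ℕ.+ (b ℕ.+ c)) ℕ.* i
      collect = solve-∀
      1-0 : 1# + - 0# ≡ 1#
      1-0 = solve 1 (λ x → x :+ :- con (0 , 0) := x) refl 1#
      at-0 : (∑ E λ c → ind (c == 0#) ℕ.* ind (nonT (1# + - c))) ≡ 0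
      at-0 = trans (∑-δ E 0# λ c → ind (nonT (1# + - c)))
        (cong ind (≢true λ h → nonT⇒¬T h (subst T (sym 1-0) T-1)))

    β≡γ : β ≡ γ
    β≡γ = ℕP.+-cancelˡ-≡ α _ _ (ℕP.suc-injective (trans 1+α+β≡2e (sym 1+α+γ≡2e)))

    γ≡e : γ ≡ e
    γ≡e = ℕP.*-cancelˡ-≡ _ _ 2 (trans (cong (γ ℕ.+_) (ℕP.+-identityʳ γ)) (trans (cong (ℕ._+ γ) (sym β≡γ)) β+γ≡2e))

    α+1≡e : α ℕ.+ 1 ≡ e
    α+1≡e = ℕP.+-cancelʳ-≡ e _ _ (begin
      (α ℕ.+ 1) ℕ.+ e   ≡⟨ arrange α e ⟩
      1 ℕ.+ (α ℕ.+ e)   ≡⟨ cong (λ g → 1 ℕ.+ (α ℕ.+ g)) γ≡e ⟨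
      1 ℕ.+ (α ℕ.+ γ)   ≡⟨ 1+α+γ≡2e ⟩
      2 ℕ.* e           ≡⟨ cong (e ℕ.+_) (ℕP.+-identityʳ e) ⟩
      e ℕ.+ e           ∎)
      where
      arrange : ∀ a e → (a ℕ.+ 1) ℕ.+ e ≡ 1 ℕ.+ (a ℕ.+ e)
      arrange = solve-∀

    -- The left side is 2 e at 0, α + 1 = e on T and γ = e elsewhere: these are the entries of A² +
    -- A = e (I + J).
    r-mod : ∀ z → ∃ λ k → r z ℕ.+ ind (inT F z) ≡ e ℕ.* k
    r-mod z with z ≟ 0# | true-or (inT F z)
    ... | yes p | _ = 2 , (begin
      r z ℕ.+ ind (inT F z)    ≡⟨ cong (λ z → r z ℕ.+ ind (inT F z)) p ⟩
      r 0# ℕ.+ ind (inT F 0#)  ≡⟨ cong₂ ℕ._+_ (trans r-0 degree≡2e) (cong ind inT-0) ⟩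
      2 ℕ.* e ℕ.+ 0            ≡⟨ trans (ℕP.+-identityʳ _) (ℕP.*-comm 2 e) ⟩
      e ℕ.* 2                  ∎)
    ... | no _ | inj₁ h = 1 , trans (cong₂ ℕ._+_ (r-T h) (cong ind h)) (trans α+1≡e (sym (ℕP.*-identityʳ e)))
    ... | no p | inj₂ h = 1 , trans
      (cong₂ ℕ._+_ (r-nonT (∧-true (not-true⁻ (p ∘ ==-sound)) (not-true⁻ h))) (cong ind (≢true h)))
      (trans (ℕP.+-identityʳ γ) (trans γ≡e (sym (ℕP.*-identityʳ e))))

    congruence : SquareCongruence F e
    congruence = record
      { half = e
      ; degree≡half = degree≡2e
      ; square = λ x y → let k , eq = r-mod (y + - x) in k , trans (cong (ℕ._+ ind (inT F (y + - x))) (shift x y)) eq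
      ; half≡1⇒e≡1 = λ p → p
      }
      where
      shift : ∀ x y → (∑ E λ z → ind (inT F (z + - x)) ℕ.* ind (inT F (y + - z))) ≡ r (y + - x)
      shift x y = trans (sym (ℕ-sums.∑-translate x λ z → ind (inT F (z + - x)) ℕ.* ind (inT F (y + - z))))
        (sum-cong elems λ c → cong₂ (λ a b → ind (inT F a) ℕ.* ind (inT F b))
          (solve 2 (λ x c → (x :+ c) :+ :- x := c) refl x c)
          (solve 3 (λ x y c → y :+ :- (x :+ c) := (y :+ :- x) :+ :- c) refl x y c))

  -- The split is on whether T exhausts the units, so it is never decided whether - 1 is a square.
  congruence : SquareCongruence F e
  congruence with search nonT
  ... | inj₁ (ν , h) = HalfUnits.congruence ν h
  ... | inj₂ none    = AllUnits.congruence λ x x≢0 → all x x≢0 (true-or (inT F x))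
    where
    all : ∀ x → nonzero x ≡ true → inT F x ≡ true ⊎ inT F x ≢ true → inT F x ≡ true
    all x x≢0 (inj₁ h) = h
    all x x≢0 (inj₂ h) = contradiction (∧-true x≢0 (not-true⁻ h)) (false≢true (none x))

-- The field with five elements

pattern 0₅ = zero
pattern 1₅ = suc zero
pattern 2₅ = suc (suc zero)
pattern 3₅ = suc (suc (suc zero))
pattern 4₅ = suc (suc (suc (suc zero)))

ℤ₅ : Enumeration (Fin 5)
ℤ₅ = record { _≟_ = FinP._≟_ ; elems = allFin 5 ; complete = ∈-allFin ; unique = allFin⁺ 5 }

neg₅ : Fin 5 → Fin 5
neg₅ a = (5 ℕ.∸ toℕ a) mod 5

opaque
  -- These tables are verified by exhaustion over `Fin 5`; opacity keeps the decision procedures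
  -- from unfolding in later conversion checks.
  +₅-neg : ∀ a → a +₅ neg₅ a ≡ 0₅
  +₅-neg = from-yes (FinP.all? λ a → a +₅ neg₅ a FinP.≟ 0₅)

  +₅-neg-0 : ∀ a b → a +₅ neg₅ b ≡ 0₅ → a ≡ b
  +₅-neg-0 = from-yes (FinP.all? λ a → FinP.all? λ b → (a +₅ neg₅ b FinP.≟ 0₅) →-dec (a FinP.≟ b))

  +₅-neg-cancel : ∀ a b → (b +₅ a) +₅ neg₅ b ≡ a
  +₅-neg-cancel = from-yes (FinP.all? λ a → FinP.all? λ b → (b +₅ a) +₅ neg₅ b FinP.≟ a)

  +₅-neg-cancel′ : ∀ a b → b +₅ (a +₅ neg₅ b) ≡ a
  +₅-neg-cancel′ = from-yes (FinP.all? λ a → FinP.all? λ b → b +₅ (a +₅ neg₅ b) FinP.≟ a)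

  +₅-idem : ∀ a → a +₅ a ≡ a → a ≡ 0₅
  +₅-idem = from-yes (FinP.all? λ a → (a +₅ a FinP.≟ a) →-dec (a FinP.≟ 0₅))

  -- Fermat's little theorem for 5; it provides a³ as an inverse of a.
  cube-inverse : ∀ a → a ≢ 0₅ → ((a *₅ a) *₅ a) *₅ a ≡ 1₅
  cube-inverse = from-yes (FinP.all? λ a → ¬? (a FinP.≟ 0₅) →-dec (((a *₅ a) *₅ a) *₅ a FinP.≟ 1₅))

  square-±1 : ∀ a → a ≢ 0₅ → a *₅ a ≡ 1₅ ⊎ a *₅ a ≡ 4₅
  square-±1 = from-yes (FinP.all? λ a → ¬? (a FinP.≟ 0₅) →-dec ((a *₅ a FinP.≟ 1₅) ⊎-dec (a *₅ a FinP.≟ 4₅)))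

  opposite-±1 : ∀ a b → a +₅ b ≡ 0₅ → b ≡ 1₅ ⊎ b ≡ 4₅ → a ≡ 1₅ ⊎ a ≡ 4₅
  opposite-±1 = from-yes (FinP.all? λ a → FinP.all? λ b → (a +₅ b FinP.≟ 0₅) →-dec
    (((b FinP.≟ 1₅) ⊎-dec (b FinP.≟ 4₅)) →-dec ((a FinP.≟ 1₅) ⊎-dec (a FinP.≟ 4₅))))

-- `Fin 5` is used with its bare operations and not as a `FinCommRing`, so the images of 0, of
-- negatives and of units are derived from the tables.
record ℤ₅-Hom (R : FinCommRing) (ρ : FinCommRing.Carrier R → Fin 5) : Set where
  open QuadraticUnits R
  field
    +-hom : ∀ x y → ρ (x + y) ≡ ρ x +₅ ρ y
    *-hom : ∀ x y → ρ (x * y) ≡ ρ x *₅ ρ y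
    1-hom : ρ 1# ≡ 1₅

  0-hom : ρ 0# ≡ 0₅
  0-hom = +₅-idem _ (trans (sym (+-hom 0# 0#)) (cong ρ (+-identityˡ 0#)))

  neg-hom : ∀ x → ρ (- x) +₅ ρ x ≡ 0₅
  neg-hom x = trans (sym (+-hom (- x) x)) (trans (cong ρ (-‿inverseˡ x)) 0-hom)

  unit-hom : ∀ {x} → Unit x → ρ x ≢ 0₅
  unit-hom {x} (y , p) q = contradiction
    (trans (sym 1-hom) (trans (cong ρ (sym p)) (trans (*-hom x y) (cong (_*₅ ρ y) q)))) λ ()

  T-hom : ∀ {x} → T x → ρ x ≡ 1₅ ⊎ ρ x ≡ 4₅
  T-hom (w , u , inj₁ refl) = subst (λ z → z ≡ 1₅ ⊎ z ≡ 4₅) (sym (*-hom w w)) (square-±1 (ρ w) (unit-hom u))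
  T-hom (w , u , inj₂ refl) = opposite-±1 (ρ (- (w * w))) (ρ (w * w)) (neg-hom (w * w)) (T-hom (T-square u))

module FiveElements (F : FinCommRing) (size≡5 : size (enumeration F) ≡ 5) where
  open QuadraticUnits F
  open Algebra.Properties.Semiring.Mult (CommutativeRing.semiring (commutativeRing F))
    using (×-homo-+; ×1-homo-*) renaming (_×_ to _·_)
  open ≡-Reasoning

  private
    module ∑F = Summation isCommutativeSemiring
    module F-sums = Sums isCommutativeSemiring

  sum-1 : ∀ (xs : List Carrier) → ∑F.sum (λ _ → 1#) xs ≡ (∑ℕ.sum (λ _ → 1) xs) · 1#
  sum-1 []       = refl
  sum-1 (x ∷ xs) = cong (1# +_) (sum-1 xs)

  -- The sum of all elements is invariant under the translation by 1.
  5·1≡0 : 5 · 1# ≡ 0#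
  5·1≡0 = begin
    5 · 1#           ≡⟨ cong (_· 1#) size≡5 ⟨
    size E · 1#      ≡⟨ sum-1 elems ⟨
    N                ≡⟨ solve 2 (λ n s → n := (n :+ s) :+ :- s) refl N Σx ⟩
    (N + Σx) + - Σx  ≡⟨ cong (_+ - Σx) (trans (sym (∑F.sum-+ (λ _ → 1#) (λ x → x) elems)) (F-sums.∑-translate 1# (λ x → x))) ⟩
    Σx + - Σx        ≡⟨ -‿inverseʳ Σx ⟩
    0#               ∎
    where
    N Σx : Carrier
    N  = ∑F.∑ E λ _ → 1#
    Σx = ∑F.∑ E λ x → x

  embed : Fin 5 → Carrier
  embed a = toℕ a · 1#

  -- The multiple of 5 removed by reduction is killed by `5·1≡0`.
  embed-mod : ∀ n → embed (n mod 5) ≡ n · 1#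
  embed-mod n = begin
    toℕ (n mod 5) · 1#                  ≡⟨ cong (_· 1#) (FinP.toℕ-fromℕ< (m%n<n n 5)) ⟩
    (n % 5) · 1#                        ≡⟨ +-identityʳ _ ⟨
    (n % 5) · 1# + 0#                   ≡⟨ cong ((n % 5) · 1# +_) (trans (cong ((n / 5) · 1# *_) 5·1≡0) (zeroʳ _)) ⟨
    (n % 5) · 1# + (n / 5) · 1# * 5 · 1#  ≡⟨ cong ((n % 5) · 1# +_) (×1-homo-* (n / 5) 5) ⟨
    (n % 5) · 1# + (n / 5 ℕ.* 5) · 1#   ≡⟨ ×-homo-+ 1# (n % 5) (n / 5 ℕ.* 5) ⟨
    (n % 5 ℕ.+ n / 5 ℕ.* 5) · 1#        ≡⟨ cong (_· 1#) (m≡m%n+[m/n]*n n 5) ⟨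
    n · 1#                              ∎

  embed-+ : ∀ a b → embed (a +₅ b) ≡ embed a + embed b
  embed-+ a b = trans (embed-mod (toℕ a ℕ.+ toℕ b)) (×-homo-+ 1# (toℕ a) (toℕ b))

  embed-* : ∀ a b → embed (a *₅ b) ≡ embed a * embed b
  embed-* a b = trans (embed-mod (toℕ a ℕ.* toℕ b)) (×1-homo-* (toℕ a) (toℕ b))

  embed-1 : embed 1₅ ≡ 1#
  embed-1 = +-identityʳ 1#

  -- A nonzero residue has an inverse, so a vanishing image would give 1 = 0.
  embed-≢0 : ∀ a → a ≢ 0₅ → embed a ≢ 0#
  embed-≢0 a a≢0 p = nontrivial (begin
    1#                                    ≡⟨ embed-1 ⟨
    embed 1₅                              ≡⟨ cong embed (cube-inverse a a≢0) ⟨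
    embed (((a *₅ a) *₅ a) *₅ a)          ≡⟨ embed-* ((a *₅ a) *₅ a) a ⟩
    embed ((a *₅ a) *₅ a) * embed a       ≡⟨ cong (embed ((a *₅ a) *₅ a) *_) p ⟩
    embed ((a *₅ a) *₅ a) * 0#            ≡⟨ zeroʳ _ ⟩
    0#                                    ∎)

  embed-injective : ∀ {a b} → embed a ≡ embed b → a ≡ b
  embed-injective {a} {b} p with a +₅ neg₅ b FinP.≟ 0₅
  ... | yes q = +₅-neg-0 a b q
  ... | no q  = contradiction (begin
    embed (a +₅ neg₅ b)       ≡⟨ embed-+ a (neg₅ b) ⟩
    embed a + embed (neg₅ b)  ≡⟨ cong (_+ embed (neg₅ b)) p ⟩
    embed b + embed (neg₅ b)  ≡⟨ embed-+ b (neg₅ b) ⟨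
    embed (b +₅ neg₅ b)       ≡⟨ cong embed (+₅-neg b) ⟩
    0#                        ∎) (embed-≢0 _ q)

  -- The inverse of `embed`: an injection between two sets of five elements is onto.
  index : Carrier → Fin 5
  index y = proj₁ (injective⇒surjective ℤ₅ E (sym size≡5) embed embed-injective y)

  embed-index : ∀ y → embed (index y) ≡ y
  embed-index y = proj₂ (injective⇒surjective ℤ₅ E (sym size≡5) embed embed-injective y)

  index-embed : ∀ a → index (embed a) ≡ a
  index-embed a = embed-injective (embed-index (embed a))

  index-hom : ℤ₅-Hom F index
  index-hom = record
    { +-hom = λ x y → embed-injective (trans (embed-index (x + y))
        (sym (trans (embed-+ (index x) (index y)) (cong₂ _+_ (embed-index x) (embed-index y)))))
    ; *-hom = λ x y → embed-injective (trans (embed-index (x * y))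
        (sym (trans (embed-* (index x) (index y)) (cong₂ _*_ (embed-index x) (embed-index y)))))
    ; 1-hom = embed-injective (trans (embed-index 1#) (sym embed-1))
    }

module ResidueField (R : FinCommRing) (M : Subset R) (local : IsLocalWith R M) where
  open Ideals R using (M-1; ∉M⇒Unit)
  open Quotient R M (IsMaximalIdeal.ideal (IsLocalWith.max local)) (M-1 local) public
  private
    module R = QuadraticUnits R
    module F = QuadraticUnits classRing

  class-Unit : ∀ {x} → R.Unit x → F.Unit (class x)
  class-Unit {x} (y , p) = class y , trans (sym (class-* x y)) (cong class p)

  lift-Unit : ∀ {a} → a ≢ F.0# → R.Unit (lift a)
  lift-Unit {a} a≢0 = ∉M⇒Unit local (≢true λ h → a≢0 (trans (sym (class-lift a)) (I⇒class-0 h)))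

  invertible : ∀ a → a ≢ F.0# → F.Unit a
  invertible a a≢0 = subst F.Unit (class-lift a) (class-Unit (lift-Unit a≢0))

  residueIso : size F.E ≡ 5 → ResidueIsoZ5 R M
  residueIso size≡5 = record
    { φ = index ∘ class
    ; +-hom = λ x y → trans (cong index (class-+ x y)) (ℤ₅-Hom.+-hom index-hom (class x) (class y))
    ; *-hom = λ x y → trans (cong index (class-* x y)) (ℤ₅-Hom.*-hom index-hom (class x) (class y))
    ; 1-hom = ℤ₅-Hom.1-hom index-hom
    ; surj = λ a → lift (embed a) , trans (cong index (class-lift (embed a))) (index-embed a)
    ; kernel = λ x p → class-0⇒I (trans (sym (embed-index (class x))) (cong embed p))
    ; kernel⁻ = λ x h → trans (cong index (I⇒class-0 h)) (index-embed 0₅)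
    }
    where open FiveElements classRing size≡5

-- Distribution of T over a quotient

module Fibres (R : FinCommRing) {S : Set} (ES : Enumeration S) (π : FinCommRing.Carrier R → S) where
  open QuadraticUnits R
  open Enumeration ES using () renaming (_==_ to _==ˢ_)
  private module S = Enumeration ES
  open ∑ℕ
  open ≡-Reasoning

  fibreSize : S → ℕ
  fibreSize y = ∑ E λ t → ind (inT R t) ℕ.* ind (π t ==ˢ y)

  -- Multiplication by s permutes T and carries the part over y′ onto the part over y.
  fibreSize-scale : ∀ {s y y′} → T s → (∀ {t} → T t → (π (s * t) ==ˢ y) ≡ (π t ==ˢ y′)) → fibreSize y ≡ fibreSize y′
  fibreSize-scale {s} {y} {y′} Ts same = trans
    (sym (ℕ-sums.∑-scale (T⇒Unit Ts) λ t → ind (inT R t) ℕ.* ind (π t ==ˢ y)))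
    (sum-cong elems λ t → trans (cong (λ b → ind b ℕ.* ind (π (s * t) ==ˢ y)) (inT-scale Ts t)) (on-T t))
    where
    on-T : ∀ t → ind (inT R t) ℕ.* ind (π (s * t) ==ˢ y) ≡ ind (inT R t) ℕ.* ind (π t ==ˢ y′)
    on-T t with true-or (inT R t)
    ... | inj₁ h = cong (λ b → ind (inT R t) ℕ.* ind b) (same (inT⁻ h))
    ... | inj₂ h = trans (cong (λ b → ind b ℕ.* ind (π (s * t) ==ˢ y)) (≢true h))
                         (sym (cong (λ b → ind b ℕ.* ind (π t ==ˢ y′)) (≢true h)))

  fibreSize-empty : ∀ {y} → (∀ {t} → T t → π t ≢ y) → fibreSize y ≡ 0
  fibreSize-empty {y} none = trans (sum-cong elems pointwise) (sum-0 elems)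
    where
    pointwise : ∀ t → ind (inT R t) ℕ.* ind (π t ==ˢ y) ≡ 0
    pointwise t with true-or (inT R t)
    ... | inj₁ h = trans (cong (λ b → ind (inT R t) ℕ.* ind b) (S.≠-false (none (inT⁻ h)))) (ℕP.*-zeroʳ (ind (inT R t)))
    ... | inj₂ h = cong (λ b → ind b ℕ.* ind (π t ==ˢ y)) (≢true h)

  degree-fibres : degree ≡ ∑ ES fibreSize
  degree-fibres = begin
    degree                                  ≡⟨ sum-cong elems (λ t → sym (ℕP.*-identityʳ _)) ⟩
    (∑ E λ t → ind (inT R t) ℕ.* 1)         ≡⟨ ∑-fibre E ES π (λ t → ind (inT R t)) (λ _ → 1) ⟩
    (∑ ES λ y → fibreSize y ℕ.* 1)          ≡⟨ sum-cong S.elems (λ y → ℕP.*-identityʳ _) ⟩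
    ∑ ES fibreSize                          ∎

module FieldQuotient (R F : FinCommRing) (π : FinCommRing.Carrier R → FinCommRing.Carrier F)
  (hom : IsRingHom R F π)
  (liftUnit : ∀ {c} → QuadraticUnits.Unit F c → ∃ λ s → QuadraticUnits.Unit R s × π s ≡ c) where
  private
    module R = QuadraticUnits R
    module F = QuadraticUnits F
  open IsRingHom hom
  open Algebra.Properties.Ring (CommutativeRing.ring (commutativeRing F)) using (x+x≈x⇒x≈0)
  open Fibres R F.E π
  open ∑ℕ
  open ≡-Reasoning

  π-0 : π R.0# ≡ F.0#
  π-0 = x+x≈x⇒x≈0 (π R.0#) (trans (sym (+-hom R.0# R.0#)) (cong π (R.+-identityˡ R.0#)))

  π-neg : ∀ x → π (R.- x) ≡ F.- π x
  π-neg x = begin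
    π (R.- x)                          ≡⟨ F.solve 2 (λ x y → y F.:= (y F.:+ x) F.:+ F.:- x) refl (π x) (π (R.- x)) ⟩
    (π (R.- x) F.+ π x) F.+ F.- π x    ≡⟨ cong (F._+ F.- π x) (trans (sym (+-hom (R.- x) x)) (trans (cong π (R.-‿inverseˡ x)) π-0)) ⟩
    F.0# F.+ F.- π x                   ≡⟨ F.+-identityˡ (F.- π x) ⟩
    F.- π x                            ∎

  π-Unit : ∀ {x} → R.Unit x → F.Unit (π x)
  π-Unit {x} (y , p) = π y , trans (sym (*-hom x y)) (trans (cong π p) 1-hom)

  π-T : ∀ {t} → R.T t → F.T (π t)
  π-T (w , u , inj₁ refl) = π w , π-Unit u , inj₁ (*-hom w w)
  π-T (w , u , inj₂ refl) = π w , π-Unit u , inj₂ (trans (π-neg (w R.* w)) (cong F.-_ (*-hom w w)))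

  liftT : ∀ {c} → F.T c → ∃ λ s → R.T s × π s ≡ c
  liftT (w , u , inj₁ refl) = let (s , v , p) = liftUnit u in
    s R.* s , R.T-square v , trans (*-hom s s) (cong₂ F._*_ p p)
  liftT (w , u , inj₂ refl) = let (s , v , p) = liftUnit u in
    R.- (s R.* s) , R.T-neg (R.T-square v) , trans (π-neg (s R.* s)) (cong F.-_ (trans (*-hom s s) (cong₂ F._*_ p p)))

  K : ℕ
  K = fibreSize F.1#

  -- Elements of T map into T of the field, so the other fibres are empty. A y in T lifts to some s
  -- in T, and multiplication by s moves the fibre over 1 to the fibre over y.
  fibreSize-T : ∀ y → fibreSize y ≡ K ℕ.* ind (inT F y)
  fibreSize-T y with true-or (inT F y)
  ... | inj₂ h = trans (fibreSize-empty λ t p → h (F.inT⁺ (subst F.T p (π-T t))))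
                       (sym (trans (cong (λ b → K ℕ.* ind b) (≢true h)) (ℕP.*-zeroʳ K)))
  ... | inj₁ h with liftT (F.inT⁻ h)
  ...   | s , Ts , πs≡y = trans (fibreSize-scale Ts λ {t} _ → Bool-ext
          (λ p → F.==-complete (F.Unit-cancel (F.T⇒Unit (F.inT⁻ h)) (trans (cong (F._* π t) (sym πs≡y))
            (trans (sym (*-hom s t)) (trans (F.==-sound p) (sym (F.*-identityʳ y)))))))
          (λ p → F.==-complete (trans (*-hom s t) (trans (cong₂ F._*_ πs≡y (F.==-sound p)) (F.*-identityʳ y)))))
        (sym (trans (cong (λ b → K ℕ.* ind b) h) (ℕP.*-identityʳ K)))

  fibre : ∀ u y → (∑ R.E λ t → ind (inT R t) ℕ.* ind (π (u R.+ t) F.== y)) ≡ K ℕ.* ind (inT F (y F.+ F.- π u))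
  fibre u y = trans (sum-cong R.elems λ t → cong (λ b → ind (inT R t) ℕ.* ind b) (Bool-ext
      (λ p → F.==-complete (trans (F.solve 2 (λ u t → t F.:= (u F.:+ t) F.:+ F.:- u) refl (π u) (π t))
        (cong (F._+ F.- π u) (trans (sym (+-hom u t)) (F.==-sound p)))))
      (λ p → F.==-complete (trans (+-hom u t) (trans (cong (π u F.+_) (F.==-sound p))
        (F.solve 2 (λ u y → u F.:+ (y F.:+ F.:- u) F.:= y) refl (π u) y))))))
    (fibreSize-T (y F.+ F.- π u))

  degree-quotient : R.degree ≡ K ℕ.* F.degree
  degree-quotient = trans degree-fibres (trans (sum-cong F.elems fibreSize-T) (sum-*ˡ K (λ y → ind (inT F y)) F.elems))

  periodic⇒e≡1 : ∀ {e} → SquareCongruence F e → PeriodicQUCG R → e ≡ 1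
  periodic⇒e≡1 {e} congruence periodic = half≡1⇒e≡1
    (PeriodicQuotient.periodic⇒f≡1 R F.E π (λ x y → inT F (y F.+ F.- x)) half K
      -- The vertex 0 and the target 1 + π 0 differ by 1 in the field, which lies in T; this is the
      -- entry 1 of A.
      degree-eq fibre square R.0# (F.1# F.+ π R.0#)
      (trans (cong (inT F) (F.solve 2 (λ o u → (o F.:+ u) F.:+ F.:- u F.:= o) refl F.1# (π R.0#))) (F.inT⁺ F.T-1))
      periodic)
    where
    open SquareCongruence congruence
    arrange : ∀ k h → k ℕ.* (2 ℕ.* h) ≡ 2 ℕ.* (h ℕ.* k)
    arrange = solve-∀
    degree-eq : R.degree ≡ 2 ℕ.* (half ℕ.* K)
    degree-eq = trans degree-quotient (trans (cong (K ℕ.*_) degree≡half) (arrange K half))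

module TwoResidues (R : FinCommRing) (ρ σ : FinCommRing.Carrier R → Fin 5) (ρ-hom : ℤ₅-Hom R ρ) (σ-hom : ℤ₅-Hom R σ)
  (liftUnits : ∀ a b → a ≢ 0₅ → b ≢ 0₅ → ∃ λ s → QuadraticUnits.Unit R s × ρ s ≡ a × σ s ≡ b) where
  private
    module R = QuadraticUnits R
    module ρ = ℤ₅-Hom ρ-hom
    module σ = ℤ₅-Hom σ-hom
    module Z = Enumeration ℤ₅
  open ∑ℕ
  open ≡-Reasoning

  -- On the residue ring ℤ₅ × ℤ₅ the set T is {±1} × {±1}, which a + 2 b maps bijectively onto ℤ₅ ∖ {0}.
  combine : Fin 5 → Fin 5 → Fin 5
  combine a b = a +₅ (2₅ *₅ b)

  π : FinCommRing.Carrier R → Fin 5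
  π x = combine (ρ x) (σ x)

  opaque
    combine-+ : ∀ a b c d → combine (a +₅ c) (b +₅ d) ≡ combine a b +₅ combine c d
    combine-+ = from-yes (FinP.all? λ a → FinP.all? λ b → FinP.all? λ c → FinP.all? λ d →
      combine (a +₅ c) (b +₅ d) FinP.≟ combine a b +₅ combine c d)

  π-+ : ∀ x y → π (x R.+ y) ≡ π x +₅ π y
  π-+ x y = trans (cong₂ combine (ρ.+-hom x y) (σ.+-hom x y)) (combine-+ (ρ x) (σ x) (ρ y) (σ y))

  open Fibres R ℤ₅ π

  -- Both residues are ± 1, and ± 1 ± 2 is never 0 modulo 5.
  π-T≢0 : ∀ {t} → R.T t → π t ≢ 0₅
  π-T≢0 {t} Tt p = table (ρ t) (σ t) (ρ.T-hom Tt) (σ.T-hom Tt) p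
    where
    table : ∀ a b → a ≡ 1₅ ⊎ a ≡ 4₅ → b ≡ 1₅ ⊎ b ≡ 4₅ → combine a b ≢ 0₅
    table _ _ (inj₁ refl) (inj₁ refl) ()
    table _ _ (inj₁ refl) (inj₂ refl) ()
    table _ _ (inj₂ refl) (inj₁ refl) ()
    table _ _ (inj₂ refl) (inj₂ refl) ()

  -- The reference fibre is the one of 1, whose image is 3 = 1 + 2 · 1.
  K : ℕ
  K = fibreSize 3₅

  -- The square of a unit with residues (a , b) lies in T and acts on residues as (a² , b²). Such
  -- squares realise all four pairs of signs, so they reach every nonempty fibre from the reference
  -- fibre; `table` checks the effect on residues ± 1.
  signs : ∀ a b → a ≢ 0₅ → b ≢ 0₅ →
          (∀ p q → p ≡ 1₅ ⊎ p ≡ 4₅ → q ≡ 1₅ ⊎ q ≡ 4₅ →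
            (combine ((a *₅ a) *₅ p) ((b *₅ b) *₅ q) Z.== combine (a *₅ a) (b *₅ b)) ≡ (combine p q Z.== 3₅)) →
          fibreSize (combine (a *₅ a) (b *₅ b)) ≡ K
  signs a b a≢0 b≢0 table with liftUnits a b a≢0 b≢0
  ... | s , u , ρs , σs = fibreSize-scale (R.T-square u) λ {t} Tt → trans
    (cong (Z._== combine (a *₅ a) (b *₅ b)) (cong₂ combine
      (trans (ρ.*-hom (s R.* s) t) (cong (_*₅ ρ t) (trans (ρ.*-hom s s) (cong₂ _*₅_ ρs ρs))))
      (trans (σ.*-hom (s R.* s) t) (cong (_*₅ σ t) (trans (σ.*-hom s s) (cong₂ _*₅_ σs σs))))))
    (table (ρ t) (σ t) (ρ.T-hom Tt) (σ.T-hom Tt))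

  fibreSize-nonzero : ∀ y → fibreSize y ≡ K ℕ.* ind (not (0₅ Z.== y))
  fibreSize-nonzero 0₅ = trans (fibreSize-empty π-T≢0) (sym (ℕP.*-zeroʳ K))
  fibreSize-nonzero 3₅ = sym (ℕP.*-identityʳ K)
  -- Here - 1 = 2², and 4 = 1 + 2 · (- 1), 1 = - 1 + 2 · 1, 2 = - 1 + 2 · (- 1).
  fibreSize-nonzero 4₅ = trans (signs 1₅ 2₅ (λ ()) (λ ()) λ where
    _ _ (inj₁ refl) (inj₁ refl) → refl
    _ _ (inj₁ refl) (inj₂ refl) → refl
    _ _ (inj₂ refl) (inj₁ refl) → refl
    _ _ (inj₂ refl) (inj₂ refl) → refl) (sym (ℕP.*-identityʳ K))
  fibreSize-nonzero 1₅ = trans (signs 2₅ 1₅ (λ ()) (λ ()) λ where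
    _ _ (inj₁ refl) (inj₁ refl) → refl
    _ _ (inj₁ refl) (inj₂ refl) → refl
    _ _ (inj₂ refl) (inj₁ refl) → refl
    _ _ (inj₂ refl) (inj₂ refl) → refl) (sym (ℕP.*-identityʳ K))
  fibreSize-nonzero 2₅ = trans (signs 2₅ 2₅ (λ ()) (λ ()) λ where
    _ _ (inj₁ refl) (inj₁ refl) → refl
    _ _ (inj₁ refl) (inj₂ refl) → refl
    _ _ (inj₂ refl) (inj₁ refl) → refl
    _ _ (inj₂ refl) (inj₂ refl) → refl) (sym (ℕP.*-identityʳ K))

  fibre : ∀ u y → (∑ R.E λ t → ind (inT R t) ℕ.* ind (π (u R.+ t) Z.== y)) ≡ K ℕ.* ind (not (π u Z.== y))
  fibre u y = begin
    (∑ R.E λ t → ind (inT R t) ℕ.* ind (π (u R.+ t) Z.== y))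
      ≡⟨ sum-cong R.elems (λ t → cong (λ b → ind (inT R t) ℕ.* ind b) (Bool-ext
           (λ p → Z.==-complete (trans (sym (+₅-neg-cancel (π t) (π u)))
             (cong (_+₅ neg₅ (π u)) (trans (sym (π-+ u t)) (Z.==-sound p)))))
           (λ p → Z.==-complete (trans (π-+ u t) (trans (cong (π u +₅_) (Z.==-sound p)) (+₅-neg-cancel′ y (π u))))))) ⟩
    fibreSize (y +₅ neg₅ (π u))
      ≡⟨ fibreSize-nonzero (y +₅ neg₅ (π u)) ⟩
    K ℕ.* ind (not (0₅ Z.== (y +₅ neg₅ (π u))))
      ≡⟨ cong (λ b → K ℕ.* ind (not b)) (Bool-ext
           (λ p → Z.==-complete (sym (+₅-neg-0 y (π u) (sym (Z.==-sound p)))))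
           (λ p → Z.==-complete (sym (trans (cong (λ z → y +₅ neg₅ z) (Z.==-sound {π u} {y} p)) (+₅-neg y))))) ⟩
    K ℕ.* ind (not (π u Z.== y)) ∎

  ¬periodic : ¬ PeriodicQUCG R
  ¬periodic periodic = contradiction
    -- On the complete graph with five vertices every entry of A² + A is 4 = 2 · 2 and the degree is
    -- 4 K = 2 (2 K), so f = 2 is admissible, contradicting f = 1.
    (PeriodicQuotient.periodic⇒f≡1 R ℤ₅ π (λ x y → not (x Z.== y)) 2 K degree-eq fibre
      (λ x y → 2 , complete-square ℤ₅ refl x y) R.0# (1₅ +₅ π R.0#)
      (not-true⁻ λ p → shifted (π R.0#) (Z.==-sound p)) periodic)
    λ ()
    where
    shifted : ∀ a → a ≢ 1₅ +₅ a
    shifted = from-yes (FinP.all? λ a → ¬? (a FinP.≟ 1₅ +₅ a))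
    arrange : ∀ k → k ℕ.* 4 ≡ 2 ℕ.* (2 ℕ.* k)
    arrange = solve-∀
    degree-eq : R.degree ≡ 2 ℕ.* (2 ℕ.* K)
    degree-eq = begin
      R.degree                                        ≡⟨ degree-fibres ⟩
      ∑ ℤ₅ fibreSize                                  ≡⟨ sum-cong Z.elems fibreSize-nonzero ⟩
      (∑ ℤ₅ λ y → K ℕ.* ind (not (0₅ Z.== y)))        ≡⟨ sum-*ˡ K (λ y → ind (not (0₅ Z.== y))) Z.elems ⟩
      K ℕ.* 4                                         ≡⟨ arrange K ⟩
      2 ℕ.* (2 ℕ.* K)                                 ∎

-- Units of a product of rings

module ProductUnits (R : FinCommRing) {s : ℕ} (Rs : Fin s → FinCommRing)
  (ψ : (i : Fin s) → FinCommRing.Carrier R → FinCommRing.Carrier (Rs i)) (iso : IsProductIso R Rs ψ) where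
  open QuadraticUnits R
  open IsProductIso iso
  private
    module Q (i : Fin s) = QuadraticUnits (Rs i)

  components⇒Unit : ∀ {x} → (∀ i → Q.Unit i (ψ i x)) → Unit x
  components⇒Unit {x} units = let (y , eq) = surjective (proj₁ ∘ units) in
    y , injective _ _ λ i → trans (IsRingHom.*-hom (hom i) x y) (trans (cong (Q._*_ i (ψ i x)) (eq i))
      (trans (proj₂ (units i)) (sym (IsRingHom.1-hom (hom i)))))

  liftUnits : (v : ∀ i → FinCommRing.Carrier (Rs i)) → (∀ i → Q.Unit i (v i)) → ∃ λ x → Unit x × ∀ i → ψ i x ≡ v i
  liftUnits v units = let (x , eq) = surjective v in
    x , components⇒Unit (λ i → subst (Q.Unit i) (sym (eq i)) (units i)) , eq

  overwrite : ∀ i → FinCommRing.Carrier (Rs i) → (∀ j → FinCommRing.Carrier (Rs j)) → ∀ j → FinCommRing.Carrier (Rs j)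
  overwrite i x v j with i FinP.≟ j
  ... | yes refl = x
  ... | no _     = v j

  overwrite-Unit : ∀ i {x v} → Q.Unit i x → (∀ j → Q.Unit j (v j)) → ∀ j → Q.Unit j (overwrite i x v j)
  overwrite-Unit i u us j with i FinP.≟ j
  ... | yes refl = u
  ... | no _     = us j

  overwrite-same : ∀ i x v → overwrite i x v i ≡ x
  overwrite-same i x v with i FinP.≟ i
  ... | yes refl = refl
  ... | no p     = contradiction refl p

  overwrite-other : ∀ {i j} x v → i ≢ j → overwrite i x v j ≡ v j
  overwrite-other {i} {j} x v i≢j with i FinP.≟ j
  ... | yes p = contradiction p i≢j
  ... | no _  = refl

  ones : ∀ i → FinCommRing.Carrier (Rs i)
  ones i = FinCommRing.1# (Rs i)

residue-hom : ∀ R (S : FinCommRing) M (z : ResidueIsoZ5 S M) {ψ} → IsRingHom R S ψ → ℤ₅-Hom R (ResidueIsoZ5.φ z ∘ ψ)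
residue-hom R S M z {ψ} hom = record
  { +-hom = λ x y → trans (cong φ (IsRingHom.+-hom hom x y)) (Z.+-hom (ψ x) (ψ y))
  ; *-hom = λ x y → trans (cong φ (IsRingHom.*-hom hom x y)) (Z.*-hom (ψ x) (ψ y))
  ; 1-hom = trans (cong φ (IsRingHom.1-hom hom)) Z.1-hom
  }
  where
  module Z = ResidueIsoZ5 z
  open Z using (φ)

-- Periodicity forces a single factor with residue field ℤ₅

module Forward (R : FinCommRing) (k : ℕ)
  (Rs : Fin (suc k) → FinCommRing)
  (M : (i : Fin (suc k)) → Subset (Rs i))
  (local : ∀ i → IsLocalWith (Rs i) (M i))
  (ψ : (i : Fin (suc k)) → FinCommRing.Carrier R → FinCommRing.Carrier (Rs i))
  (iso : IsProductIso R Rs ψ)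
  (mod4 : ∀ i → resSize (Rs i) (M i) % 4 ≡ 1)
  (periodic : PeriodicQUCG R) where
  open ProductUnits R Rs ψ iso
  private
    module Q (i : Fin (suc k)) = QuadraticUnits (Rs i)
    module F (i : Fin (suc k)) = ResidueField (Rs i) (M i) (local i)

  size-residueField : ∀ i → size (enumeration (F.classRing i)) ≡ suc (4 ℕ.* (resSize (Rs i) (M i) / 4))
  size-residueField i = trans (sym (F.resSize-class i)) (trans (m≡m%n+[m/n]*n (resSize (Rs i) (M i)) 4)
    (cong₂ ℕ._+_ (mod4 i) (ℕP.*-comm (resSize (Rs i) (M i) / 4) 4)))

  residue : ∀ i → FinCommRing.Carrier R → FinCommRing.Carrier (F.classRing i)
  residue i = F.class i ∘ ψ i

  residue-isHom : ∀ i → IsRingHom R (F.classRing i) (residue i)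
  residue-isHom i = record
    { +-hom = λ x y → trans (cong (F.class i) (IsRingHom.+-hom (IsProductIso.hom iso i) x y)) (F.class-+ i _ _)
    ; *-hom = λ x y → trans (cong (F.class i) (IsRingHom.*-hom (IsProductIso.hom iso i) x y)) (F.class-* i _ _)
    ; 1-hom = cong (F.class i) (IsRingHom.1-hom (IsProductIso.hom iso i))
    }

  -- The representative of c is a unit of the local ring, and 1 in all other components completes it
  -- to a unit of R.
  liftResidueUnit : ∀ i {c} → QuadraticUnits.Unit (F.classRing i) c →
                    ∃ λ s → QuadraticUnits.Unit R s × residue i s ≡ c
  liftResidueUnit i {c} u =
    let lifted = F.lift-Unit i {c} λ p → QuadraticUnits.¬Unit-0 (F.classRing i) (subst (QuadraticUnits.Unit (F.classRing i)) p u)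
        s , unit , eq = liftUnits (overwrite i (F.lift i c) ones) (overwrite-Unit i lifted λ j → Q.Unit-1 j)
    in s , unit , trans (cong (F.class i) (trans (eq i) (overwrite-same i (F.lift i c) ones))) (F.class-lift i c)

  residueIso : ∀ i → ResidueIsoZ5 (Rs i) (M i)
  residueIso i = F.residueIso i (trans (size-residueField i) (cong (λ e → suc (4 ℕ.* e))
    (FieldQuotient.periodic⇒e≡1 R (F.classRing i) (residue i) (residue-isHom i) (liftResidueUnit i)
      (FieldSums.congruence (F.classRing i) (F.invertible i) (resSize (Rs i) (M i) / 4) (size-residueField i)) periodic)))

  nonzeroResidue⇒Unit : ∀ i {x} → ResidueIsoZ5.φ (residueIso i) x ≢ 0₅ → Q.Unit i x
  nonzeroResidue⇒Unit i φx≢0 =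
    Ideals.∉M⇒Unit (Rs i) (local i) (≢true λ h → φx≢0 (ResidueIsoZ5.kernel⁻ (residueIso i) _ h))

  single-factor : ∀ (i j : Fin (suc k)) → i ≡ j
  single-factor i j with i FinP.≟ j
  ... | yes p  = p
  ... | no i≢j = contradiction periodic (TwoResidues.¬periodic R (I.φ ∘ ψ i) (J.φ ∘ ψ j)
      (residue-hom R (Rs i) (M i) (residueIso i) (IsProductIso.hom iso i))
      (residue-hom R (Rs j) (M j) (residueIso j) (IsProductIso.hom iso j)) lifts)
    where
    module I = ResidueIsoZ5 (residueIso i)
    module J = ResidueIsoZ5 (residueIso j)
    lifts : ∀ a b → a ≢ 0₅ → b ≢ 0₅ → ∃ λ s → QuadraticUnits.Unit R s × I.φ (ψ i s) ≡ a × J.φ (ψ j s) ≡ b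
    lifts a b a≢0 b≢0 =
      let x , φx = I.surj a
          y , φy = J.surj b
          -- Component j is set here and component i on top of it; as i ≠ j, both prescribed values
          -- survive.
          v = overwrite j y ones
          s , unit , eq = liftUnits (overwrite i x v)
            (overwrite-Unit i (nonzeroResidue⇒Unit i (a≢0 ∘ trans (sym φx)))
              (overwrite-Unit j (nonzeroResidue⇒Unit j (b≢0 ∘ trans (sym φy))) λ l → Q.Unit-1 l))
      in s , unit , trans (cong I.φ (trans (eq i) (overwrite-same i x v))) φx
           , trans (cong J.φ (trans (eq j) (trans (overwrite-other x v i≢j) (overwrite-same j y ones)))) φy

-- The walk on a blow-up of the pentagon

module Pentagon where
  open import Data.Rational using (_+_; _*_; _-_; -_)
  open ℚ-solver using (solve; con; _:=_; _:+_; _:*_; _:-_; :-_)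
  open ≡-Reasoning

  -- The adjacency operator B of the 5-cycle, 4 being - 1 modulo 5.
  neighbours : (Fin 5 → ℚ) → Fin 5 → ℚ
  neighbours h c = h (c +₅ 1₅) + h (c +₅ 4₅)

  total : (Fin 5 → ℚ) → ℚ
  total h = h 0₅ + (h 1₅ + (h 2₅ + (h 3₅ + h 4₅)))

  neighbours-cong : ∀ {h k : Fin 5 → ℚ} → (∀ c → h c ≡ k c) → ∀ c → neighbours h c ≡ neighbours k c
  neighbours-cong eq c = cong₂ _+_ (eq (c +₅ 1₅)) (eq (c +₅ 4₅))

  -- Walks of length two from c return in two ways or end at one of the two non-neighbours, so B² =
  -- J - B + I.
  neighbours² : ∀ h c → neighbours (neighbours h) c ≡ total h - neighbours h c + h c
  neighbours² h c = go c
    where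
    go : ∀ c → neighbours (neighbours h) c ≡ total h - neighbours h c + h c
    go 0₅ = solve 5 (λ a b c d e → (c :+ a) :+ (a :+ d) := (a :+ (b :+ (c :+ (d :+ e)))) :- (b :+ e) :+ a) refl
              (h 0₅) (h 1₅) (h 2₅) (h 3₅) (h 4₅)
    go 1₅ = solve 5 (λ a b c d e → (d :+ b) :+ (b :+ e) := (a :+ (b :+ (c :+ (d :+ e)))) :- (c :+ a) :+ b) refl
              (h 0₅) (h 1₅) (h 2₅) (h 3₅) (h 4₅)
    go 2₅ = solve 5 (λ a b c d e → (e :+ c) :+ (c :+ a) := (a :+ (b :+ (c :+ (d :+ e)))) :- (d :+ b) :+ c) refl
              (h 0₅) (h 1₅) (h 2₅) (h 3₅) (h 4₅)
    go 3₅ = solve 5 (λ a b c d e → (a :+ d) :+ (d :+ b) := (a :+ (b :+ (c :+ (d :+ e)))) :- (e :+ c) :+ d) refl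
              (h 0₅) (h 1₅) (h 2₅) (h 3₅) (h 4₅)
    go 4₅ = solve 5 (λ a b c d e → (b :+ e) :+ (e :+ c) := (a :+ (b :+ (c :+ (d :+ e)))) :- (a :+ d) :+ e) refl
              (h 0₅) (h 1₅) (h 2₅) (h 3₅) (h 4₅)

  total-recurrence : ∀ h k → total (λ c → neighbours h c - k c) ≡ total h + total h - total k
  total-recurrence h k = solve 10 (λ a b c d e p q r s t →
      ((b :+ e) :- p) :+ (((c :+ a) :- q) :+ (((d :+ b) :- r) :+ (((e :+ c) :- s) :+ ((a :+ d) :- t))))
      := (a :+ (b :+ (c :+ (d :+ e)))) :+ (a :+ (b :+ (c :+ (d :+ e)))) :- (p :+ (q :+ (r :+ (s :+ t)))))
    refl (h 0₅) (h 1₅) (h 2₅) (h 3₅) (h 4₅) (k 0₅) (k 1₅) (k 2₅) (k 3₅) (k 4₅)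

  module Wave (Ψ : ℕ → Fin 5 → ℚ)
              (wave : ∀ n c → Ψ (suc (suc n)) c ≡ neighbours (Ψ (suc n)) c - Ψ n c)
              (balanced : total (Ψ 1) ≡ total (Ψ 0)) where

    s : ℚ
    s = total (Ψ 0)

    total-cong : ∀ {h k : Fin 5 → ℚ} → (∀ c → h c ≡ k c) → total h ≡ total k
    total-cong eq = cong₂ _+_ (eq 0₅) (cong₂ _+_ (eq 1₅) (cong₂ _+_ (eq 2₅) (cong₂ _+_ (eq 3₅) (eq 4₅))))

    -- The totals satisfy t(n + 2) = 2 t(n + 1) - t(n), which permits linear growth; `balanced`
    -- excludes it.
    total-Ψ : ∀ n → total (Ψ n) ≡ s
    total-Ψ zero          = refl
    total-Ψ (suc zero)    = balanced
    total-Ψ (suc (suc n)) = begin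
      total (Ψ (suc (suc n)))                              ≡⟨ total-cong (wave n) ⟩
      total (λ c → neighbours (Ψ (suc n)) c - Ψ n c)       ≡⟨ total-recurrence (Ψ (suc n)) (Ψ n) ⟩
      total (Ψ (suc n)) + total (Ψ (suc n)) - total (Ψ n)  ≡⟨ cong₂ (λ x y → x + x - y) (total-Ψ (suc n)) (total-Ψ n) ⟩
      s + s - s                                            ≡⟨ solve 1 (λ s → s :+ s :- s := s) refl s ⟩
      s                                                    ∎

    module _ (n : ℕ) where
      private
        X Y : Fin 5 → ℚ
        X = Ψ n
        Y = Ψ (suc n)

      -- `neighbours²` eliminates B², so every later term is a combination of X, Y, B X, B Y and the
      -- constant s.
      Ψ₃ : ∀ c → Ψ (suc (suc (suc n))) c ≡ s - (neighbours Y c + neighbours X c)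
      Ψ₃ c = begin
        Ψ (suc (suc (suc n))) c
          ≡⟨ wave (suc n) c ⟩
        neighbours (Ψ (suc (suc n))) c - Y c
          ≡⟨ cong (_- Y c) (neighbours-cong (wave n) c) ⟩
        ((neighbours Y (c +₅ 1₅) - X (c +₅ 1₅)) + (neighbours Y (c +₅ 4₅) - X (c +₅ 4₅))) - Y c
          ≡⟨ solve 5 (λ a b d e y → ((a :- b) :+ (d :- e)) :- y := (a :+ d) :- (b :+ e) :- y) refl
               (neighbours Y (c +₅ 1₅)) (X (c +₅ 1₅)) (neighbours Y (c +₅ 4₅)) (X (c +₅ 4₅)) (Y c) ⟩
        neighbours (neighbours Y) c - neighbours X c - Y c
          ≡⟨ cong (λ z → z - neighbours X c - Y c) (trans (neighbours² Y c)
               (cong (λ t → t - neighbours Y c + Y c) (total-Ψ (suc n)))) ⟩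
        s - neighbours Y c + Y c - neighbours X c - Y c
          ≡⟨ solve 4 (λ s a y x → s :- a :+ y :- x :- y := s :- (a :+ x)) refl s (neighbours Y c) (Y c) (neighbours X c) ⟩
        s - (neighbours Y c + neighbours X c) ∎

      Ψ₄ : ∀ c → Ψ (suc (suc (suc (suc n)))) c ≡ neighbours X c - Y c
      Ψ₄ c = begin
        Ψ (suc (suc (suc (suc n)))) c
          ≡⟨ wave (suc (suc n)) c ⟩
        neighbours (Ψ (suc (suc (suc n)))) c - Ψ (suc (suc n)) c
          ≡⟨ cong₂ _-_ (neighbours-cong Ψ₃ c) (wave n c) ⟩
        (s - (neighbours Y (c +₅ 1₅) + neighbours X (c +₅ 1₅))) + (s - (neighbours Y (c +₅ 4₅) + neighbours X (c +₅ 4₅)))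
          - (neighbours Y c - X c)
          ≡⟨ solve 7 (λ s a b d e y x → (s :- (a :+ b)) :+ (s :- (d :+ e)) :- (y :- x)
                        := (s :+ s) :- (a :+ d) :- (b :+ e) :- (y :- x)) refl
               s (neighbours Y (c +₅ 1₅)) (neighbours X (c +₅ 1₅)) (neighbours Y (c +₅ 4₅)) (neighbours X (c +₅ 4₅))
               (neighbours Y c) (X c) ⟩
        (s + s) - neighbours (neighbours Y) c - neighbours (neighbours X) c - (neighbours Y c - X c)
          ≡⟨ cong₂ (λ a b → (s + s) - a - b - (neighbours Y c - X c))
               (trans (neighbours² Y c) (cong (λ t → t - neighbours Y c + Y c) (total-Ψ (suc n))))
               (trans (neighbours² X c) (cong (λ t → t - neighbours X c + X c) (total-Ψ n))) ⟩
        (s + s) - (s - neighbours Y c + Y c) - (s - neighbours X c + X c) - (neighbours Y c - X c)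
          ≡⟨ solve 5 (λ s a y b x → (s :+ s) :- (s :- a :+ y) :- (s :- b :+ x) :- (a :- x) := b :- y) refl
               s (neighbours Y c) (Y c) (neighbours X c) (X c) ⟩
        neighbours X c - Y c ∎

      -- Off the constants B has the eigenvalues 2 cos(2π/5) and 2 cos(4π/5), so the characteristic
      -- roots of `wave` are primitive fifth roots of unity; on the constants the sequence is fixed
      -- by `total-Ψ`.
      Ψ₅ : ∀ c → Ψ (suc (suc (suc (suc (suc n))))) c ≡ X c
      Ψ₅ c = begin
        Ψ (suc (suc (suc (suc (suc n))))) c
          ≡⟨ wave (suc (suc (suc n))) c ⟩
        neighbours (Ψ (suc (suc (suc (suc n))))) c - Ψ (suc (suc (suc n))) c
          ≡⟨ cong₂ _-_ (neighbours-cong Ψ₄ c) (Ψ₃ c) ⟩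
        (neighbours X (c +₅ 1₅) - Y (c +₅ 1₅)) + (neighbours X (c +₅ 4₅) - Y (c +₅ 4₅)) - (s - (neighbours Y c + neighbours X c))
          ≡⟨ solve 7 (λ a b d e s y x → (a :- b) :+ (d :- e) :- (s :- (y :+ x)) := (a :+ d) :- (b :+ e) :- (s :- (y :+ x))) refl
               (neighbours X (c +₅ 1₅)) (Y (c +₅ 1₅)) (neighbours X (c +₅ 4₅)) (Y (c +₅ 4₅)) s (neighbours Y c) (neighbours X c) ⟩
        neighbours (neighbours X) c - neighbours Y c - (s - (neighbours Y c + neighbours X c))
          ≡⟨ cong (λ z → z - neighbours Y c - (s - (neighbours Y c + neighbours X c)))
               (trans (neighbours² X c) (cong (λ t → t - neighbours X c + X c) (total-Ψ n))) ⟩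
        (s - neighbours X c + X c) - neighbours Y c - (s - (neighbours Y c + neighbours X c))
          ≡⟨ solve 4 (λ s b x y → (s :- b :+ x) :- y :- (s :- (y :+ b)) := x) refl s (neighbours X c) (X c) (neighbours Y c) ⟩
        X c ∎

      -- Over a period the fifth roots of unity cancel, and five times the constant part s / 5
      -- remains.
      five-sum : ∀ c → Ψ n c + (Ψ (suc n) c + (Ψ (suc (suc n)) c + (Ψ (suc (suc (suc n))) c + Ψ (suc (suc (suc (suc n)))) c))) ≡ s
      five-sum c = trans
        (cong₂ (λ a b → X c + (Y c + (a + b))) (wave n c) (cong₂ _+_ (Ψ₃ c) (Ψ₄ c)))
        (solve 5 (λ x y a s b → x :+ (y :+ ((a :- x) :+ ((s :- (a :+ b)) :+ (b :- y)))) := s) refl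
          (X c) (Y c) (neighbours Y c) s (neighbours X c))

    neighbours-five : ∀ (h : Fin 5 → Fin 5 → ℚ) → (∀ c → h 0₅ c + (h 1₅ c + (h 2₅ c + (h 3₅ c + h 4₅ c))) ≡ s) → ∀ c →
      neighbours (h 0₅) c + (neighbours (h 1₅) c + (neighbours (h 2₅) c + (neighbours (h 3₅) c + neighbours (h 4₅) c))) ≡ s + s
    neighbours-five h eq c = trans
      (solve 10 (λ a b d e f p q r t u →
         (a :+ p) :+ ((b :+ q) :+ ((d :+ r) :+ ((e :+ t) :+ (f :+ u))))
         := (a :+ (b :+ (d :+ (e :+ f)))) :+ (p :+ (q :+ (r :+ (t :+ u))))) refl
         (h 0₅ (c +₅ 1₅)) (h 1₅ (c +₅ 1₅)) (h 2₅ (c +₅ 1₅)) (h 3₅ (c +₅ 1₅)) (h 4₅ (c +₅ 1₅))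
         (h 0₅ (c +₅ 4₅)) (h 1₅ (c +₅ 4₅)) (h 2₅ (c +₅ 4₅)) (h 3₅ (c +₅ 4₅)) (h 4₅ (c +₅ 4₅)))
      (cong₂ _+_ (eq (c +₅ 1₅)) (eq (c +₅ 4₅)))

    -- Ψ has period 5, so the indices n, n + 4, …, n + 16 run through all residues.
    neighbours-every-fourth : ∀ n c →
      neighbours (Ψ n) c + (neighbours (Ψ (4 ℕ.+ n)) c + (neighbours (Ψ (8 ℕ.+ n)) c +
        (neighbours (Ψ (12 ℕ.+ n)) c + neighbours (Ψ (16 ℕ.+ n)) c))) ≡ s + s
    neighbours-every-fourth n c = neighbours-five
      (λ where
        0₅ → Ψ n
        1₅ → Ψ (4 ℕ.+ n)
        2₅ → Ψ (8 ℕ.+ n)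
        3₅ → Ψ (12 ℕ.+ n)
        4₅ → Ψ (16 ℕ.+ n))
      (λ c → begin
        Ψ n c + (Ψ (4 ℕ.+ n) c + (Ψ (8 ℕ.+ n) c + (Ψ (12 ℕ.+ n) c + Ψ (16 ℕ.+ n) c)))
          ≡⟨ cong (λ z → Ψ n c + (Ψ (4 ℕ.+ n) c + z)) (cong₂ _+_ (Ψ₅ (3 ℕ.+ n) c)
               (cong₂ _+_ (trans (Ψ₅ (7 ℕ.+ n) c) (Ψ₅ (2 ℕ.+ n) c))
                 (trans (Ψ₅ (11 ℕ.+ n) c) (trans (Ψ₅ (6 ℕ.+ n) c) (Ψ₅ (1 ℕ.+ n) c))))) ⟩
        Ψ n c + (Ψ (4 ℕ.+ n) c + (Ψ (3 ℕ.+ n) c + (Ψ (2 ℕ.+ n) c + Ψ (1 ℕ.+ n) c)))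
          ≡⟨ solve 5 (λ a b c d e → a :+ (e :+ (d :+ (c :+ b))) := a :+ (b :+ (c :+ (d :+ e)))) refl
               (Ψ n c) (Ψ (1 ℕ.+ n) c) (Ψ (2 ℕ.+ n) c) (Ψ (3 ℕ.+ n) c) (Ψ (4 ℕ.+ n) c) ⟩
        Ψ n c + (Ψ (1 ℕ.+ n) c + (Ψ (2 ℕ.+ n) c + (Ψ (3 ℕ.+ n) c + Ψ (4 ℕ.+ n) c)))
          ≡⟨ five-sum n c ⟩
        s ∎) c

    -- Twenty steps are five increments of four steps each. By `neighbours-every-fourth` their
    -- positive and negative parts both add up to 2 (s + s), whatever a and b are.
    returns : ∀ (g : ℕ → ℚ) a b →
              (∀ n → g (4 ℕ.+ n) ≡ g n + (ι 2 * neighbours (Ψ (3 ℕ.+ n)) a - ι 2 * neighbours (Ψ (2 ℕ.+ n)) b)) →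
              g 20 ≡ g 0
    returns g a b step = begin
      g 20
        ≡⟨ trans (step 16) (cong (_+ d 16) (trans (step 12) (cong (_+ d 12) (trans (step 8) (cong (_+ d 8)
             (trans (step 4) (cong (_+ d 4) (step 0)))))))) ⟩
      g 0 + d 0 + d 4 + d 8 + d 12 + d 16
        ≡⟨ telescope (g 0) (ι 2) (p 0) (p 4) (p 8) (p 12) (p 16) (q 0) (q 4) (q 8) (q 12) (q 16) ⟩
      g 0 + ι 2 * (p 0 + (p 4 + (p 8 + (p 12 + p 16)))) - ι 2 * (q 0 + (q 4 + (q 8 + (q 12 + q 16))))
        ≡⟨ cong₂ (λ x y → g 0 + ι 2 * x - ι 2 * y) (neighbours-every-fourth 3 a) (neighbours-every-fourth 2 b) ⟩
      g 0 + ι 2 * (s + s) - ι 2 * (s + s)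
        ≡⟨ solve 2 (λ g x → g :+ x :- x := g) refl (g 0) (ι 2 * (s + s)) ⟩
      g 0 ∎
      where
      p q d : ℕ → ℚ
      p n = neighbours (Ψ (3 ℕ.+ n)) a
      q n = neighbours (Ψ (2 ℕ.+ n)) b
      d n = ι 2 * p n - ι 2 * q n
      telescope : ∀ g t p₀ p₁ p₂ p₃ p₄ q₀ q₁ q₂ q₃ q₄ →
        g + (t * p₀ - t * q₀) + (t * p₁ - t * q₁) + (t * p₂ - t * q₂) + (t * p₃ - t * q₃) + (t * p₄ - t * q₄)
        ≡ g + t * (p₀ + (p₁ + (p₂ + (p₃ + p₄)))) - t * (q₀ + (q₁ + (q₂ + (q₃ + q₄))))
      telescope = solve 12 (λ g t p₀ p₁ p₂ p₃ p₄ q₀ q₁ q₂ q₃ q₄ →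
        g :+ (t :* p₀ :- t :* q₀) :+ (t :* p₁ :- t :* q₁) :+ (t :* p₂ :- t :* q₂) :+ (t :* p₃ :- t :* q₃) :+ (t :* p₄ :- t :* q₄)
        := g :+ t :* (p₀ :+ (p₁ :+ (p₂ :+ (p₃ :+ p₄)))) :- t :* (q₀ :+ (q₁ :+ (q₂ :+ (q₃ :+ q₄))))) refl

-- Residue field ℤ₅ makes the walk periodic

module PentagonBlowUp (R : FinCommRing) (ρ : FinCommRing.Carrier R → Fin 5) (ρ-hom : ℤ₅-Hom R ρ)
  (ρ-surjective : ∀ a → ∃ λ x → ρ x ≡ a)
  (ρ-Unit : ∀ x → ρ x ≢ 0₅ → QuadraticUnits.Unit R x) where
  open QuadraticUnits R
  open ℤ₅-Hom ρ-hom
  open Pentagon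
  private module Z = Enumeration ℤ₅

  module SquareRoots where
    open ≡-Reasoning

    -- Squaring is injective on the fibre of 1, since there x + y has residue 2 and is a unit.
    partialSquare : Carrier → Carrier
    partialSquare x = if ρ x Z.== 1₅ then x * x else x

    partialSquare-1 : ∀ {x} → ρ x ≡ 1₅ → partialSquare x ≡ x * x
    partialSquare-1 {x} p = cong (λ b → if b then x * x else x) (Z.==-complete p)

    partialSquare-≢1 : ∀ {x} → ρ x ≢ 1₅ → partialSquare x ≡ x
    partialSquare-≢1 {x} p = cong (λ b → if b then x * x else x) (Z.≠-false p)

    ρ-square : ∀ {x} → ρ x ≡ 1₅ → ρ (x * x) ≡ 1₅
    ρ-square {x} p = trans (*-hom x x) (cong₂ _*₅_ p p)

    square-injective : ∀ {x y} → ρ x ≡ 1₅ → ρ y ≡ 1₅ → x * x ≡ y * y → x ≡ y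
    square-injective {x} {y} p q eq = difference-0 (Unit-cancel (ρ-Unit (x + y) x+y≢0) (begin
      (x + y) * (x + - y)  ≡⟨ solve 2 (λ x y → (x :+ y) :* (x :+ :- y) := x :* x :+ :- (y :* y)) refl x y ⟩
      x * x + - (y * y)    ≡⟨ cong (λ z → z + - (y * y)) eq ⟩
      y * y + - (y * y)    ≡⟨ -‿inverseʳ _ ⟩
      0#                   ≡⟨ zeroʳ (x + y) ⟨
      (x + y) * 0#         ∎))
      where
      x+y≢0 : ρ (x + y) ≢ 0₅
      x+y≢0 r = contradiction (trans (sym r) (trans (+-hom x y) (cong₂ _+₅_ p q))) λ ()

    partialSquare-injective : ∀ {x y} → partialSquare x ≡ partialSquare y → x ≡ y
    partialSquare-injective {x} {y} eq = cases (ρ x FinP.≟ 1₅) (ρ y FinP.≟ 1₅)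
      where
      cases : Dec (ρ x ≡ 1₅) → Dec (ρ y ≡ 1₅) → x ≡ y
      cases (yes p) (yes q) = square-injective p q (trans (sym (partialSquare-1 p)) (trans eq (partialSquare-1 q)))
      cases (yes p) (no q)  = contradiction
        (trans (cong ρ (trans (sym (partialSquare-≢1 q)) (trans (sym eq) (partialSquare-1 p)))) (ρ-square p)) q
      cases (no p)  (yes q) = contradiction
        (trans (cong ρ (trans (sym (partialSquare-≢1 p)) (trans eq (partialSquare-1 q)))) (ρ-square q)) p
      cases (no p)  (no q)  = trans (sym (partialSquare-≢1 p)) (trans eq (partialSquare-≢1 q))

    -- Extending squaring by the identity makes it an injective self-map of the finite ring, hence
    -- onto. A preimage of x must itself have residue 1, because elsewhere `partialSquare` fixes its
    -- argument, so it is a square root of x.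
    fibre-1-T : ∀ {x} → ρ x ≡ 1₅ → T x
    fibre-1-T {x} p = let y , eq = injective⇒surjective E E refl partialSquare partialSquare-injective x in
      root y eq (ρ y FinP.≟ 1₅)
      where
      root : ∀ y → partialSquare y ≡ x → Dec (ρ y ≡ 1₅) → T x
      root y eq (yes q) = y , ρ-Unit y (λ z → contradiction (trans (sym q) z) λ ()) , inj₁ (trans (sym eq) (partialSquare-1 q))
      root y eq (no q)  = contradiction (trans (cong ρ (trans (sym (partialSquare-≢1 q)) eq)) p) q

    fibre-4-T : ∀ {x} → ρ x ≡ 4₅ → T x
    fibre-4-T {x} p = subst T (solve 1 (λ x → :- (:- x) := x) refl x)
      (T-neg (fibre-1-T (opposite (ρ (- x)) (trans (cong (ρ (- x) +₅_) (sym p)) (neg-hom x)))))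
      where
      opposite : ∀ a → a +₅ 4₅ ≡ 0₅ → a ≡ 1₅
      opposite = from-yes (FinP.all? λ a → (a +₅ 4₅ FinP.≟ 0₅) →-dec (a FinP.≟ 1₅))

  inT-ρ : ∀ t → inT R t ≡ (ρ t Z.== 1₅) ∨ (ρ t Z.== 4₅)
  inT-ρ t = Bool-ext (λ h → forth (T-hom (inT⁻ h))) (λ h → back (∨-true {ρ t Z.== 1₅} h))
    where
    forth : ρ t ≡ 1₅ ⊎ ρ t ≡ 4₅ → (ρ t Z.== 1₅) ∨ (ρ t Z.== 4₅) ≡ true
    forth (inj₁ p) = ∨-trueˡ (Z.==-complete p)
    forth (inj₂ p) = ∨-trueʳ (Z.==-complete p)
    back : (ρ t Z.== 1₅) ≡ true ⊎ (ρ t Z.== 4₅) ≡ true → inT R t ≡ true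
    back (inj₁ p) = inT⁺ (SquareRoots.fibre-1-T (Z.==-sound p))
    back (inj₂ p) = inT⁺ (SquareRoots.fibre-4-T (Z.==-sound p))

  m : ℕ
  m = ∑ℕ.∑ E λ t → ∑ℕ.ind (ρ t Z.== 0₅)

  translate-fibre : ∀ u w c → (ρ (u + w) Z.== (ρ u +₅ c)) ≡ (ρ w Z.== c)
  translate-fibre u w c = Bool-ext
    (λ p → Z.==-complete (trans (sym (+₅-neg-cancel (ρ w) (ρ u)))
      (trans (cong (_+₅ neg₅ (ρ u)) (trans (sym (+-hom u w)) (Z.==-sound p))) (+₅-neg-cancel c (ρ u)))))
    (λ p → Z.==-complete (trans (+-hom u w) (cong (ρ u +₅_) (Z.==-sound p))))

  fibre-m : ∀ c → (∑ℕ.∑ E λ t → ∑ℕ.ind (ρ t Z.== c)) ≡ m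
  fibre-m c = let x , ρx≡c = ρ-surjective c in trans
    (sym (ℕ-sums.∑-translate x λ t → ∑ℕ.ind (ρ t Z.== c)))
    (∑ℕ.sum-cong elems λ t → cong ∑ℕ.ind (trans
      (cong (ρ (x + t) Z.==_) (trans (sym (identity c)) (cong (_+₅ 0₅) (sym ρx≡c))))
      (translate-fibre x t 0₅)))
    where
    identity : ∀ c → c +₅ 0₅ ≡ c
    identity = from-yes (FinP.all? λ c → c +₅ 0₅ FinP.≟ c)

  disjoint-ℕ : ∀ c → ∑ℕ.ind ((c Z.== 1₅) ∨ (c Z.== 4₅)) ≡ ∑ℕ.ind (c Z.== 1₅) ℕ.+ ∑ℕ.ind (c Z.== 4₅)
  disjoint-ℕ 0₅ = refl
  disjoint-ℕ 1₅ = refl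
  disjoint-ℕ 2₅ = refl
  disjoint-ℕ 3₅ = refl
  disjoint-ℕ 4₅ = refl

  degree≡2m : degree ≡ 2 ℕ.* m
  degree≡2m = begin
    degree
      ≡⟨ ∑ℕ.sum-cong elems (λ t → trans (cong ∑ℕ.ind (inT-ρ t)) (disjoint-ℕ (ρ t))) ⟩
    (∑ℕ.∑ E λ t → ∑ℕ.ind (ρ t Z.== 1₅) ℕ.+ ∑ℕ.ind (ρ t Z.== 4₅))
      ≡⟨ ∑ℕ.sum-+ (λ t → ∑ℕ.ind (ρ t Z.== 1₅)) (λ t → ∑ℕ.ind (ρ t Z.== 4₅)) elems ⟩
    (∑ℕ.∑ E λ t → ∑ℕ.ind (ρ t Z.== 1₅)) ℕ.+ (∑ℕ.∑ E λ t → ∑ℕ.ind (ρ t Z.== 4₅))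
      ≡⟨ cong₂ ℕ._+_ (fibre-m 1₅) (trans (fibre-m 4₅) (sym (ℕP.+-identityʳ m))) ⟩
    2 ℕ.* m ∎
    where open ≡-Reasoning

  open Grover (Enumeration._≟_ E) elems (adjR R)
    using (Arc; recip; deg; I)
  open Walk E (adjR R) adj-sym
  open ∑ℚ
  open import Data.Rational using () renaming (_+_ to _+ℚ_; _*_ to _*ℚ_; _-_ to _-ℚ_; -_ to -ℚ_)
  private module S = ℚ-solver
  open ≡-Reasoning

  r : ℚ
  r = recip degree

  -- 2 r = 1/m, so mean g c is the average of g over the fibre of c.
  mean : (Carrier → ℚ) → Fin 5 → ℚ
  mean g c = (ι 2 *ℚ r) *ℚ ∑ E λ w → ind (ρ w Z.== c) *ℚ g w

  normalisation : (ι 2 *ℚ r) *ℚ ι m ≡ 1ℚ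
  normalisation = begin
    (ι 2 *ℚ r) *ℚ ι m     ≡⟨ S.solve 3 (λ t r m → (t S.:* r) S.:* m S.:= r S.:* (t S.:* m)) refl (ι 2) r (ι m) ⟩
    r *ℚ (ι 2 *ℚ ι m)     ≡⟨ cong (r *ℚ_) (trans (sym (ι-* 2 m)) (cong ι (sym degree≡2m))) ⟩
    r *ℚ ι degree         ≡⟨ recip-degree ⟩
    1ℚ                    ∎

  mean-cong : ∀ {g h : Carrier → ℚ} → (∀ w → g w ≡ h w) → ∀ c → mean g c ≡ mean h c
  mean-cong eq c = cong ((ι 2 *ℚ r) *ℚ_) (sum-cong elems λ w → cong (ind (ρ w Z.== c) *ℚ_) (eq w))

  -- A pulled-back function is constant on the m elements of each fibre, and `normalisation` divides
  -- by m.
  mean-ρ : ∀ h c → mean (h ∘ ρ) c ≡ h c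
  mean-ρ h c = begin
    (ι 2 *ℚ r) *ℚ (∑ E λ w → ind (ρ w Z.== c) *ℚ h (ρ w))
      ≡⟨ cong ((ι 2 *ℚ r) *ℚ_) (trans (sum-cong elems λ w → on-fibre w) (sum-*ʳ (h c) (λ w → ind (ρ w Z.== c)) elems)) ⟩
    (ι 2 *ℚ r) *ℚ ((∑ E λ w → ind (ρ w Z.== c)) *ℚ h c)
      ≡⟨ cong (λ z → (ι 2 *ℚ r) *ℚ (z *ℚ h c)) (trans (sym (ι-∑-ind E λ w → ρ w Z.== c)) (cong ι (fibre-m c))) ⟩
    (ι 2 *ℚ r) *ℚ (ι m *ℚ h c)   ≡⟨ ℚP.*-assoc (ι 2 *ℚ r) (ι m) (h c) ⟨
    ((ι 2 *ℚ r) *ℚ ι m) *ℚ h c   ≡⟨ cong (_*ℚ h c) normalisation ⟩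
    1ℚ *ℚ h c                    ≡⟨ ℚP.*-identityˡ (h c) ⟩
    h c                          ∎
    where
    on-fibre : ∀ w → ind (ρ w Z.== c) *ℚ h (ρ w) ≡ ind (ρ w Z.== c) *ℚ h c
    on-fibre w with true-or (ρ w Z.== c)
    ... | inj₁ p = cong (λ z → ind (ρ w Z.== c) *ℚ h z) (Z.==-sound p)
    ... | inj₂ p = trans (cong (λ b → ind b *ℚ h (ρ w)) (≢true p)) (trans (ℚP.*-zeroˡ (h (ρ w)))
          (sym (trans (cong (λ b → ind b *ℚ h c) (≢true p)) (ℚP.*-zeroˡ (h c)))))

  mean-minus : ∀ g h c → mean (λ w → g w -ℚ h w) c ≡ mean g c -ℚ mean h c
  mean-minus g h c = begin
    k *ℚ (∑ E λ w → i w *ℚ (g w -ℚ h w))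
      ≡⟨ cong (k *ℚ_) (trans (sum-cong elems λ w → S.solve 3 (λ i g h → i S.:* (g S.:- h) S.:= i S.:* g S.:+ S.con (0 , 1) S.:* (i S.:* h))
           refl (i w) (g w) (h w)) (trans (sum-+ (λ w → i w *ℚ g w) (λ w → (-ℚ 1ℚ) *ℚ (i w *ℚ h w)) elems)
             (cong ((∑ E λ w → i w *ℚ g w) +ℚ_) (sum-*ˡ (-ℚ 1ℚ) (λ w → i w *ℚ h w) elems)))) ⟩
    k *ℚ ((∑ E λ w → i w *ℚ g w) +ℚ (-ℚ 1ℚ) *ℚ (∑ E λ w → i w *ℚ h w))
      ≡⟨ S.solve 3 (λ k a b → k S.:* (a S.:+ S.con (0 , 1) S.:* b) S.:= k S.:* a S.:- k S.:* b) refl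
           k (∑ E λ w → i w *ℚ g w) (∑ E λ w → i w *ℚ h w) ⟩
    mean g c -ℚ mean h c ∎
    where
    k = ι 2 *ℚ r
    i : Carrier → ℚ
    i w = ind (ρ w Z.== c)

  -- By `inT-ρ` the neighbours of u fill the fibres over ρ u + 1 and ρ u + 4; as the degree is 2 m,
  -- twice the average is the sum of the two fibre means.
  average-mean : ∀ g u → ι 2 *ℚ average g u ≡ neighbours (mean g) (ρ u)
  average-mean g u = begin
    ι 2 *ℚ average g u
      ≡⟨ cong (ι 2 *ℚ_) (average-T g u) ⟩
    ι 2 *ℚ (r *ℚ (∑ E λ t → ind (inT R t) *ℚ g (u + t)))
      ≡⟨ cong (λ z → ι 2 *ℚ (r *ℚ z)) (trans
           (sum-cong elems λ t → trans (cong (_*ℚ g (u + t)) (indicator t))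
             (ℚP.*-distribʳ-+ (g (u + t)) (ind (ρ t Z.== 1₅)) (ind (ρ t Z.== 4₅))))
           (trans (sum-+ (λ t → ind (ρ t Z.== 1₅) *ℚ g (u + t)) (λ t → ind (ρ t Z.== 4₅) *ℚ g (u + t)) elems)
             (cong₂ _+ℚ_ (shift 1₅) (shift 4₅)))) ⟩
    ι 2 *ℚ (r *ℚ (fibreSum (ρ u +₅ 1₅) +ℚ fibreSum (ρ u +₅ 4₅)))
      ≡⟨ S.solve 4 (λ t r a b → t S.:* (r S.:* (a S.:+ b)) S.:= (t S.:* r) S.:* a S.:+ (t S.:* r) S.:* b) refl
           (ι 2) r (fibreSum (ρ u +₅ 1₅)) (fibreSum (ρ u +₅ 4₅)) ⟩
    neighbours (mean g) (ρ u) ∎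
    where
    fibreSum : Fin 5 → ℚ
    fibreSum c = ∑ E λ w → ind (ρ w Z.== c) *ℚ g w
    indicator : ∀ t → ind (inT R t) ≡ ind (ρ t Z.== 1₅) +ℚ ind (ρ t Z.== 4₅)
    indicator t = trans (cong ind (inT-ρ t)) (trans (sym (ι-ind ((ρ t Z.== 1₅) ∨ (ρ t Z.== 4₅))))
      (trans (cong ι (disjoint-ℕ (ρ t))) (trans (ι-+ (∑ℕ.ind (ρ t Z.== 1₅)) (∑ℕ.ind (ρ t Z.== 4₅)))
        (cong₂ _+ℚ_ (ι-ind (ρ t Z.== 1₅)) (ι-ind (ρ t Z.== 4₅))))))
    shift : ∀ c → (∑ E λ t → ind (ρ t Z.== c) *ℚ g (u + t)) ≡ fibreSum (ρ u +₅ c)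
    shift c = trans (sum-cong elems λ t → cong (λ b → ind b *ℚ g (u + t)) (sym (translate-fibre u t c)))
      (ℚ-sums.∑-translate u λ w → ind (ρ w Z.== (ρ u +₅ c)) *ℚ g w)

  total-mean : ∀ g → total (mean g) ≡ (ι 2 *ℚ r) *ℚ ∑ E g
  total-mean g = begin
    total (mean g)
      ≡⟨ S.solve 6 (λ k a b c d e → k S.:* a S.:+ (k S.:* b S.:+ (k S.:* c S.:+ (k S.:* d S.:+ k S.:* e)))
           S.:= k S.:* (a S.:+ (b S.:+ (c S.:+ (d S.:+ (e S.:+ S.con (0 , 0))))))) refl
           (ι 2 *ℚ r) (fibreSum 0₅) (fibreSum 1₅) (fibreSum 2₅) (fibreSum 3₅) (fibreSum 4₅) ⟩
    (ι 2 *ℚ r) *ℚ ∑ ℤ₅ fibreSum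
      ≡⟨ cong ((ι 2 *ℚ r) *ℚ_) (trans (sum-swap (λ c w → ind (ρ w Z.== c) *ℚ g w) Z.elems elems)
           (sum-cong elems λ w → ∑-δ′ ℤ₅ (ρ w) λ _ → g w)) ⟩
    (ι 2 *ℚ r) *ℚ ∑ E g ∎
    where
    fibreSum : Fin 5 → ℚ
    fibreSum c = ∑ E λ w → ind (ρ w Z.== c) *ℚ g w

  -- The graph is regular, so both sides are the sum of f over all arcs divided by the degree.
  ∑-outflow-inflow : ∀ f → ∑ E (inflow f) ≡ ∑ E (outflow f)
  ∑-outflow-inflow f = begin
    (∑ E λ u → recip (deg u) *ℚ (∑ E λ w → ind (adjR R w u) *ℚ f (w , u)))
      ≡⟨ trans (sum-cong elems λ u → cong (λ d → recip d *ℚ (∑ E λ w → ind (adjR R w u) *ℚ f (w , u))) (deg-degree u))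
           (sum-*ˡ r (λ u → ∑ E λ w → ind (adjR R w u) *ℚ f (w , u)) elems) ⟩
    r *ℚ (∑ E λ u → ∑ E λ w → ind (adjR R w u) *ℚ f (w , u))
      ≡⟨ cong (r *ℚ_) (sum-swap (λ u w → ind (adjR R w u) *ℚ f (w , u)) elems elems) ⟩
    r *ℚ (∑ E λ w → ∑ E λ u → ind (adjR R w u) *ℚ f (w , u))
      ≡⟨ trans (sum-cong elems λ u → cong (λ d → recip d *ℚ (∑ E λ w → ind (adjR R u w) *ℚ f (u , w))) (deg-degree u))
           (sum-*ˡ r (λ u → ∑ E λ w → ind (adjR R u w) *ℚ f (u , w)) elems) ⟨
    (∑ E λ u → recip (deg u) *ℚ (∑ E λ w → ind (adjR R u w) *ℚ f (u , w))) ∎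

  module Evolution (f : Arc → ℚ) where

    -- Outflow is tracked because the inflow at time n is the outflow at time n + 1; one sequence,
    -- starting at time 0, thus carries both.
    G : ℕ → Carrier → ℚ
    G n = outflow (evolve^ n f)

    inflow-G : ∀ n u → inflow (evolve^ n f) u ≡ G (suc n) u
    inflow-G n u = sym (outflow-evolve recip-deg (evolve^ n f) u)

    G-recurrence : ∀ n u → G (suc (suc n)) u ≡ neighbours (mean (G (suc n))) (ρ u) -ℚ G n u
    G-recurrence n u = begin
      G (suc (suc n)) u
        ≡⟨ inflow-G (suc n) u ⟨
      inflow (evolve (evolve^ n f)) u
        ≡⟨ inflow-evolve (evolve^ n f) u ⟩
      ι 2 *ℚ average (inflow (evolve^ n f)) u -ℚ G n u
        ≡⟨ cong (λ z → ι 2 *ℚ z -ℚ G n u) (average-cong recip-deg (inflow-G n) u) ⟩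
      ι 2 *ℚ average (G (suc n)) u -ℚ G n u
        ≡⟨ cong (_-ℚ G n u) (average-mean (G (suc n)) u) ⟩
      neighbours (mean (G (suc n))) (ρ u) -ℚ G n u ∎

    Ψ : ℕ → Fin 5 → ℚ
    Ψ n = mean (G n)

    -- Take fibre means in `G-recurrence`; its first term depends on residues only, so the mean
    -- leaves it unchanged.
    wave : ∀ n c → Ψ (suc (suc n)) c ≡ neighbours (Ψ (suc n)) c -ℚ Ψ n c
    wave n c = trans (mean-cong (G-recurrence n) c)
      (trans (mean-minus (neighbours (Ψ (suc n)) ∘ ρ) (G n) c) (cong (_-ℚ Ψ n c) (mean-ρ (neighbours (Ψ (suc n))) c)))

    -- G 1 is the inflow of f and G 0 its outflow, and these have the same sum over all vertices.
    balanced : total (Ψ 1) ≡ total (Ψ 0)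
    balanced = trans (total-mean (G 1)) (trans
      (cong ((ι 2 *ℚ r) *ℚ_) (trans (sum-cong elems λ u → sym (inflow-G 0 u)) (∑-outflow-inflow f)))
      (sym (total-mean (G 0))))

    -- Each step reverses the arc and the sign, so after two of them the old value at (u , v)
    -- reappears with coefficient 1.
    two-steps : ∀ n {u v} → adjR R u v ≡ true →
                evolve^ (suc (suc n)) f (u , v) ≡ evolve^ n f (u , v) +ℚ (ι 2 *ℚ G (suc (suc n)) u -ℚ ι 2 *ℚ G (suc n) v)
    two-steps n {u} {v} p = begin
      evolve (evolve (evolve^ n f)) (u , v)
        ≡⟨ evolve-step (evolve (evolve^ n f)) p ⟩
      ι 2 *ℚ inflow (evolve^ (suc n) f) u -ℚ evolve (evolve^ n f) (v , u)
        ≡⟨ cong₂ (λ x y → ι 2 *ℚ x -ℚ y) (inflow-G (suc n) u)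
             (trans (evolve-step (evolve^ n f) (trans (adj-sym v u) p)) (cong (λ z → ι 2 *ℚ z -ℚ evolve^ n f (u , v)) (inflow-G n v))) ⟩
      ι 2 *ℚ G (suc (suc n)) u -ℚ (ι 2 *ℚ G (suc n) v -ℚ evolve^ n f (u , v))
        ≡⟨ S.solve 3 (λ a b x → a S.:- (b S.:- x) S.:= x S.:+ (a S.:- b)) refl
             (ι 2 *ℚ G (suc (suc n)) u) (ι 2 *ℚ G (suc n) v) (evolve^ n f (u , v)) ⟩
      evolve^ n f (u , v) +ℚ (ι 2 *ℚ G (suc (suc n)) u -ℚ ι 2 *ℚ G (suc n) v) ∎

    -- Adding two increments pairs G (4 + n) with G (2 + n) and G (3 + n) with G (1 + n). By
    -- `G-recurrence` each pair depends on residues only, so the increment involves nothing but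
    -- fibre means.
    four-steps : ∀ {u v} → adjR R u v ≡ true → ∀ n →
                 evolve^ (4 ℕ.+ n) f (u , v) ≡
                 evolve^ n f (u , v) +ℚ (ι 2 *ℚ neighbours (Ψ (3 ℕ.+ n)) (ρ u) -ℚ ι 2 *ℚ neighbours (Ψ (2 ℕ.+ n)) (ρ v))
    four-steps {u} {v} p n = begin
      evolve^ (4 ℕ.+ n) f (u , v)
        ≡⟨ trans (two-steps (2 ℕ.+ n) p) (cong (_+ℚ (ι 2 *ℚ G (4 ℕ.+ n) u -ℚ ι 2 *ℚ G (3 ℕ.+ n) v)) (two-steps n p)) ⟩
      (x +ℚ (ι 2 *ℚ G (2 ℕ.+ n) u -ℚ ι 2 *ℚ G (1 ℕ.+ n) v)) +ℚ (ι 2 *ℚ G (4 ℕ.+ n) u -ℚ ι 2 *ℚ G (3 ℕ.+ n) v)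
        ≡⟨ cong₂ (λ a b → (x +ℚ (ι 2 *ℚ G (2 ℕ.+ n) u -ℚ ι 2 *ℚ G (1 ℕ.+ n) v)) +ℚ (ι 2 *ℚ a -ℚ ι 2 *ℚ b))
             (G-recurrence (2 ℕ.+ n) u) (G-recurrence (1 ℕ.+ n) v) ⟩
      (x +ℚ (ι 2 *ℚ G (2 ℕ.+ n) u -ℚ ι 2 *ℚ G (1 ℕ.+ n) v)) +ℚ
        (ι 2 *ℚ (neighbours (Ψ (3 ℕ.+ n)) (ρ u) -ℚ G (2 ℕ.+ n) u) -ℚ ι 2 *ℚ (neighbours (Ψ (2 ℕ.+ n)) (ρ v) -ℚ G (1 ℕ.+ n) v))
        ≡⟨ S.solve 6 (λ x t a b p q → (x S.:+ (t S.:* a S.:- t S.:* b)) S.:+ (t S.:* (p S.:- a) S.:- t S.:* (q S.:- b))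
             S.:= x S.:+ (t S.:* p S.:- t S.:* q)) refl
             x (ι 2) (G (2 ℕ.+ n) u) (G (1 ℕ.+ n) v) (neighbours (Ψ (3 ℕ.+ n)) (ρ u)) (neighbours (Ψ (2 ℕ.+ n)) (ρ v)) ⟩
      x +ℚ (ι 2 *ℚ neighbours (Ψ (3 ℕ.+ n)) (ρ u) -ℚ ι 2 *ℚ neighbours (Ψ (2 ℕ.+ n)) (ρ v)) ∎
      where
      x = evolve^ n f (u , v)

    period-20 : ∀ {u v} → adjR R u v ≡ true → evolve^ 20 f (u , v) ≡ f (u , v)
    period-20 {u} {v} p = Wave.returns Ψ wave balanced (λ n → evolve^ n f (u , v)) (ρ u) (ρ v) (four-steps p)

  periodic : PeriodicQUCG R
  -- Column b of `U ^ 20` is the evolution of column b of the identity.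
  periodic = 20 , s≤s z≤n , λ (u , v) b a∈ _ →
    trans (U^-evolve 20 (u , v) b) (Evolution.period-20 (λ c → I c b) (arcs⁻ a∈))

-- Both directions combined

one-element-Fin : ∀ {k} → (∀ (i j : Fin (suc k)) → i ≡ j) → suc k ≡ 1
one-element-Fin {zero}  _ = refl
one-element-Fin {suc k} h with () ← h zero (suc zero)

theorem5p5 : (R : FinCommRing) (k : ℕ)
    (Rs : Fin (suc k) → FinCommRing)
    (M : (i : Fin (suc k)) → Subset (Rs i))
    (local : ∀ i → IsLocalWith (Rs i) (M i))
    (ψ : (i : Fin (suc k)) → FinCommRing.Carrier R → FinCommRing.Carrier (Rs i))
    (iso : IsProductIso R Rs ψ)
    (ordered : ∀ i j → toℕ i ≤ toℕ j → resSize (Rs j) (M j) ≤ resSize (Rs i) (M i))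
    (mod4 : ∀ i → resSize (Rs i) (M i) % 4 ≡ 1)
    → PeriodicQUCG R ⇔ ((suc k ≡ 1) × ResidueIsoZ5 (Rs zero) (M zero))
theorem5p5 R k Rs M local ψ iso ordered mod4 = mk⇔
  (λ periodic → let open Forward R k Rs M local ψ iso mod4 periodic in
    one-element-Fin single-factor , residueIso zero)
  -- Matching `refl` sets k = 0, so `zero` is the only index and the single clauses below cover all
  -- components.
  (λ { (refl , residue) → let open ResidueIsoZ5 residue in
    PentagonBlowUp.periodic R (φ ∘ ψ zero)
      (residue-hom R (Rs zero) (M zero) residue (IsProductIso.hom iso zero))
      (λ a → let x , φx≡a = surj a
                 y , ψy≡x = IsProductIso.surjective iso λ { zero → x }
             in y , trans (cong φ (ψy≡x zero)) φx≡a)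
      (λ x φψx≢0 → ProductUnits.components⇒Unit R Rs ψ iso λ { zero →
        Ideals.∉M⇒Unit (Rs zero) (local zero) (≢true λ h → φψx≢0 (kernel⁻ (ψ zero x) h)) }) })
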